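{- For every positive integer $k$, there exists an extremal Type~II $\mathbb{Z}_{2k}$-code of length $32$, and there exists an extremal Type~II $\mathbb{Z}_{2k}$-code of length $40$.
   Context: $\mathbb{Z}_m$ denotes the ring of integers modulo $m$. A $\mathbb{Z}_m$-code of length $n$ is a $\mathbb{Z}_m$-submodule of $\mathbb{Z}_m^n$; it is self-dual if $C=C^\perp$, where $C^\perp=\{x\in\mathbb{Z}_m^n : x\cdot y=0 \text{ for all } y\in C\}$ with respect to the standard inner product. The Euclidean weight of $x=(x_1,\dots,x_n)\in\mathbb{Z}_m^n$ is $\sum_{\alpha=1}^{\lfloor m/2\rfloor} n_\alpha(x)\alpha^2$, where $n_\alpha(x)$ is the number of $i$ with $x_i\equiv\pm\alpha \pmod m$; $d_E(C)$ is the minimum Euclidean weight of a nonzero codeword of $C$. A Type~II $\mathbb{Z}_{2k}$-code is a self-dual $\mathbb{Z}_{2k}$-code all of whose codewords have Euclidean weight divisible by $4k$. For a Type~II $\mathbb{Z}_{2k}$-code $C$ of length $n\le 136$ one has $d_E(C)\le 4k\lfloor n/24\rfloor+4k$, and $C$ is called extremal if equality holds. -}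

module Defs where

open import Algebra.Bundles using (CommutativeRing)
open import Algebra.Structures using (IsCommutativeRing)
open import Data.Fin using (Fin; toℕ)
open import Data.Fin.Properties using (_≟_; toℕ-fromℕ<; toℕ-injective; toℕ<n)
open import Data.List using (applyUpTo) renaming (map to mapᴸ)
open import Data.Nat as ℕ using (ℕ; NonZero; _≤_; _^_; _∸_; _%_; _/_)
open import Data.Nat.Divisibility using (_∣_)
open import Data.Nat.DivMod using (_mod_; m<n⇒m%n≡m; m%n<n; %-distribˡ-+; %-distribˡ-*; n%n≡0; m*n%n≡0)
open import Data.Nat.ListAction using (sum)
import Data.Nat.Properties as ℕₚ
open import Data.Product using (_×_; _,_; ∃-syntax)
open import Data.Sum using (_⊎_)
open import Data.Vec using (Vec; count; foldr′; map; replicate; zipWith)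
open import Function using (_⇔_)
open import Level using (0ℓ)
open import Relation.Binary.PropositionalEquality
open import Relation.Nullary using (Dec)
open import Relation.Nullary.Decidable using (_⊎-dec_)
open import Relation.Unary using (Pred)

ℤ/ : ℕ → Set
ℤ/ m = Fin m

module Modular (m : ℕ) .{{_ : NonZero m}} where

  infixl 6 _+_
  infixl 7 _*_
  infix  8 -_

  ⟦_⟧ : ℕ → ℤ/ m
  ⟦ a ⟧ = a mod m

  _+_ _*_ : ℤ/ m → ℤ/ m → ℤ/ m
  x + y = ⟦ toℕ x ℕ.+ toℕ y ⟧
  x * y = ⟦ toℕ x ℕ.* toℕ y ⟧

  -_ : ℤ/ m → ℤ/ m
  - x = ⟦ m ∸ toℕ x ⟧

  0# 1# : ℤ/ m
  0# = ⟦ 0 ⟧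
  1# = ⟦ 1 ⟧

  toℕ-⟦⟧ : ∀ a → toℕ ⟦ a ⟧ ≡ a % m
  toℕ-⟦⟧ a = toℕ-fromℕ< (m%n<n a m)

  ⟦⟧-cong : ∀ {a b} → a % m ≡ b % m → ⟦ a ⟧ ≡ ⟦ b ⟧
  ⟦⟧-cong {a} {b} eq = toℕ-injective (trans (toℕ-⟦⟧ a) (trans eq (sym (toℕ-⟦⟧ b))))

  ⟦toℕ⟧ : ∀ x → ⟦ toℕ x ⟧ ≡ x
  ⟦toℕ⟧ x = toℕ-injective (trans (toℕ-⟦⟧ (toℕ x)) (m<n⇒m%n≡m (toℕ<n x)))

  ⟦⟧-+ : ∀ a b → ⟦ a ⟧ + ⟦ b ⟧ ≡ ⟦ a ℕ.+ b ⟧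
  ⟦⟧-+ a b rewrite toℕ-⟦⟧ a | toℕ-⟦⟧ b = ⟦⟧-cong (sym (%-distribˡ-+ a b m))

  ⟦⟧-* : ∀ a b → ⟦ a ⟧ * ⟦ b ⟧ ≡ ⟦ a ℕ.* b ⟧
  ⟦⟧-* a b rewrite toℕ-⟦⟧ a | toℕ-⟦⟧ b = ⟦⟧-cong (sym (%-distribˡ-* a b m))

  private
    +-⟦⟧ˡ : ∀ a z → ⟦ a ⟧ + z ≡ ⟦ a ℕ.+ toℕ z ⟧
    +-⟦⟧ˡ a z = trans (cong (⟦ a ⟧ +_) (sym (⟦toℕ⟧ z))) (⟦⟧-+ a (toℕ z))

    +-⟦⟧ʳ : ∀ x b → x + ⟦ b ⟧ ≡ ⟦ toℕ x ℕ.+ b ⟧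
    +-⟦⟧ʳ x b = trans (cong (_+ ⟦ b ⟧) (sym (⟦toℕ⟧ x))) (⟦⟧-+ (toℕ x) b)

    *-⟦⟧ˡ : ∀ a z → ⟦ a ⟧ * z ≡ ⟦ a ℕ.* toℕ z ⟧
    *-⟦⟧ˡ a z = trans (cong (⟦ a ⟧ *_) (sym (⟦toℕ⟧ z))) (⟦⟧-* a (toℕ z))

    *-⟦⟧ʳ : ∀ x b → x * ⟦ b ⟧ ≡ ⟦ toℕ x ℕ.* b ⟧
    *-⟦⟧ʳ x b = trans (cong (_* ⟦ b ⟧) (sym (⟦toℕ⟧ x))) (⟦⟧-* (toℕ x) b)

  +-comm : ∀ x y → x + y ≡ y + x
  +-comm x y = cong ⟦_⟧ (ℕₚ.+-comm (toℕ x) (toℕ y))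

  *-comm : ∀ x y → x * y ≡ y * x
  *-comm x y = cong ⟦_⟧ (ℕₚ.*-comm (toℕ x) (toℕ y))

  +-assoc : ∀ x y z → (x + y) + z ≡ x + (y + z)
  +-assoc x y z = trans (+-⟦⟧ˡ _ z)
    (trans (cong ⟦_⟧ (ℕₚ.+-assoc (toℕ x) (toℕ y) (toℕ z))) (sym (+-⟦⟧ʳ x _)))

  *-assoc : ∀ x y z → (x * y) * z ≡ x * (y * z)
  *-assoc x y z = trans (*-⟦⟧ˡ _ z)
    (trans (cong ⟦_⟧ (ℕₚ.*-assoc (toℕ x) (toℕ y) (toℕ z))) (sym (*-⟦⟧ʳ x _)))

  +-identityˡ : ∀ x → 0# + x ≡ x
  +-identityˡ x = trans (+-⟦⟧ˡ 0 x) (⟦toℕ⟧ x)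

  *-identityˡ : ∀ x → 1# * x ≡ x
  *-identityˡ x = trans (*-⟦⟧ˡ 1 x)
    (trans (cong ⟦_⟧ (ℕₚ.*-identityˡ (toℕ x))) (⟦toℕ⟧ x))

  -‿inverseˡ : ∀ x → - x + x ≡ 0#
  -‿inverseˡ x = trans (+-⟦⟧ˡ _ x)
    (trans (cong ⟦_⟧ (ℕₚ.m∸n+n≡m (ℕₚ.<⇒≤ (toℕ<n x))))
           (⟦⟧-cong (trans (n%n≡0 m) (sym (m*n%n≡0 0 m)))))

  *-distribˡ-+ : ∀ x y z → x * (y + z) ≡ x * y + x * z
  *-distribˡ-+ x y z = trans (*-⟦⟧ʳ x _)
    (trans (cong ⟦_⟧ (ℕₚ.*-distribˡ-+ (toℕ x) (toℕ y) (toℕ z))) (sym (⟦⟧-+ _ _)))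

  isCommutativeRing : IsCommutativeRing _≡_ _+_ _*_ -_ 0# 1#
  isCommutativeRing = record
    { isRing = record
      { +-isAbelianGroup = record
        { isGroup = record
          { isMonoid = record
            { isSemigroup = record
              { isMagma = record { isEquivalence = isEquivalence ; ∙-cong = cong₂ _+_ }
              ; assoc = +-assoc
              }
            ; identity = +-identityˡ , λ x → trans (+-comm x 0#) (+-identityˡ x)
            }
          ; inverse = -‿inverseˡ , λ x → trans (+-comm x (- x)) (-‿inverseˡ x)
          ; ⁻¹-cong = cong -_
          }
        ; comm = +-comm
        }
      ; *-cong = cong₂ _*_
      ; *-assoc = *-assoc
      ; *-identity = *-identityˡ , λ x → trans (*-comm x 1#) (*-identityˡ x)
      ; distrib = *-distribˡ-+ , λ x y z → trans (*-comm (y + z) x)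
          (trans (*-distribˡ-+ x y z) (cong₂ _+_ (*-comm x y) (*-comm x z)))
      }
    ; *-comm = *-comm
    }

  commutativeRing : CommutativeRing 0ℓ 0ℓ
  commutativeRing = record { isCommutativeRing = isCommutativeRing }

  infixl 6 _+ᵛ_
  infixl 7 _*ᵛ_ _·_

  0ᵛ : ∀ {n} → Vec (ℤ/ m) n
  0ᵛ = replicate _ 0#

  _+ᵛ_ : ∀ {n} → Vec (ℤ/ m) n → Vec (ℤ/ m) n → Vec (ℤ/ m) n
  _+ᵛ_ = zipWith _+_

  _*ᵛ_ : ∀ {n} → ℤ/ m → Vec (ℤ/ m) n → Vec (ℤ/ m) n
  a *ᵛ x = map (a *_) x

  _·_ : ∀ {n} → Vec (ℤ/ m) n → Vec (ℤ/ m) n → ℤ/ m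
  x · y = foldr′ _+_ 0# (zipWith _*_ x y)

  record Code (n : ℕ) : Set₁ where
    infix 4 _∈C
    field
      _∈C       : Pred (Vec (ℤ/ m) n) 0ℓ
      0-closed  : 0ᵛ ∈C
      +ᵛ-closed : ∀ {x y} → x ∈C → y ∈C → x +ᵛ y ∈C
      *ᵛ-closed : ∀ a {x} → x ∈C → a *ᵛ x ∈C

  open Code using (_∈C)

  infix 4 _∈_
  _∈_ : ∀ {n} → Vec (ℤ/ m) n → Code n → Set
  x ∈ C = _∈C C x

  Dual : ∀ {n} → Code n → Pred (Vec (ℤ/ m) n) 0ℓ
  Dual C x = ∀ y → y ∈ C → x · y ≡ 0#

  SelfDual : ∀ {n} → Code n → Set
  SelfDual C = ∀ x → x ∈ C ⇔ Dual C x

  -- A disjunction, so that a coordinate with α ≡ - α (that is, α = m / 2)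
  -- is counted once.
  _≡±_ : ℤ/ m → ℕ → Set
  a ≡± α = a ≡ ⟦ α ⟧ ⊎ a ≡ - ⟦ α ⟧

  _≡±?_ : ∀ a α → Dec (a ≡± α)
  a ≡±? α = (a ≟ ⟦ α ⟧) ⊎-dec (a ≟ - ⟦ α ⟧)

  n[_] : ∀ {n} → ℕ → Vec (ℤ/ m) n → ℕ
  n[ α ] x = count (_≡±? α) x

  euclideanWeight : ∀ {n} → Vec (ℤ/ m) n → ℕ
  euclideanWeight x = sum (mapᴸ (λ α → n[ α ] x ℕ.* α ^ 2) (applyUpTo ℕ.suc (m / 2)))

  -- d_E(C) = d, as a relation: membership in a code need not be decidable, so
  -- the minimum is not given by a function.
  MinEuclideanWeight : ∀ {n} → Code n → ℕ → Set
  MinEuclideanWeight C d =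
      (∃[ x ] x ∈ C × x ≢ 0ᵛ × euclideanWeight x ≡ d)
    × (∀ x → x ∈ C → x ≢ 0ᵛ → d ≤ euclideanWeight x)

module _ (k : ℕ) .{{_ : NonZero k}} where

  open Modular (2 ℕ.* k) {{ℕₚ.m*n≢0 2 k}}

  record TypeII (n : ℕ) : Set₁ where
    field
      code             : Code n
      selfDual         : SelfDual code
      4k∣euclideanWeight : ∀ x → x ∈ code → 4 ℕ.* k ∣ euclideanWeight x

  record Extremal {n : ℕ} (C : TypeII n) : Set where
    open TypeII C
    field
      n≤136 : n ≤ 136
      d_E≡  : MinEuclideanWeight code (4 ℕ.* k ℕ.* (n / 24) ℕ.+ 4 ℕ.* k)

{-# OPTIONS --safe #-}

-- Let L be an even unimodular lattice of rank n and minimum norm 4, and let the rows of F be n orthogonal vectors of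
-- norm 2k of L.  The c ∈ ℤⁿ with cF/2k ∈ L form modulo 2k a Type II code, and c has norm 2k times that of cF/2k, so
-- the code has minimum Euclidean weight 8k for k ≥ 2.
--
-- Let C₁ be a doubly even binary code of minimum weight at least 16, containing the all-ones word, whose dual has
-- minimum weight 4, and let G be a lift of its generators with GGᵗ ≡ 0 modulo 4 and norms ≡ 0 modulo 8.  Then
-- L = {(aG + 2u)/2 : u modulo 2 in C₁⊥} is as required, and it contains the integral vectors that lie in C₁⊥ modulo 2.
-- So the matrices F = 2(a + bX + cY + dZ) + eU have rows in L if U does modulo 2, and FFᵗ = 4(a² + b² + c² + d²) + 6e²
-- if X, Y, Z are skew signed permutations, U is skew with UUᵗ = 6, and all of these anticommute.  By Lagrange's theorem
-- this scalar takes the values 4j (with e = 0) and 6 + 4j (with e = 1), that is, every 2k with k ≥ 2.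
--
-- For k = 1 the code is an extremal double circulant binary code.

module Submission where

open import Defs
open import Data.Bool as Bool using (Bool; true; false; not; _∧_; _∨_; _xor_; if_then_else_)
open import Data.Bool.ListAction using (any)
import Data.Bool.Properties as Boolₚ
open import Data.Fin as Fin using (Fin; zero; suc; toℕ)
import Data.Fin.Properties as Finₚ
open import Data.Integer as ℤ using (ℤ; +_; -[1+_]; ∣_∣; _+_; _*_; -_; _-_; _≤_; _<_; +≤+; +<+)
open import Data.Integer.DivMod using (_%ℕ_; _/ℕ_; a≡a%ℕn+[a/ℕn]*n; n%ℕd<d)
open import Data.Integer.Divisibility.Signed
import Data.Integer.Properties as ℤₚ
open import Algebra.Properties.Semiring.Sum ℤₚ.+-*-semiring
  using (sum; sum-cong-≗; ∑-distrib-+; ∑-comm; *-distribˡ-sum; *-distribʳ-sum)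
open import Data.Integer.Tactic.RingSolver using (solve-∀)
open import Data.List using (List; []; _∷_; applyUpTo) renaming (map to mapᴸ)
open import Data.List.Relation.Unary.All using (All; []; _∷_)
open import Data.Nat as ℕ using (ℕ; NonZero; _^_; _∸_; _%_; _/_; z≤n; s≤s)
import Data.Nat.DivMod as ℕ÷
import Data.Nat.Divisibility as ℕ∣
open import Data.Nat.Induction using (<-wellFounded)
open import Data.Nat.ListAction using () renaming (sum to sumᴸ; product to ℕ-product)
open import Data.Nat.Primality using (Prime; prime⇒irreducible; prime⇒nonTrivial; euclidsLemma)
open import Data.Nat.Primality.Factorisation using (PrimeFactorisation; factorise)
import Data.Nat.Properties as ℕₚ
open import Data.Product using (_×_; _,_; ∃; ∃-syntax; proj₁; proj₂)
open import Data.Sum as Sum using (_⊎_; inj₁; inj₂)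
open import Data.Vec as Vec using (Vec; []; _∷_; lookup; map; replicate; tabulate; zipWith)
import Data.Vec.Properties as Vecₚ
open import Function using (_∘_; id; mk⇔)
open import Induction.WellFounded using (Acc; acc)
open import Relation.Binary.PropositionalEquality
open import Relation.Nullary using (¬_; Dec; yes; no; does; contradiction)
open import Relation.Nullary.Decidable using (toWitness)

-- Why 6: the factor 2 before the four signed permutations puts their rows into C₁⊥ modulo 2
-- whatever the coefficients are, but then only multiples of 4 occur as norms. For 2k ≡ 2 modulo 4 a
-- further summand is needed whose rows lie in C₁⊥ modulo 2 by themselves. A row of norm 2 would be
-- a word of weight 2 in a code of minimum weight 4, so 6 is the least norm available. The value 2k
-- = 2 is missed of necessity: L has no vectors of norm 2, hence no such frame.
--
-- Equality in the bound needs a vector of norm 4 of L that is not an integral combination zF, since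
-- zF corresponds to the zero word 2kz. For even k the chosen frames have only even entries, so any
-- vector of norm 4 with an odd entry will do; for odd k ≥ 3 the norms alone exclude such a
-- combination.
--
-- Vectors of L are doubled throughout: divisibility by 4 and by 8 and the bound 16 stand for
-- integrality, evenness and minimum norm 4.

-- Integral vectors and divisibility of their inner products

ℤ^_ : ℕ → Set
ℤ^ n = Fin n → ℤ

infix 7 _∙_
_∙_ : ∀ {n} → ℤ^ n → ℤ^ n → ℤ
x ∙ y = sum (λ i → x i * y i)

infix 8 _ᵗ
_ᵗ : ∀ {r n} → (Fin r → ℤ^ n) → (Fin n → ℤ^ r)
(G ᵗ) j i = G i j

infixl 7 _⊛_
_⊛_ : ∀ {r n} → ℤ^ r → (Fin r → ℤ^ n) → ℤ^ n
(a ⊛ G) j = sum (λ i → a i * G i j)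

δ : ∀ {n} → Fin n → Fin n → ℤ
δ zero    zero    = + 1
δ zero    (suc _) = + 0
δ (suc _) zero    = + 0
δ (suc i) (suc j) = δ i j

sum-0 : ∀ {n} (f : ℤ^ n) → (∀ i → f i ≡ + 0) → sum f ≡ + 0
sum-0 {ℕ.zero}  f eq = refl
sum-0 {ℕ.suc n} f eq = cong₂ _+_ (eq zero) (sum-0 (f ∘ suc) (eq ∘ suc))

∙-δ : ∀ {n} (x : ℤ^ n) j → x ∙ δ j ≡ x j
∙-δ {ℕ.suc n} x zero    = trans (cong₂ _+_ (ℤₚ.*-identityʳ (x zero)) (sum-0 _ (λ i → ℤₚ.*-zeroʳ (x (suc i))))) (ℤₚ.+-identityʳ (x zero))
∙-δ {ℕ.suc n} x (suc j) = trans (cong₂ _+_ (ℤₚ.*-zeroʳ (x zero)) (∙-δ (x ∘ suc) j)) (ℤₚ.+-identityˡ _)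

δ-sym : ∀ {n} (i j : Fin n) → δ i j ≡ δ j i
δ-sym zero    zero    = refl
δ-sym zero    (suc _) = refl
δ-sym (suc _) zero    = refl
δ-sym (suc i) (suc j) = δ-sym i j

∙-cong : ∀ {n} {x x′ y y′ : ℤ^ n} → (∀ i → x i ≡ x′ i) → (∀ i → y i ≡ y′ i) → x ∙ y ≡ x′ ∙ y′
∙-cong p q = sum-cong-≗ (λ i → cong₂ _*_ (p i) (q i))

∙-congˡ : ∀ {n} (x : ℤ^ n) {y y′ : ℤ^ n} → (∀ i → y i ≡ y′ i) → x ∙ y ≡ x ∙ y′
∙-congˡ x q = sum-cong-≗ (λ i → cong (_*_ (x i)) (q i))

∙-comm : ∀ {n} (x y : ℤ^ n) → x ∙ y ≡ y ∙ x
∙-comm x y = sum-cong-≗ (λ i → ℤₚ.*-comm (x i) (y i))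

∙-+ˡ : ∀ {n} (x y z : ℤ^ n) → (λ i → x i + y i) ∙ z ≡ x ∙ z + y ∙ z
∙-+ˡ x y z = trans (sum-cong-≗ (λ i → ℤₚ.*-distribʳ-+ (z i) (x i) (y i))) (∑-distrib-+ (λ i → x i * z i) (λ i → y i * z i))

∙-*ˡ : ∀ {n} a (x y : ℤ^ n) → (λ i → a * x i) ∙ y ≡ a * (x ∙ y)
∙-*ˡ a x y = trans (sum-cong-≗ (λ i → ℤₚ.*-assoc a (x i) (y i))) (sym (*-distribˡ-sum a (λ i → x i * y i)))

∙-+ʳ : ∀ {n} (x y z : ℤ^ n) → x ∙ (λ i → y i + z i) ≡ x ∙ y + x ∙ z
∙-+ʳ x y z = trans (∙-comm x _) (trans (∙-+ˡ y z x) (cong₂ _+_ (∙-comm y x) (∙-comm z x)))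

∙-*ʳ : ∀ {n} a (x y : ℤ^ n) → x ∙ (λ i → a * y i) ≡ a * (x ∙ y)
∙-*ʳ a x y = trans (∙-comm x _) (trans (∙-*ˡ a y x) (cong (_*_ a) (∙-comm y x)))

∙--ʳ : ∀ {n} (x y z : ℤ^ n) → x ∙ (λ i → y i - z i) ≡ x ∙ y - x ∙ z
∙--ʳ x y z = trans (∙-congˡ x (λ i → cong (_+_ (y i)) (sym (ℤₚ.-1*i≡-i (z i)))))
  (trans (∙-+ʳ x y _) (cong (_+_ (x ∙ y)) (trans (∙-*ʳ -[1+ 0 ] x z) (ℤₚ.-1*i≡-i (x ∙ z)))))

⊛-∙ : ∀ {r n} (a : ℤ^ r) (G : Fin r → ℤ^ n) (y : ℤ^ n) → (a ⊛ G) ∙ y ≡ a ∙ (λ i → G i ∙ y)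
⊛-∙ a G y = begin
  sum (λ j → sum (λ i → a i * G i j) * y j)    ≡⟨ sum-cong-≗ (λ j → *-distribʳ-sum (y j) (λ i → a i * G i j)) ⟩
  sum (λ j → sum (λ i → a i * G i j * y j))    ≡⟨ ∑-comm (λ j i → a i * G i j * y j) ⟩
  sum (λ i → sum (λ j → a i * G i j * y j))    ≡⟨ sum-cong-≗ (λ i → sum-cong-≗ (λ j → ℤₚ.*-assoc (a i) (G i j) (y j))) ⟩
  sum (λ i → sum (λ j → a i * (G i j * y j)))  ≡⟨ sum-cong-≗ (λ i → *-distribˡ-sum (a i) (λ j → G i j * y j)) ⟨
  sum (λ i → a i * (G i ∙ y))                  ∎
  where open ≡-Reasoning

∙-⊛ : ∀ {r n} (a : ℤ^ r) (G : Fin r → ℤ^ n) (y : ℤ^ n) → y ∙ (a ⊛ G) ≡ a ∙ (λ i → y ∙ G i)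
∙-⊛ a G y = trans (∙-comm y (a ⊛ G)) (trans (⊛-∙ a G y) (∙-congˡ a (λ i → ∙-comm (G i) y)))

⊛-+ : ∀ {r n} (a b : ℤ^ r) (G : Fin r → ℤ^ n) j → ((λ i → a i + b i) ⊛ G) j ≡ (a ⊛ G) j + (b ⊛ G) j
⊛-+ a b G j = ∙-+ˡ a b (λ i → G i j)

⊛-* : ∀ {r n} c (a : ℤ^ r) (G : Fin r → ℤ^ n) j → ((λ i → c * a i) ⊛ G) j ≡ c * (a ⊛ G) j
⊛-* c a G j = ∙-*ˡ c a (λ i → G i j)

⊛-cong : ∀ {r n} {a b : ℤ^ r} (G : Fin r → ℤ^ n) → (∀ i → a i ≡ b i) → ∀ j → (a ⊛ G) j ≡ (b ⊛ G) j
⊛-cong G eq j = ∙-cong eq (λ _ → refl)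

∣-sum : ∀ {d n} (f : ℤ^ n) → (∀ i → d ∣ f i) → d ∣ sum f
∣-sum {d} {ℕ.zero}  f df = divides (+ 0) refl
∣-sum {d} {ℕ.suc n} f df = ∣m∣n⇒∣m+n (df zero) (∣-sum (f ∘ suc) (df ∘ suc))

∣-∙ʳ : ∀ {d n} (x y : ℤ^ n) → (∀ i → d ∣ y i) → d ∣ x ∙ y
∣-∙ʳ x y dy = ∣-sum _ (λ i → ∣n⇒∣m*n (x i) (dy i))

∣-∙ˡ : ∀ {d n} (x y : ℤ^ n) → (∀ i → d ∣ x i) → d ∣ x ∙ y
∣-∙ˡ x y dx = ∣-sum _ (λ i → ∣m⇒∣m*n (y i) (dx i))

0≤square : ∀ z → + 0 ≤ z * z
0≤square (+ a)    = subst (+ 0 ≤_) (ℤₚ.pos-* a a) (+≤+ z≤n)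
0≤square -[1+ a ] = +≤+ z≤n

sum-nonneg : ∀ {n} (f : ℤ^ n) → (∀ i → + 0 ≤ f i) → + 0 ≤ sum f
sum-nonneg {ℕ.zero}  f f≥0 = ℤₚ.≤-refl
sum-nonneg {ℕ.suc n} f f≥0 = ℤₚ.+-mono-≤ (f≥0 zero) (sum-nonneg (f ∘ suc) (f≥0 ∘ suc))

sum-nonneg≡0 : ∀ {n} (f : ℤ^ n) → (∀ i → + 0 ≤ f i) → sum f ≡ + 0 → ∀ i → f i ≡ + 0
sum-nonneg≡0 {ℕ.suc n} f f≥0 eq zero    = ℤₚ.≤-antisym
  (subst₂ _≤_ (ℤₚ.+-identityʳ (f zero)) eq (ℤₚ.+-monoʳ-≤ (f zero) (sum-nonneg (f ∘ suc) (f≥0 ∘ suc)))) (f≥0 zero)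
sum-nonneg≡0 {ℕ.suc n} f f≥0 eq (suc i) = sum-nonneg≡0 (f ∘ suc) (f≥0 ∘ suc) (ℤₚ.≤-antisym
  (subst₂ _≤_ (ℤₚ.+-identityˡ (sum (f ∘ suc))) eq (ℤₚ.+-monoˡ-≤ (sum (f ∘ suc)) (f≥0 zero))) (sum-nonneg (f ∘ suc) (f≥0 ∘ suc))) i

0≤norm : ∀ {n} (x : ℤ^ n) → + 0 ≤ x ∙ x
0≤norm x = sum-nonneg _ (λ i → 0≤square (x i))

norm≡0⇒≡0 : ∀ {n} (x : ℤ^ n) → x ∙ x ≡ + 0 → ∀ i → x i ≡ + 0
norm≡0⇒≡0 x eq i = Sum.[ id , id ] (ℤₚ.i*j≡0⇒i≡0∨j≡0 (x i) (sum-nonneg≡0 (λ i → x i * x i) (λ i → 0≤square (x i)) eq i))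

sum-mono-≤ : ∀ {n} (f g : ℤ^ n) → (∀ i → f i ≤ g i) → sum f ≤ sum g
sum-mono-≤ {ℕ.zero}  f g le = ℤₚ.≤-refl
sum-mono-≤ {ℕ.suc n} f g le = ℤₚ.+-mono-≤ (le zero) (sum-mono-≤ (f ∘ suc) (g ∘ suc) (le ∘ suc))

square-mono : ∀ {x y} → ∣ x ∣ ℕ.≤ ∣ y ∣ → x * x ≤ y * y
square-mono {x} {y} le = subst₂ _≤_ (square x) (square y) (+≤+ (ℕₚ.*-mono-≤ le le))
  where
  square : ∀ z → + (∣ z ∣ ℕ.* ∣ z ∣) ≡ z * z
  square (+ a)    = ℤₚ.pos-* a a
  square -[1+ a ] = refl

norm-+ : ∀ {n} (x y : ℤ^ n) → (λ i → x i + y i) ∙ (λ i → x i + y i) ≡ x ∙ x + + 2 * (x ∙ y) + y ∙ y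
norm-+ x y = begin
  (λ i → x i + y i) ∙ (λ i → x i + y i)                            ≡⟨ ∙-+ˡ x y _ ⟩
  x ∙ (λ i → x i + y i) + y ∙ (λ i → x i + y i)                    ≡⟨ cong₂ _+_ (∙-+ʳ x x y) (trans (∙-+ʳ y x y) (cong (_+ y ∙ y) (∙-comm y x))) ⟩
  x ∙ x + x ∙ y + (x ∙ y + y ∙ y)                                  ≡⟨ collect (x ∙ x) (x ∙ y) (y ∙ y) ⟩
  x ∙ x + + 2 * (x ∙ y) + y ∙ y                                    ∎
  where
  open ≡-Reasoning
  collect : ∀ a b c → a + b + (b + c) ≡ a + + 2 * b + c
  collect = solve-∀

norm-* : ∀ {n} c (x : ℤ^ n) → (λ i → c * x i) ∙ (λ i → c * x i) ≡ c * c * (x ∙ x)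
norm-* c x = trans (∙-*ˡ c x _) (trans (cong (_*_ c) (∙-*ʳ c x x)) (sym (ℤₚ.*-assoc c c (x ∙ x))))

∣-⊛∙ : ∀ {d r n} (a : ℤ^ r) (G : Fin r → ℤ^ n) y → (∀ i → d ∣ G i ∙ y) → d ∣ (a ⊛ G) ∙ y
∣-⊛∙ {d} a G y dG = subst (d ∣_) (sym (⊛-∙ a G y)) (∣-∙ʳ a _ dG)

∣-⊛∙⊛ : ∀ {d r n} (a b : ℤ^ r) (G : Fin r → ℤ^ n) → (∀ i j → d ∣ G i ∙ G j) → d ∣ (a ⊛ G) ∙ (b ⊛ G)
∣-⊛∙⊛ {d} a b G dG = ∣-⊛∙ a G (b ⊛ G) λ i → subst (d ∣_) (∙-comm (b ⊛ G) (G i)) (∣-⊛∙ b G (G i) λ j → dG j i)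

-- In the expansion of the norm every cross term occurs twice, so divisibility by `d` suffices for
-- the products of distinct rows; only the norms of the rows must be divisible by `2d`.
2d∣norm : ∀ {d r n} (a : ℤ^ r) (G : Fin r → ℤ^ n) →
  (∀ i j → d ∣ G i ∙ G j) → (∀ i → + 2 * d ∣ G i ∙ G i) → + 2 * d ∣ (a ⊛ G) ∙ (a ⊛ G)
2d∣norm {d} {ℕ.zero}  {n} a G dG 2dG = subst (+ 2 * d ∣_) (sym (sum-0 {n} _ (λ _ → refl))) (divides (+ 0) refl)
2d∣norm {d} {ℕ.suc r} a G dG 2dG = subst (+ 2 * d ∣_) (sym (norm-+ (λ j → a zero * G zero j) rest))
  (∣m∣n⇒∣m+n (∣m∣n⇒∣m+n
    (subst (+ 2 * d ∣_) (sym (norm-* (a zero) (G zero))) (∣n⇒∣m*n (a zero * a zero) (2dG zero)))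
    (*-monoʳ-∣ (+ 2) (subst (d ∣_) (sym (∙-*ˡ (a zero) (G zero) rest)) (∣n⇒∣m*n (a zero)
      (subst (d ∣_) (∙-comm rest (G zero)) (∣-⊛∙ (a ∘ suc) (G ∘ suc) (G zero) λ i → dG (suc i) zero))))))
    (2d∣norm (a ∘ suc) (G ∘ suc) (λ i j → dG (suc i) (suc j)) (2dG ∘ suc)))
  where rest = (a ∘ suc) ⊛ (G ∘ suc)

-- The preimage in ℤⁿ of a Type II code over ℤ/2k with minimum Euclidean weight 8k.
record ExtremalPreimage (k n : ℕ) : Set₁ where
  field
    Mem           : ℤ^ n → Set
    Mem-cong      : ∀ {x y} → (∀ i → x i ≡ y i) → Mem x → Mem y
    Mem-+         : ∀ {x y} → Mem x → Mem y → Mem (λ i → x i + y i)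
    Mem-*         : ∀ a {x} → Mem x → Mem (λ i → a * x i)
    Mem-2k        : ∀ (z : ℤ^ n) → Mem (λ i → z i * + (2 ℕ.* k))
    selfOrthogonal : ∀ {x y} → Mem x → Mem y → + (2 ℕ.* k) ∣ x ∙ y
    dual⇒Mem      : ∀ x → (∀ y → Mem y → + (2 ℕ.* k) ∣ x ∙ y) → Mem x
    doublyEven    : ∀ {x} → Mem x → + (4 ℕ.* k) ∣ x ∙ x
    minimum       : ∀ {x} → Mem x → ¬ (∀ i → + (2 ℕ.* k) ∣ x i) → + (8 ℕ.* k) ≤ x ∙ x
    attained      : ∃[ x ] Mem x × ¬ (∀ i → + (2 ℕ.* k) ∣ x i) × x ∙ x ≡ + (8 ℕ.* k)

-- Residues and Euclidean weights

module Reduction (k : ℕ) .{{_ : NonZero k}} where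

  m : ℕ
  m = 2 ℕ.* k

  instance
    m≢0 : NonZero m
    m≢0 = ℕₚ.m*n≢0 2 k

  open Modular (2 ℕ.* k) {{ℕₚ.m*n≢0 2 k}} public
    hiding (+-comm; *-comm; +-assoc; *-assoc; +-identityˡ; *-identityˡ; *-distribˡ-+)
    renaming (_+_ to _+ᵐ_; _*_ to _*ᵐ_; -_ to -ᵐ_)

  lift₁ : ℤ/ m → ℤ
  lift₁ a = + toℕ a

  reduce₁ : ℤ → ℤ/ m
  reduce₁ z = ⟦ z %ℕ m ⟧

  lift : ∀ {n} → Vec (ℤ/ m) n → ℤ^ n
  lift x i = lift₁ (lookup x i)

  reduce : ∀ {n} → ℤ^ n → Vec (ℤ/ m) n
  reduce z = tabulate (reduce₁ ∘ z)

  lift₁-⟦⟧ : ∀ a → + m ∣ + a - lift₁ ⟦ a ⟧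
  lift₁-⟦⟧ a rewrite toℕ-⟦⟧ a = divides (+ (a / m)) (begin
    + a - + (a % m)                          ≡⟨ cong (λ b → + b - + (a % m)) (ℕ÷.m≡m%n+[m/n]*n a m) ⟩
    + (a % m ℕ.+ (a / m) ℕ.* m) - + (a % m)  ≡⟨ cong (_- + (a % m)) (trans (ℤₚ.pos-+ (a % m) _) (cong (_+_ (+ (a % m))) (ℤₚ.pos-* (a / m) m))) ⟩
    + (a % m) + + (a / m) * + m - + (a % m)  ≡⟨ x+y-x (+ (a % m)) _ ⟩
    + (a / m) * + m ∎)
    where
    open ≡-Reasoning
    x+y-x : ∀ x y → x + y - x ≡ y
    x+y-x = solve-∀

  lift₁-reduce₁ : ∀ z → + m ∣ z - lift₁ (reduce₁ z)
  lift₁-reduce₁ z = subst (+ m ∣_) (sym eq)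
    (∣m∣n⇒∣m+n (lift₁-⟦⟧ (z %ℕ m)) (divides (z /ℕ m) refl))
    where
    swap : ∀ x y w → x + y - w ≡ x - w + y
    swap = solve-∀
    eq : z - lift₁ (reduce₁ z) ≡ (+ (z %ℕ m) - lift₁ (reduce₁ z)) + (z /ℕ m) * + m
    eq = trans (cong (_- lift₁ (reduce₁ z)) (a≡a%ℕn+[a/ℕn]*n z m))
               (swap (+ (z %ℕ m)) ((z /ℕ m) * + m) (lift₁ (reduce₁ z)))

  ⟦⟧≡0⇒∣ : ∀ {a} → ⟦ a ⟧ ≡ 0# → m ℕ∣.∣ a
  ⟦⟧≡0⇒∣ {a} eq = ℕ∣.m%n≡0⇒n∣m a m
    (trans (sym (toℕ-⟦⟧ a)) (trans (cong toℕ eq) (trans (toℕ-⟦⟧ 0) (ℕ÷.m*n%n≡0 0 m))))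

  ∣⇒⟦⟧≡0 : ∀ {a} → m ℕ∣.∣ a → ⟦ a ⟧ ≡ 0#
  ∣⇒⟦⟧≡0 {a} m∣a = ⟦⟧-cong (trans (ℕ∣.n∣m⇒m%n≡0 a m m∣a) (sym (ℕ÷.m*n%n≡0 0 m)))

  ∣lift₁⇒≡0 : ∀ a → + m ∣ lift₁ a → a ≡ 0#
  ∣lift₁⇒≡0 a m∣a = trans (sym (⟦toℕ⟧ a)) (∣⇒⟦⟧≡0 (∣⇒∣ᵤ m∣a))

  ·-lift : ∀ {n} (x y : Vec (ℤ/ m) n) → ∃[ N ] (x · y ≡ ⟦ N ⟧ × lift x ∙ lift y ≡ + N)
  ·-lift []      []      = 0 , refl , refl
  ·-lift (a ∷ x) (b ∷ y) with ·-lift x y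
  ... | N , eq , eq′ = toℕ a ℕ.* toℕ b ℕ.+ N
    , trans (cong (a *ᵐ b +ᵐ_) eq) (⟦⟧-+ (toℕ a ℕ.* toℕ b) N)
    , trans (cong₂ _+_ (sym (ℤₚ.pos-* (toℕ a) (toℕ b))) eq′) (sym (ℤₚ.pos-+ _ N))

  ·≡0⇒∣ : ∀ {n} (x y : Vec (ℤ/ m) n) → x · y ≡ 0# → + m ∣ lift x ∙ lift y
  ·≡0⇒∣ x y eq with ·-lift x y
  ... | N , p , q = subst (+ m ∣_) (sym q) (∣ᵤ⇒∣ (⟦⟧≡0⇒∣ (trans (sym p) eq)))

  ∣⇒·≡0 : ∀ {n} (x y : Vec (ℤ/ m) n) → + m ∣ lift x ∙ lift y → x · y ≡ 0#
  ∣⇒·≡0 x y d with ·-lift x y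
  ... | N , p , q = trans p (∣⇒⟦⟧≡0 (∣⇒∣ᵤ (subst (+ m ∣_) q d)))

  -- The representative in (-k, k], whose absolute value is the α under which the coordinate is
  -- counted in the Euclidean weight.
  balanced : ℤ/ m → ℤ
  balanced a with toℕ a ℕ.≤? k
  ... | yes _ = + toℕ a
  ... | no  _ = + toℕ a - + m

  balanced≡ : ∀ a → + m ∣ balanced a - lift₁ a
  balanced≡ a with toℕ a ℕ.≤? k
  ... | yes _ = divides (+ 0) (ℤₚ.+-inverseʳ (+ toℕ a))
  ... | no  _ = divides -[1+ 0 ] (x-y-x (+ toℕ a) (+ m))
    where
    x-y-x : ∀ x y → x - y - x ≡ -[1+ 0 ] * y
    x-y-x = solve-∀

  ∥_∥ : ℤ/ m → ℕ
  ∥ a ∥ = ∣ balanced a ∣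

  k+k≡m : k ℕ.+ k ≡ m
  k+k≡m = cong (k ℕ.+_) (sym (ℕₚ.+-identityʳ k))

  toℕ≤m : (a : ℤ/ m) → toℕ a ℕ.≤ m
  toℕ≤m a = ℕₚ.<⇒≤ (Finₚ.toℕ<n a)

  ∣a-m∣ : ∀ (a : ℤ/ m) → ∣ + toℕ a - + m ∣ ≡ m ∸ toℕ a
  ∣a-m∣ a = trans (cong ∣_∣ (ℤₚ.m-n≡m⊖n (toℕ a) m)) (ℤₚ.∣⊖∣-≤ (toℕ≤m a))

  ∥∥-cases : ∀ a → (∥ a ∥ ≡ toℕ a × toℕ a ℕ.≤ m ∸ toℕ a) ⊎ (∥ a ∥ ≡ m ∸ toℕ a × m ∸ toℕ a ℕ.≤ toℕ a)
  ∥∥-cases a with toℕ a ℕ.≤? k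
  ... | yes p = inj₁ (refl , ℕₚ.m+n≤o⇒m≤o∸n (toℕ a) (subst (toℕ a ℕ.+ toℕ a ℕ.≤_) k+k≡m (ℕₚ.+-mono-≤ p p)))
  ... | no ¬p = inj₂ (∣a-m∣ a , ℕₚ.m≤n+o⇒m∸n≤o m (toℕ a)
      (subst (ℕ._≤ toℕ a ℕ.+ toℕ a) k+k≡m (ℕₚ.+-mono-≤ (ℕₚ.≰⇒≥ ¬p) (ℕₚ.≰⇒≥ ¬p))))

  ∥∥≤toℕ : ∀ a → ∥ a ∥ ℕ.≤ toℕ a
  ∥∥≤toℕ a with ∥∥-cases a
  ... | inj₁ (eq , _) = ℕₚ.≤-reflexive eq
  ... | inj₂ (eq , q) = subst (ℕ._≤ toℕ a) (sym eq) q

  ∥∥≤m∸toℕ : ∀ a → ∥ a ∥ ℕ.≤ m ∸ toℕ a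
  ∥∥≤m∸toℕ a with ∥∥-cases a
  ... | inj₁ (eq , q) = subst (ℕ._≤ m ∸ toℕ a) (sym eq) q
  ... | inj₂ (eq , _) = ℕₚ.≤-reflexive eq

  ∥∥≤k : ∀ a → ∥ a ∥ ℕ.≤ k
  ∥∥≤k a with toℕ a ℕ.≤? k
  ... | yes p = p
  ... | no ¬p = subst (ℕ._≤ k) (sym (∣a-m∣ a)) (ℕₚ.m≤n+o⇒m∸n≤o m (toℕ a)
      (subst (ℕ._≤ toℕ a ℕ.+ k) k+k≡m (ℕₚ.+-monoˡ-≤ k (ℕₚ.≰⇒≥ ¬p))))

  -- An integer congruent to `a` is `toℕ a + q m`. For q ≥ 0 its absolute value is at least `toℕ a`,
  -- for q < 0 at least `m ∸ toℕ a`, and `∥ a ∥` exceeds neither.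
  ∥∥-minimal : ∀ a z → + m ∣ z - lift₁ a → ∥ a ∥ ℕ.≤ ∣ z ∣
  ∥∥-minimal a z (divides q eq) = helper q (trans (x≡y+[x-y] z (lift₁ a)) (cong (_+_ (lift₁ a)) eq))
    where
    x≡y+[x-y] : ∀ x y → x ≡ y + (x - y)
    x≡y+[x-y] = solve-∀
    negate : ∀ x y w → - (x + (- (+ 1 + w)) * y) ≡ y - x + w * y
    negate = solve-∀
    helper : ∀ q → z ≡ lift₁ a + q * + m → ∥ a ∥ ℕ.≤ ∣ z ∣
    helper (+ q) eq = ℕₚ.≤-trans (∥∥≤toℕ a) (subst (λ w → toℕ a ℕ.≤ ∣ w ∣)
      (sym (trans eq (trans (cong (_+_ (lift₁ a)) (sym (ℤₚ.pos-* q m))) (sym (ℤₚ.pos-+ (toℕ a) _)))))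
      (ℕₚ.m≤m+n (toℕ a) (q ℕ.* m)))
    helper -[1+ q ] eq = ℕₚ.≤-trans (∥∥≤m∸toℕ a) (subst (m ∸ toℕ a ℕ.≤_) (sym ∣z∣)
      (ℕₚ.m≤m+n (m ∸ toℕ a) (q ℕ.* m)))
      where
      open ≡-Reasoning
      ∣z∣ : ∣ z ∣ ≡ (m ∸ toℕ a) ℕ.+ q ℕ.* m
      ∣z∣ = begin
        ∣ z ∣                                    ≡⟨ ℤₚ.∣-i∣≡∣i∣ z ⟨
        ∣ - z ∣                                  ≡⟨ cong (∣_∣ ∘ -_) eq ⟩
        ∣ - (lift₁ a + -[1+ q ] * + m) ∣         ≡⟨ cong ∣_∣ (negate (lift₁ a) (+ m) (+ q)) ⟩
        ∣ + m - + toℕ a + + q * + m ∣            ≡⟨ cong (λ w → ∣ w + + q * + m ∣) (trans (ℤₚ.m-n≡m⊖n m (toℕ a)) (ℤₚ.⊖-≥ (toℕ≤m a))) ⟩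
        ∣ + (m ∸ toℕ a) + + q * + m ∣            ≡⟨ cong (λ w → ∣ + (m ∸ toℕ a) + w ∣) (ℤₚ.pos-* q m) ⟨
        (m ∸ toℕ a) ℕ.+ q ℕ.* m ∎

  toℕ-⟦⟧-small : ∀ α → α ℕ.≤ k → toℕ ⟦ α ⟧ ≡ α
  toℕ-⟦⟧-small α α≤k = trans (toℕ-⟦⟧ α) (ℕ÷.m<n⇒m%n≡m (ℕₚ.≤-<-trans α≤k k<m))
    where
    k<m : k ℕ.< m
    k<m = subst (k ℕ.<_) k+k≡m (ℕₚ.m<m+n k (ℕ.>-nonZero⁻¹ k))

  toℕ--⟦⟧ : ∀ α → 1 ℕ.≤ α → α ℕ.≤ k → toℕ (-ᵐ ⟦ α ⟧) ≡ m ∸ α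
  toℕ--⟦⟧ α 1≤α α≤k = trans (toℕ-⟦⟧ (m ∸ toℕ ⟦ α ⟧)) (trans (cong (λ b → (m ∸ b) % m) (toℕ-⟦⟧-small α α≤k))
    (ℕ÷.m<n⇒m%n≡m (ℕₚ.∸-monoʳ-< 1≤α (ℕₚ.≤-trans α≤k (subst (k ℕ.≤_) k+k≡m (ℕₚ.m≤m+n k k))))))

  ∥∥-≡± : ∀ a α → 1 ℕ.≤ α → α ℕ.≤ k → a ≡± α → ∥ a ∥ ≡ α
  ∥∥-≡± a α 1≤α α≤k (inj₁ eq) with toℕ a ℕ.≤? k | trans (cong toℕ eq) (toℕ-⟦⟧-small α α≤k)
  ... | yes _ | eq′ = eq′
  ... | no ¬p | eq′ = contradiction (subst (ℕ._≤ k) (sym eq′) α≤k) ¬p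
  ∥∥-≡± a α 1≤α α≤k (inj₂ eq) with toℕ a ℕ.≤? k | trans (cong toℕ eq) (toℕ--⟦⟧ α 1≤α α≤k)
  ... | no _  | eq′ = trans (∣a-m∣ a) (trans (cong (m ∸_) eq′) (ℕₚ.m∸[m∸n]≡n (ℕₚ.≤-trans α≤k (subst (k ℕ.≤_) k+k≡m (ℕₚ.m≤m+n k k)))))
  -- Here both α and m - α are at most k, which forces α = k, the one nonzero residue that equals
  -- its negative.
  ... | yes p | eq′ = trans eq′ (trans (cong (m ∸_) α≡k) (trans (cong (_∸ k) (sym k+k≡m)) (trans (ℕₚ.m+n∸n≡m k k) (sym α≡k))))
    where
    α≡k : α ≡ k
    α≡k = ℕₚ.≤-antisym α≤k (ℕₚ.+-cancelʳ-≤ k k α (subst (ℕ._≤ α ℕ.+ k) (sym k+k≡m)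
      (ℕₚ.≤-trans (ℕₚ.m≤n+m∸n m α) (ℕₚ.+-monoʳ-≤ α (subst (ℕ._≤ k) eq′ p)))))

  ≡±-∥∥ : ∀ a α → 1 ℕ.≤ α → α ℕ.≤ k → ∥ a ∥ ≡ α → a ≡± α
  ≡±-∥∥ a α 1≤α α≤k eq with ∥∥-cases a
  ... | inj₁ (p , _) = inj₁ (Finₚ.toℕ-injective (trans (sym p) (trans eq (sym (toℕ-⟦⟧-small α α≤k)))))
  ... | inj₂ (p , _) = inj₂ (Finₚ.toℕ-injective (trans (sym (ℕₚ.m∸[m∸n]≡n (toℕ≤m a)))
      (trans (cong (m ∸_) (trans (sym p) eq)) (sym (toℕ--⟦⟧ α 1≤α α≤k)))))

  private
    term : ∀ {n} → Vec (ℤ/ m) n → ℕ → ℕ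
    term x α = n[ α ] x ℕ.* α ^ 2

    bit : ℤ/ m → ℕ → ℕ
    bit a α = term (a ∷ []) α

    term-∷ : ∀ {n} a (x : Vec (ℤ/ m) n) α → term (a ∷ x) α ≡ bit a α ℕ.+ term x α
    term-∷ a x α with does (a ≡±? α)
    ... | true  = cong (ℕ._+ term x α) (sym (ℕₚ.+-identityʳ (α ^ 2)))
    ... | false = refl

    sum-term-∷ : ∀ {n} a (x : Vec (ℤ/ m) n) αs →
      sumᴸ (mapᴸ (term (a ∷ x)) αs) ≡ sumᴸ (mapᴸ (bit a) αs) ℕ.+ sumᴸ (mapᴸ (term x) αs)
    sum-term-∷ a x []       = refl
    sum-term-∷ a x (α ∷ αs) = trans (cong₂ ℕ._+_ (term-∷ a x α) (sum-term-∷ a x αs))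
      (interchange (bit a α) (term x α) _ _)
      where open import Algebra.Properties.CommutativeSemigroup ℕₚ.+-commutativeSemigroup using (interchange)

    count-yes : ∀ {P : Set} (d : Dec P) → P → (if does d then ℕ.suc else (λ c → c)) 0 ≡ 1
    count-yes (yes _) p = refl
    count-yes (no ¬p) p = contradiction p ¬p

    count-no : ∀ {P : Set} (d : Dec P) → ¬ P → (if does d then ℕ.suc else (λ c → c)) 0 ≡ 0
    count-no (yes p) ¬p = contradiction p ¬p
    count-no (no _)  ¬p = refl

    bit-hit : ∀ a α → a ≡± α → bit a α ≡ α ^ 2
    bit-hit a α p = trans (cong (ℕ._* α ^ 2) (count-yes (a ≡±? α) p)) (ℕₚ.+-identityʳ (α ^ 2))

    bit-miss : ∀ a α → ¬ (a ≡± α) → bit a α ≡ 0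
    bit-miss a α ¬p = cong (ℕ._* α ^ 2) (count-no (a ≡±? α) ¬p)

    sum-bit-miss : ∀ a (f : ℕ → ℕ) K → (∀ i → i ℕ.< K → ¬ (a ≡± f i)) →
      sumᴸ (mapᴸ (bit a) (applyUpTo f K)) ≡ 0
    sum-bit-miss a f ℕ.zero    miss = refl
    sum-bit-miss a f (ℕ.suc K) miss = cong₂ ℕ._+_ (bit-miss a (f 0) (miss 0 (s≤s z≤n)))
      (sum-bit-miss a (f ∘ ℕ.suc) K (λ i i<K → miss (ℕ.suc i) (s≤s i<K)))

    sum-bit-hit : ∀ a (f : ℕ → ℕ) K j → j ℕ.< K → a ≡± f j →
      (∀ i → i ℕ.< K → a ≡± f i → i ≡ j) →
      sumᴸ (mapᴸ (bit a) (applyUpTo f K)) ≡ f j ^ 2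
    sum-bit-hit a f (ℕ.suc K) ℕ.zero _ hit unique = trans (cong₂ ℕ._+_ (bit-hit a (f 0) hit)
      (sum-bit-miss a (f ∘ ℕ.suc) K λ i i<K p → contradiction (unique (ℕ.suc i) (s≤s i<K) p) λ ()))
      (ℕₚ.+-identityʳ _)
    sum-bit-hit a f (ℕ.suc K) (ℕ.suc j) (s≤s j<K) hit unique = cong₂ ℕ._+_
      (bit-miss a (f 0) λ p → contradiction (unique 0 (s≤s z≤n) p) λ ())
      (sum-bit-hit a (f ∘ ℕ.suc) K j j<K hit λ i i<K p → ℕₚ.suc-injective (unique (ℕ.suc i) (s≤s i<K) p))

    -- For `a` nonzero exactly one α in 1, ..., k contributes, namely `∥ a ∥`; for `a` zero none
    -- does.
    sum-bit : ∀ a → sumᴸ (mapᴸ (bit a) (applyUpTo ℕ.suc k)) ≡ ∥ a ∥ ^ 2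
    sum-bit a with ∥ a ∥ in eq | ∥∥≤k a
    ... | ℕ.zero  | _ = sum-bit-miss a ℕ.suc k λ i i<k p →
      contradiction (trans (sym (∥∥-≡± a (ℕ.suc i) (s≤s z≤n) i<k p)) eq) λ ()
    ... | ℕ.suc j | j<k = sum-bit-hit a ℕ.suc k j j<k (≡±-∥∥ a (ℕ.suc j) (s≤s z≤n) j<k eq) λ i i<k p →
      ℕₚ.suc-injective (trans (sym (∥∥-≡± a (ℕ.suc i) (s≤s z≤n) i<k p)) eq)

  representative : ∀ {n} → Vec (ℤ/ m) n → ℤ^ n
  representative x i = balanced (lookup x i)

  euclideanWeight≡norm : ∀ {n} (x : Vec (ℤ/ m) n) → + euclideanWeight x ≡ representative x ∙ representative x
  euclideanWeight≡norm x = trans (cong (λ K → + sumᴸ (mapᴸ (term x) (applyUpTo ℕ.suc K))) m/2≡k) (go x)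
    where
    m/2≡k : m / 2 ≡ k
    m/2≡k = trans (cong (_/ 2) (ℕₚ.*-comm 2 k)) (ℕ÷.m*n/n≡m k 2)
    square : ∀ z → + (∣ z ∣ ^ 2) ≡ z * z
    square (+ a)    = trans (cong (λ b → + (a ℕ.* b)) (ℕₚ.*-identityʳ a)) (ℤₚ.pos-* a a)
    square -[1+ a ] = cong (λ b → + (ℕ.suc a ℕ.* b)) (ℕₚ.*-identityʳ (ℕ.suc a))
    go : ∀ {n} (x : Vec (ℤ/ m) n) → + sumᴸ (mapᴸ (term x) (applyUpTo ℕ.suc k)) ≡ representative x ∙ representative x
    go []      = cong +_ (sum-zero (applyUpTo ℕ.suc k))
      where
      sum-zero : ∀ αs → sumᴸ (mapᴸ (term []) αs) ≡ 0
      sum-zero []       = refl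
      sum-zero (_ ∷ αs) = sum-zero αs
    go (a ∷ x) = trans (cong +_ (trans (sum-term-∷ a x (applyUpTo ℕ.suc k)) (cong (ℕ._+ _) (sum-bit a))))
      (trans (ℤₚ.pos-+ (∥ a ∥ ^ 2) _) (cong₂ _+_ (square (balanced a)) (go x)))

-- The extremal code defined by a preimage

module _ (k : ℕ) .{{_ : NonZero k}} {n : ℕ} (n≤136 : n ℕ.≤ 136) (n/24≡1 : n / 24 ≡ 1)
         (P : ExtremalPreimage k n) where

  open Reduction k
  open ExtremalPreimage P

  private
    Mem-congruent : ∀ {x y} → (∀ i → + m ∣ x i - y i) → Mem y → Mem x
    Mem-congruent {x} {y} x≡y My = Mem-cong (λ i → trans (cong (_+_ (y i)) (sym (_∣_.equality (x≡y i)))) (x≡y+ (x i) (y i)))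
      (Mem-+ My (Mem-2k (λ i → _∣_.quotient (x≡y i))))
      where
      x≡y+ : ∀ x y → y + (x - y) ≡ x
      x≡y+ = solve-∀

    -swap : ∀ a b → - (a - b) ≡ b - a
    -swap = solve-∀

    lift-+ : ∀ (x y : Vec (ℤ/ m) n) i → + m ∣ lift (x +ᵛ y) i - (lift x i + lift y i)
    lift-+ x y i rewrite Vecₚ.lookup-zipWith _+ᵐ_ i x y =
      subst (+ m ∣_) (trans (-swap (+ N) (lift₁ ⟦ N ⟧)) (cong (_-_ (lift₁ ⟦ N ⟧)) (ℤₚ.pos-+ (toℕ (lookup x i)) _)))
        (∣m⇒∣-m (lift₁-⟦⟧ N))
      where N = toℕ (lookup x i) ℕ.+ toℕ (lookup y i)

    lift-* : ∀ a (x : Vec (ℤ/ m) n) i → + m ∣ lift (a *ᵛ x) i - lift₁ a * lift x i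
    lift-* a x i rewrite Vecₚ.lookup-map i (a *ᵐ_) x =
      subst (+ m ∣_) (trans (-swap (+ N) (lift₁ ⟦ N ⟧)) (cong (_-_ (lift₁ ⟦ N ⟧)) (ℤₚ.pos-* (toℕ a) _)))
        (∣m⇒∣-m (lift₁-⟦⟧ N))
      where N = toℕ a ℕ.* toℕ (lookup x i)

    lift-0 : ∀ i → + m ∣ lift (0ᵛ {n}) i - + 0
    lift-0 i rewrite Vecₚ.lookup-replicate i 0# =
      subst (+ m ∣_) (-swap (+ 0) (lift₁ 0#)) (∣m⇒∣-m (lift₁-⟦⟧ 0))

    lift-reduce : ∀ z i → + m ∣ lift (reduce {n} z) i - z i
    lift-reduce z i rewrite Vecₚ.lookup∘tabulate (reduce₁ ∘ z) i =
      subst (+ m ∣_) (-swap (z i) (lift₁ (reduce₁ (z i)))) (∣m⇒∣-m (lift₁-reduce₁ (z i)))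

    Mem-0 : Mem (λ _ → + 0)
    Mem-0 = Mem-cong (λ _ → refl) (Mem-2k (λ _ → + 0))

    Mem-representative : ∀ (x : Vec (ℤ/ m) n) → Mem (lift x) → Mem (representative x)
    Mem-representative x = Mem-congruent (λ i → balanced≡ (lookup x i))

    code : Code n
    code = record
      { _∈C       = λ x → Mem (lift x)
      ; 0-closed  = Mem-congruent lift-0 Mem-0
      ; +ᵛ-closed = λ {x} {y} x∈ y∈ → Mem-congruent (lift-+ x y) (Mem-+ x∈ y∈)
      ; *ᵛ-closed = λ a {x} x∈ → Mem-congruent (lift-* a x) (Mem-* (lift₁ a) x∈)
      }

    ∙-congruent : ∀ (x y z : ℤ^ n) → (∀ i → + m ∣ y i - z i) → + m ∣ x ∙ y → + m ∣ x ∙ z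
    ∙-congruent x y z d e = subst (+ m ∣_) (trans (cong (_-_ (x ∙ y)) (∙--ʳ x y z)) (cancel (x ∙ y) (x ∙ z)))
      (∣m∣n⇒∣m-n e (∣-∙ʳ x _ d))
      where
      cancel : ∀ a b → a - (a - b) ≡ b
      cancel = solve-∀

    selfDual : SelfDual code
    selfDual x = mk⇔
      (λ x∈ y y∈ → ∣⇒·≡0 x y (selfOrthogonal x∈ y∈))
      -- Membership has to be tested on arbitrary integral `y`, but only codewords are at hand:
      -- `reduce y` is one, and congruent vectors have congruent inner products with `lift x`.
      (λ x∈⊥ → dual⇒Mem (lift x) λ y My →
        ∙-congruent (lift x) (lift (reduce y)) y (lift-reduce y)
          (·≡0⇒∣ x (reduce y) (x∈⊥ (reduce y) (Mem-congruent (lift-reduce y) My))))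

    typeII : TypeII k n
    typeII = record
      { code = code
      ; selfDual = selfDual
      ; 4k∣euclideanWeight = λ x x∈ →
          ∣⇒∣ᵤ (subst (+ (4 ℕ.* k) ∣_) (sym (euclideanWeight≡norm x)) (doublyEven (Mem-representative x x∈)))
      }

    lookup-injective : ∀ {j} (x y : Vec (ℤ/ m) j) → (∀ i → lookup x i ≡ lookup y i) → x ≡ y
    lookup-injective []      []      _  = refl
    lookup-injective (a ∷ x) (b ∷ y) eq = cong₂ _∷_ (eq zero) (lookup-injective x y (eq ∘ suc))

    ≢0⇒representative≢0 : ∀ (x : Vec (ℤ/ m) n) → x ≢ 0ᵛ → ¬ (∀ i → + m ∣ representative x i)
    ≢0⇒representative≢0 x x≢0 d = x≢0 (lookup-injective x 0ᵛ λ i →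
      trans (∣lift₁⇒≡0 (lookup x i) (subst (+ m ∣_) (cancel (balanced (lookup x i)) _) (∣m∣n⇒∣m-n (d i) (balanced≡ (lookup x i)))))
            (sym (Vecₚ.lookup-replicate i 0#)))
      where
      cancel : ∀ b l → b - (b - l) ≡ l
      cancel = solve-∀

    lower : ∀ (x : Vec (ℤ/ m) n) → x ∈ code → x ≢ 0ᵛ → 8 ℕ.* k ℕ.≤ euclideanWeight x
    lower x x∈ x≢0 = ℤₚ.drop‿+≤+ (subst (+ (8 ℕ.* k) ≤_) (sym (euclideanWeight≡norm x))
      (minimum (Mem-representative x x∈) (≢0⇒representative≢0 x x≢0)))

    -- Balanced representatives are coordinatewise the shortest in their classes.
    weight-reduce≤ : ∀ z → + euclideanWeight (reduce {n} z) ≤ z ∙ z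
    weight-reduce≤ z = subst (_≤ z ∙ z) (sym (euclideanWeight≡norm (reduce z)))
      (sum-mono-≤ _ _ λ i → square-mono {representative (reduce z) i} {z i} (∥∥-minimal (lookup (reduce z) i) (z i)
        (subst (+ m ∣_) (-swap (lift (reduce z) i) (z i)) (∣m⇒∣-m (lift-reduce z i)))))

    8k≡ : 4 ℕ.* k ℕ.* (n / 24) ℕ.+ 4 ℕ.* k ≡ 8 ℕ.* k
    8k≡ = trans (cong (λ q → 4 ℕ.* k ℕ.* q ℕ.+ 4 ℕ.* k) n/24≡1)
      (trans (cong (ℕ._+ 4 ℕ.* k) (ℕₚ.*-identityʳ (4 ℕ.* k))) (sym (ℕₚ.*-distribʳ-+ k 4 4)))

  extremalCode : ∃[ C ] Extremal k {n} C
  extremalCode = typeII , record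
    { n≤136 = n≤136
    ; d_E≡  = subst (MinEuclideanWeight code) (sym 8k≡) ((x₀ , x₀∈ , x₀≢0 , weight-x₀) , lower)
    }
    where
    z  = proj₁ attained
    x₀ = reduce z
    x₀∈ : x₀ ∈ code
    x₀∈ = Mem-congruent (lift-reduce z) (proj₁ (proj₂ attained))
    x₀≢0 : x₀ ≢ 0ᵛ
    x₀≢0 eq = proj₁ (proj₂ (proj₂ attained)) λ i →
      subst (+ m ∣_) (trans (cong (λ x → lift x i - + 0 - (lift x₀ i - z i)) (sym eq)) (cancel (lift x₀ i) (z i)))
        (∣m∣n⇒∣m-n (lift-0 i) (lift-reduce z i))
      where
      cancel : ∀ l z → l - + 0 - (l - z) ≡ z
      cancel = solve-∀
    -- The entries of `z` need not be balanced, so its norm only bounds the weight from above; the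
    -- bound from below is the minimum already established for all nonzero codewords.
    weight-x₀ : euclideanWeight x₀ ≡ 8 ℕ.* k
    weight-x₀ = ℕₚ.≤-antisym
      (ℤₚ.drop‿+≤+ (subst (+ euclideanWeight x₀ ≤_) (proj₂ (proj₂ (proj₂ attained))) (weight-reduce≤ z)))
      (lower x₀ x₀∈ x₀≢0)

-- Light words of binary codes

bit : Bool → ℤ
bit false = + 0
bit true  = + 1

oddℕ : ℕ → Bool
oddℕ ℕ.zero    = false
oddℕ (ℕ.suc n) = not (oddℕ n)

odd : ℤ → Bool
odd z = oddℕ ∣ z ∣

odd-spec : ∀ z → + 2 ∣ z - bit (odd z)
odd-spec (+ n) = odd-specℕ n
  where
  odd-specℕ : ∀ n → + 2 ∣ + n - bit (oddℕ n)
  odd-specℕ ℕ.zero    = divides (+ 0) refl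
  odd-specℕ (ℕ.suc n) with oddℕ n | odd-specℕ n
  ... | false | d = subst (+ 2 ∣_) (eq (+ n)) d
    where
    eq : ∀ z → z - + 0 ≡ + 1 + z - + 1
    eq = solve-∀
  ... | true  | d = subst (+ 2 ∣_) (eq (+ n)) (∣m∣n⇒∣m+n d (divides (+ 1) refl))
    where
    eq : ∀ z → z - + 1 + + 2 ≡ + 1 + z - + 0
    eq = solve-∀
odd-spec -[1+ n ] = subst (+ 2 ∣_) (eq (+ ℕ.suc n) (bit (odd (+ ℕ.suc n))))
  (∣m∣n⇒∣m-n (∣m⇒∣-m (odd-spec (+ ℕ.suc n))) (divides (bit (odd (+ ℕ.suc n))) refl))
  where
  eq : ∀ z b → - (z - b) - b * + 2 ≡ - z - b
  eq = solve-∀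

odd-unique : ∀ z b → + 2 ∣ z - bit b → odd z ≡ b
odd-unique z b d with odd z | b | ∣m∣n⇒∣m-n (odd-spec z) d
... | false | false | _ = refl
... | true  | true  | _ = refl
... | false | true  | e = contradiction (∣⇒∣ᵤ (subst (+ 2 ∣_) (eq z) e)) λ d → contradiction (ℕ∣.∣⇒≤ d) λ { (s≤s ()) }
  where
  eq : ∀ z → z - + 0 - (z - + 1) ≡ + 1
  eq = solve-∀
... | true  | false | e = contradiction (∣⇒∣ᵤ (subst (+ 2 ∣_) (eq z) e)) λ d → contradiction (ℕ∣.∣⇒≤ d) λ { (s≤s ()) }
  where
  eq : ∀ z → z - + 1 - (z - + 0) ≡ - (+ 1)
  eq = solve-∀

∣⇒odd≡false : ∀ {z} → + 2 ∣ z → odd z ≡ false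
∣⇒odd≡false {z} d = odd-unique z false (subst (+ 2 ∣_) (sym (ℤₚ.+-identityʳ z)) d)

odd≡false⇒∣ : ∀ {z} → odd z ≡ false → + 2 ∣ z
odd≡false⇒∣ {z} eq = subst (+ 2 ∣_) (trans (cong (λ b → z - bit b) eq) (ℤₚ.+-identityʳ z)) (odd-spec z)

odd-+ : ∀ x y → odd (x + y) ≡ odd x xor odd y
odd-+ x y = odd-unique (x + y) (odd x xor odd y)
  (subst (+ 2 ∣_) (sym (eq x y (odd x) (odd y))) (∣m∣n⇒∣m+n (∣m∣n⇒∣m+n (odd-spec x) (odd-spec y)) (carry (odd x) (odd y))))
  where
  carry : ∀ a b → + 2 ∣ bit a + bit b - bit (a xor b)
  carry false false = divides (+ 0) refl
  carry false true  = divides (+ 0) refl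
  carry true  false = divides (+ 0) refl
  carry true  true  = divides (+ 1) refl
  regroup : ∀ x y a b c → x + y - c ≡ (x - a) + (y - b) + (a + b - c)
  regroup = solve-∀
  eq : ∀ x y a b → x + y - bit (a xor b) ≡ (x - bit a) + (y - bit b) + (bit a + bit b - bit (a xor b))
  eq x y a b = regroup x y (bit a) (bit b) (bit (a xor b))

odd-* : ∀ x y → odd (x * y) ≡ odd x ∧ odd y
odd-* x y = odd-unique (x * y) (odd x ∧ odd y)
  (subst (+ 2 ∣_) (sym (eq x y (odd x) (odd y))) (∣m∣n⇒∣m+n (∣m⇒∣m*n y (odd-spec x)) (∣n⇒∣m*n (bit (odd x)) (odd-spec y))))
  where
  bit-∧ : ∀ a b → bit (a ∧ b) ≡ bit a * bit b
  bit-∧ false b     = refl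
  bit-∧ true  false = refl
  bit-∧ true  true  = refl
  regroup : ∀ x y a b → x * y - a * b ≡ (x - a) * y + a * (y - b)
  regroup = solve-∀
  eq : ∀ x y a b → x * y - bit (a ∧ b) ≡ (x - bit a) * y + bit a * (y - bit b)
  eq x y a b = trans (cong (_-_ (x * y)) (bit-∧ a b)) (regroup x y (bit a) (bit b))

infixl 6 _⊕_
_⊕_ : ∀ {n} → Vec Bool n → Vec Bool n → Vec Bool n
_⊕_ = zipWith _xor_

combine : ∀ {r n} → Vec Bool r → Vec (Vec Bool n) r → Vec Bool n
combine []           []       = replicate _ false
combine (false ∷ bs) (c ∷ cs) = combine bs cs
combine (true  ∷ bs) (c ∷ cs) = c ⊕ combine bs cs

weight : ∀ {n} → Vec Bool n → ℕ
weight []           = 0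
weight (false ∷ bs) = weight bs
weight (true  ∷ bs) = ℕ.suc (weight bs)

-- The budget b bounds the number of summands, so that the absence of light words is checked without running
-- through the whole code.
sums : ∀ {r n} → (Vec Bool n → Bool) → Vec (Vec Bool n) r → Vec Bool n → ℕ → Bool
sums p []       s b         = p s
sums p (c ∷ cs) s ℕ.zero    = p s
sums p (c ∷ cs) s (ℕ.suc b) = sums p cs s (ℕ.suc b) ∧ sums p cs (s ⊕ c) b

nonemptySums : ∀ {r n} → (Vec Bool n → Bool) → Vec (Vec Bool n) r → ℕ → Bool
nonemptySums p []       b = true
nonemptySums p (c ∷ cs) b = sums p cs c b ∧ nonemptySums p cs b

∧-elim : ∀ {a b} → a ∧ b ≡ true → a ≡ true × b ≡ true
∧-elim {true} {true} _ = refl , refl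

⊕-identityʳ : ∀ {n} (s : Vec Bool n) → s ⊕ replicate n false ≡ s
⊕-identityʳ = Vecₚ.zipWith-identityʳ Boolₚ.xor-identityʳ

combine-weight0 : ∀ {r n} (bs : Vec Bool r) (cs : Vec (Vec Bool n) r) → weight bs ℕ.≤ 0 → combine bs cs ≡ replicate n false
combine-weight0 []           []       _ = refl
combine-weight0 (false ∷ bs) (c ∷ cs) w = combine-weight0 bs cs w

sums-sound : ∀ {r n} p (cs : Vec (Vec Bool n) r) s b → sums p cs s b ≡ true →
  ∀ bs → weight bs ℕ.≤ b → p (s ⊕ combine bs cs) ≡ true
sums-sound p []       s b ok []  _ = trans (cong p (⊕-identityʳ s)) ok
sums-sound p (c ∷ cs) s ℕ.zero ok bs w = trans (cong p (trans (cong (s ⊕_) (combine-weight0 bs (c ∷ cs) w)) (⊕-identityʳ s))) ok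
sums-sound p (c ∷ cs) s (ℕ.suc b) ok (false ∷ bs) w       = sums-sound p cs s (ℕ.suc b) (proj₁ (∧-elim ok)) bs w
sums-sound p (c ∷ cs) s (ℕ.suc b) ok (true  ∷ bs) (s≤s w) = trans
  (cong p (sym (Vecₚ.zipWith-assoc Boolₚ.xor-assoc s c (combine bs cs))))
  (sums-sound p cs (s ⊕ c) b (proj₂ (∧-elim {sums p cs s (ℕ.suc b)} ok)) bs w)

-- The first chosen row opens the partial sum without being charged to the budget, so budget `b`
-- covers `b + 1` summands. Thus budget 2 rules out words of weight at most 3 in a dual code, and a
-- budget equal to the rank covers all words.
nonemptySums-sound : ∀ {r n} p (cs : Vec (Vec Bool n) r) b → nonemptySums p cs b ≡ true →
  ∀ bs → weight bs ℕ.≤ ℕ.suc b → p (combine bs cs) ≡ true ⊎ (∀ i → lookup bs i ≡ false)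
nonemptySums-sound p [] b ok [] w = inj₂ λ ()
nonemptySums-sound p (c ∷ cs) b ok (true ∷ bs) (s≤s w) = inj₁ (sums-sound p cs c b (proj₁ (∧-elim ok)) bs w)
nonemptySums-sound p (c ∷ cs) b ok (false ∷ bs) w with nonemptySums-sound p cs b (proj₂ (∧-elim {sums p cs c b} ok)) bs w
... | inj₁ q = inj₁ q
... | inj₂ q = inj₂ λ { zero → refl ; (suc i) → q i }

nonzero : ∀ {n} → Vec Bool n → Bool
nonzero []       = false
nonzero (b ∷ bs) = b ∨ nonzero bs

nonzero-sound : ∀ {n} (bs : Vec Bool n) → nonzero bs ≡ true → ¬ (∀ i → lookup bs i ≡ false)
nonzero-sound (true  ∷ bs) _ z = contradiction (z zero) λ ()
nonzero-sound (false ∷ bs) e z = nonzero-sound bs e (z ∘ suc)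

bits : ∀ {n} → ℤ^ n → Vec Bool n
bits x = tabulate (odd ∘ x)

rows : ∀ {r n} → (Fin r → ℤ^ n) → Vec (Vec Bool n) r
rows G = tabulate (bits ∘ G)

bits-⊛ : ∀ {r n} (a : ℤ^ r) (G : Fin r → ℤ^ n) j → odd ((a ⊛ G) j) ≡ lookup (combine (bits a) (rows G)) j
bits-⊛ {ℕ.zero}  a G j = sym (Vecₚ.lookup-replicate j false)
bits-⊛ {ℕ.suc r} a G j = trans (odd-+ (a zero * G zero j) _) (trans (cong₂ _xor_ (odd-* (a zero) (G zero j)) (bits-⊛ (a ∘ suc) (G ∘ suc) j)) step)
  where
  step : (odd (a zero) ∧ odd (G zero j)) xor lookup (combine (bits (a ∘ suc)) (rows (G ∘ suc))) j ≡ lookup (combine (bits a) (rows G)) j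
  step with odd (a zero)
  ... | false = refl
  ... | true  = sym (trans (Vecₚ.lookup-zipWith _xor_ j (bits (G zero)) rest)
      (cong (λ b → b xor lookup rest j) (Vecₚ.lookup∘tabulate (odd ∘ G zero) j)))
    where rest = combine (bits (a ∘ suc)) (rows (G ∘ suc))

weight≤norm : ∀ {n} (x : ℤ^ n) → + weight (bits x) ≤ x ∙ x
weight≤norm {ℕ.zero}  x = ℤₚ.≤-refl
weight≤norm {ℕ.suc n} x with odd (x zero) in eq
... | false = subst (_≤ x ∙ x) (ℤₚ.+-identityˡ _) (ℤₚ.+-mono-≤ (0≤square (x zero)) (weight≤norm (x ∘ suc)))
... | true  = ℤₚ.+-mono-≤ (1≤square (x zero) eq) (weight≤norm (x ∘ suc))
  where
  1≤square : ∀ z → odd z ≡ true → + 1 ≤ z * z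
  1≤square (+ ℕ.suc a) _ = +≤+ (s≤s z≤n)
  1≤square -[1+ a ]    _ = +≤+ (s≤s z≤n)

weight≤length : ∀ {n} (bs : Vec Bool n) → weight bs ℕ.≤ n
weight≤length []           = z≤n
weight≤length (false ∷ bs) = ℕₚ.m≤n⇒m≤1+n (weight≤length bs)
weight≤length (true  ∷ bs) = s≤s (weight≤length bs)

-- The hypothesis on `G i ∙ x` says that the columns of `G` at the odd coordinates of `x` sum to
-- zero modulo 2. There are at most `x ∙ x` such coordinates, and no nonempty set of at most `b + 1`
-- columns has sum zero.
light⇒even : ∀ {r n} (G : Fin r → ℤ^ n) b → nonemptySums nonzero (rows (G ᵗ)) b ≡ true →
  ∀ x → (∀ i → + 2 ∣ G i ∙ x) → x ∙ x ≤ + ℕ.suc b → ∀ i → + 2 ∣ x i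
light⇒even G b ok x Gx x²≤ i = Sum.[ (λ nz → contradiction syndrome (nonzero-sound (combine (bits x) (rows (G ᵗ))) nz))
                                   , (λ even → odd≡false⇒∣ (trans (sym (Vecₚ.lookup∘tabulate (odd ∘ x) i)) (even i))) ]
  (nonemptySums-sound nonzero (rows (G ᵗ)) b ok (bits x) (ℤₚ.drop‿+≤+ (ℤₚ.≤-trans (weight≤norm x) x²≤)))
  where
  syndrome : ∀ l → lookup (combine (bits x) (rows (G ᵗ))) l ≡ false
  syndrome l = trans (sym (bits-⊛ x (G ᵗ) l)) (∣⇒odd≡false (subst (+ 2 ∣_) (∙-comm (G l) x) (Gx l)))

-- Lattices

-- Twice an even unimodular lattice of minimum norm 4: the generators G span modulo 2 a doubly even code C₁
-- of minimum weight at least 16, and the lattice is spanned by G and by twice the integral lifts of C₁⊥,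
-- which has minimum weight 4.  The rows of D are dual to G modulo 2.
record Lattice (n : ℕ) : Set where
  field
    {rank}        : ℕ
    G D           : Fin rank → ℤ^ n
    4∣G∙G         : ∀ i j → + 4 ∣ G i ∙ G j
    8∣G∙G         : ∀ i → + 8 ∣ G i ∙ G i
    G∙D           : ∀ i j → + 2 ∣ G i ∙ D j - δ i j
    allOnes       : ∃[ i ] ∀ j → odd (G i j) ≡ true
    wordWeights   : nonemptySums (λ w → 16 ℕ.≤ᵇ weight w) (rows G) rank ≡ true
    dualWeights   : nonemptySums nonzero (rows (G ᵗ)) 2 ≡ true

  Dual₂ : ℤ^ n → Set
  Dual₂ u = ∀ i → + 2 ∣ G i ∙ u

  InLattice : ℤ^ n → Set
  InLattice v = ∃[ a ] ∃[ u ] (∀ j → v j ≡ (a ⊛ G) j + + 2 * u j) × Dual₂ u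

  Dual₂-* : ∀ c {u} → Dual₂ u → Dual₂ (λ i → c * u i)
  Dual₂-* c {u} Du i = subst (+ 2 ∣_) (sym (∙-*ʳ c (G i) u)) (∣n⇒∣m*n c (Du i))

  Dual₂-+ : ∀ {u w} → Dual₂ u → Dual₂ w → Dual₂ (λ i → u i + w i)
  Dual₂-+ {u} {w} Du Dw i = subst (+ 2 ∣_) (sym (∙-+ʳ (G i) u w)) (∣m∣n⇒∣m+n (Du i) (Dw i))

  InLattice-+ : ∀ {v w} → InLattice v → InLattice w → InLattice (λ i → v i + w i)
  InLattice-+ (a , u , v≡ , Du) (b , t , w≡ , Dt) = (λ i → a i + b i) , (λ i → u i + t i) ,
    (λ j → trans (cong₂ _+_ (v≡ j) (w≡ j)) (trans (collect ((a ⊛ G) j) (u j) ((b ⊛ G) j) (t j)) (cong (λ x → x + + 2 * (u j + t j)) (sym (⊛-+ a b G j))))) ,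
    Dual₂-+ Du Dt
    where
    collect : ∀ p q r s → p + + 2 * q + (r + + 2 * s) ≡ p + r + + 2 * (q + s)
    collect = solve-∀

  InLattice-* : ∀ c {v} → InLattice v → InLattice (λ i → c * v i)
  InLattice-* c {v} (a , u , v≡ , Du) = (λ i → c * a i) , (λ i → c * u i) ,
    (λ j → trans (cong (_*_ c) (v≡ j)) (trans (collect c ((a ⊛ G) j) (u j)) (cong (λ x → x + + 2 * (c * u j)) (sym (⊛-* c a G j))))) ,
    Dual₂-* c Du
    where
    collect : ∀ c p q → c * (p + + 2 * q) ≡ c * p + + 2 * (c * q)
    collect = solve-∀

  InLattice-2* : ∀ {u} → Dual₂ u → InLattice (λ j → + 2 * u j)
  InLattice-2* {u} Du = (λ _ → + 0) , u , (λ j → sym (trans (cong (_+ (+ 2 * u j)) (sum-0 {rank} _ (λ _ → refl))) (ℤₚ.+-identityˡ _))) , Du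

  InLattice-4δ : ∀ j → InLattice (λ i → + 2 * (+ 2 * δ j i))
  InLattice-4δ j = InLattice-2* λ i → ∣-∙ʳ (G i) _ λ l → divides (δ j l) (ℤₚ.*-comm (+ 2) (δ j l))

  4∣∙ : ∀ {v w} → InLattice v → InLattice w → + 4 ∣ v ∙ w
  4∣∙ {v} {w} (a , u , v≡ , Du) (b , t , w≡ , Dt) = subst (+ 4 ∣_) (sym expand)
    (∣m∣n⇒∣m+n (∣m∣n⇒∣m+n (∣-⊛∙⊛ a b G 4∣G∙G)
      (*-monoʳ-∣ (+ 2) (∣m∣n⇒∣m+n (∣-⊛∙ a G t Dt) (∣-⊛∙ b G u Du))))
      (divides (u ∙ t) (ℤₚ.*-comm (+ 4) (u ∙ t))))
    where
    open ≡-Reasoning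
    collect : ∀ p q r s → p + + 2 * q + (+ 2 * r + + 2 * (+ 2 * s)) ≡ p + + 2 * (q + r) + + 4 * s
    collect = solve-∀
    expand : v ∙ w ≡ (a ⊛ G) ∙ (b ⊛ G) + + 2 * ((a ⊛ G) ∙ t + (b ⊛ G) ∙ u) + + 4 * (u ∙ t)
    expand = begin
      v ∙ w                                                                ≡⟨ ∙-cong v≡ w≡ ⟩
      (λ j → (a ⊛ G) j + + 2 * u j) ∙ (λ j → (b ⊛ G) j + + 2 * t j)        ≡⟨ ∙-+ˡ (a ⊛ G) _ _ ⟩
      (a ⊛ G) ∙ (λ j → (b ⊛ G) j + + 2 * t j) + (λ j → + 2 * u j) ∙ (λ j → (b ⊛ G) j + + 2 * t j)
        ≡⟨ cong₂ _+_ (trans (∙-+ʳ (a ⊛ G) (b ⊛ G) _) (cong (_+_ ((a ⊛ G) ∙ (b ⊛ G))) (∙-*ʳ (+ 2) (a ⊛ G) t)))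
                     (trans (∙-*ˡ (+ 2) u _) (trans (cong (_*_ (+ 2)) (∙-+ʳ u (b ⊛ G) _)) (trans (ℤₚ.*-distribˡ-+ (+ 2) (u ∙ (b ⊛ G)) _)
                       (cong₂ (λ p q → + 2 * p + + 2 * q) (∙-comm u (b ⊛ G)) (∙-*ʳ (+ 2) u t))))) ⟩
      (a ⊛ G) ∙ (b ⊛ G) + + 2 * ((a ⊛ G) ∙ t) + (+ 2 * ((b ⊛ G) ∙ u) + + 2 * (+ 2 * (u ∙ t)))
        ≡⟨ collect ((a ⊛ G) ∙ (b ⊛ G)) _ _ _ ⟩
      (a ⊛ G) ∙ (b ⊛ G) + + 2 * ((a ⊛ G) ∙ t + (b ⊛ G) ∙ u) + + 4 * (u ∙ t) ∎

  -- This is where the all-ones word is used: for its lift `g` the entries of `u` and `u − g` have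
  -- opposite parity, so `u ∙ u` ≡ `u ∙ g` ≡ 0 modulo 2.
  Dual₂⇒2∣norm : ∀ {u} → Dual₂ u → + 2 ∣ u ∙ u
  Dual₂⇒2∣norm {u} Du = subst (+ 2 ∣_) (trans (cong (_+ u ∙ g) (∙--ʳ u u g)) (restore (u ∙ u) (u ∙ g)))
    (∣m∣n⇒∣m+n (∣-sum _ even) (subst (+ 2 ∣_) (∙-comm g u) (Du i₀)) )
    where
    i₀ = proj₁ allOnes
    g = G i₀
    restore : ∀ x y → x - y + y ≡ x
    restore = solve-∀
    even : ∀ j → + 2 ∣ u j * (u j - g j)
    even j = odd≡false⇒∣ (trans (odd-* (u j) (u j - g j)) (trans (cong (λ b → odd (u j) ∧ b)
      (trans (odd-+ (u j) (- g j)) (cong (λ b → odd (u j) xor b) (trans (cong oddℕ (ℤₚ.∣-i∣≡∣i∣ (g j))) (proj₂ allOnes j)))))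
      (b∧¬b (odd (u j)))))
      where
      b∧¬b : ∀ b → b ∧ (b xor true) ≡ false
      b∧¬b false = refl
      b∧¬b true  = refl

  8∣norm : ∀ {v} → InLattice v → + 8 ∣ v ∙ v
  8∣norm {v} (a , u , v≡ , Du) = subst (+ 8 ∣_) (sym (trans (∙-cong v≡ v≡) (norm-+ (a ⊛ G) (λ j → + 2 * u j))))
    (∣m∣n⇒∣m+n (∣m∣n⇒∣m+n (2d∣norm {+ 4} a G 4∣G∙G 8∣G∙G)
      (subst (+ 8 ∣_) (trans (ℤₚ.*-assoc (+ 2) (+ 2) _) (cong (_*_ (+ 2)) (sym (∙-*ʳ (+ 2) (a ⊛ G) u)))) (*-monoʳ-∣ (+ 4) (∣-⊛∙ a G u Du))))
      (subst (+ 8 ∣_) (sym (norm-* (+ 2) u)) (*-monoʳ-∣ (+ 4) (Dual₂⇒2∣norm Du))))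

  -- Unimodularity of L. The dual vectors `D` read off the coefficients `a`; testing `v` against
  -- doubled words of C₁⊥ shows that `v − aG` is even, and testing against the rows of `G` shows
  -- that its half lies in C₁⊥ modulo 2.
  dual : ∀ v → (∀ w → InLattice w → + 4 ∣ v ∙ w) → InLattice v
  dual v 4∣v∙ = a , u , v≡ , Du
    where
    a = λ i → v ∙ D i
    -- The rows of 1 − GᵗD lie in C₁⊥, so v − (Dv)G is even.
    test : Fin n → ℤ^ n
    test j l = δ j l - ((λ i → G i j) ⊛ D) l
    test-dual : ∀ j → Dual₂ (test j)
    test-dual j i = subst (+ 2 ∣_) (sym G∙test) (∣m⇒∣-m (∣-∙ʳ b _ λ l → G∙D i l))
      where
      open ≡-Reasoning
      b = λ l → G l j
      G∙test : G i ∙ test j ≡ - (b ∙ (λ l → G i ∙ D l - δ i l))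
      G∙test = begin
        G i ∙ test j                                    ≡⟨ ∙--ʳ (G i) (δ j) (b ⊛ D) ⟩
        G i ∙ δ j - G i ∙ (b ⊛ D)                       ≡⟨ cong₂ _-_ (∙-δ (G i) j) (∙-⊛ b D (G i)) ⟩
        G i j - b ∙ (λ l → G i ∙ D l)                   ≡⟨ cong (_- b ∙ (λ l → G i ∙ D l)) (∙-δ b i) ⟨
        b ∙ δ i - b ∙ (λ l → G i ∙ D l)                 ≡⟨ neg-swap (b ∙ δ i) _ ⟩
        - (b ∙ (λ l → G i ∙ D l) - b ∙ δ i)             ≡⟨ cong -_ (∙--ʳ b _ (δ i)) ⟨
        - (b ∙ (λ l → G i ∙ D l - δ i l))               ∎
        where
        neg-swap : ∀ x y → x - y ≡ - (y - x)
        neg-swap = solve-∀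
    v∙test : ∀ j → v ∙ test j ≡ v j - (a ⊛ G) j
    v∙test j = trans (∙--ʳ v (δ j) _) (cong₂ _-_ (∙-δ v j) (trans (∙-⊛ (λ l → G l j) D v) (∙-comm (λ l → G l j) a)))
    even : ∀ j → + 2 ∣ v j - (a ⊛ G) j
    even j = subst (+ 2 ∣_) (v∙test j) (*-cancelˡ-∣ (+ 2) (subst (+ 4 ∣_) (∙-*ʳ (+ 2) v (test j)) (4∣v∙ _ (InLattice-2* (test-dual j)))))
    u : ℤ^ n
    u j = _∣_.quotient (even j)
    v≡ : ∀ j → v j ≡ (a ⊛ G) j + + 2 * u j
    v≡ j = trans (restore (v j) ((a ⊛ G) j)) (cong (_+_ ((a ⊛ G) j)) (trans (_∣_.equality (even j)) (ℤₚ.*-comm (u j) (+ 2))))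
      where
      restore : ∀ x y → x ≡ y + (x - y)
      restore = solve-∀
    Du : Dual₂ u
    Du i = *-cancelˡ-∣ (+ 2) (subst (+ 4 ∣_) eq (∣m∣n⇒∣m-n
        (subst (+ 4 ∣_) (∙-comm v (G i)) (4∣v∙ (G i) G∈)) (subst (+ 4 ∣_) (∙-comm (a ⊛ G) (G i)) (∣-⊛∙ a G (G i) λ l → 4∣G∙G l i))))
      where
      G∈ : InLattice (G i)
      G∈ = δ i , (λ _ → + 0) , (λ j → sym (trans (ℤₚ.+-identityʳ _) (trans (∙-comm (δ i) (λ l → G l j)) (∙-δ (λ l → G l j) i)))) ,
        λ j → ∣-∙ʳ (G j) _ λ _ → divides (+ 0) refl
      eq : G i ∙ v - G i ∙ (a ⊛ G) ≡ + 2 * (G i ∙ u)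
      eq = trans (cong (_- G i ∙ (a ⊛ G)) (trans (∙-congˡ (G i) v≡) (∙-+ʳ (G i) (a ⊛ G) _)))
        (trans (cancel (G i ∙ (a ⊛ G)) _) (∙-*ʳ (+ 2) (G i) u))
        where
        cancel : ∀ x y → x + y - x ≡ y
        cancel = solve-∀

  private
    halve : ∀ {j} (x : ℤ^ j) → (∀ i → + 2 ∣ x i) → ∃[ y ] ∀ i → x i ≡ + 2 * y i
    halve x even = (λ i → _∣_.quotient (even i)) , λ i → trans (_∣_.equality (even i)) (ℤₚ.*-comm _ (+ 2))

    quarter : ∀ (x y : ℤ^ n) → (∀ j → x j ≡ + 2 * y j) → x ∙ x ≡ + 4 * (y ∙ y)
    quarter x y x≡ = trans (∙-cong x≡ x≡) (norm-* (+ 2) y)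

    word : ∀ v a u → (∀ j → v j ≡ (a ⊛ G) j + + 2 * u j) → combine (bits a) (rows G) ≡ bits v
    word v a u v≡ = trans (sym (Vecₚ.tabulate∘lookup _)) (Vecₚ.tabulate-cong λ j → sym (trans (odd-v j) (bits-⊛ a G j)))
      where
      odd-v : ∀ j → odd (v j) ≡ odd ((a ⊛ G) j)
      odd-v j = trans (cong odd (v≡ j)) (trans (odd-+ ((a ⊛ G) j) (+ 2 * u j))
        (trans (cong (λ b → odd ((a ⊛ G) j) xor b) (∣⇒odd≡false (divides (u j) (ℤₚ.*-comm (+ 2) (u j))))) (Boolₚ.xor-identityʳ _)))

    Dual₂-minimumNorm : ∀ w → Dual₂ w → w ∙ w < + 4 → ∀ j → w j ≡ + 0
    Dual₂-minimumNorm w Dw w²<4 j = trans (w≡2y j) (cong (_*_ (+ 2)) (norm≡0⇒≡0 y y²≡0 j))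
      where
      half = halve w (light⇒even G 2 dualWeights w Dw (ℤₚ.i<j⇒i≤pred[j] w²<4))
      y = proj₁ half
      w≡2y = proj₂ half
      y²≡0 : y ∙ y ≡ + 0
      y²≡0 = ℤₚ.≤-antisym (ℤₚ.i<j⇒i≤pred[j] (ℤₚ.*-cancelˡ-<-nonNeg {y ∙ y} {+ 1} (+ 4) (subst (_< + 4) (quarter w y w≡2y) w²<4))) (0≤norm y)

    even-minimumNorm : ∀ v a u → (∀ j → v j ≡ (a ⊛ G) j + + 2 * u j) → Dual₂ u → (∀ i → + 2 ∣ a i) →
      v ∙ v < + 16 → ∀ j → v j ≡ + 0
    even-minimumNorm v a u v≡ Du even v²<16 j = trans (v≡2w j) (cong (_*_ (+ 2))
      (Dual₂-minimumNorm w Dw (ℤₚ.*-cancelˡ-<-nonNeg {w ∙ w} {+ 4} (+ 4) (subst (_< + 16) (quarter v w v≡2w) v²<16)) j))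
      where
      a′ = proj₁ (halve a even)
      w : ℤ^ n
      w j = (a′ ⊛ G) j + u j
      v≡2w : ∀ j → v j ≡ + 2 * w j
      v≡2w j = trans (v≡ j) (trans (cong (_+ + 2 * u j) (trans (⊛-cong G (proj₂ (halve a even)) j) (⊛-* (+ 2) a′ G j)))
        (sym (ℤₚ.*-distribˡ-+ (+ 2) ((a′ ⊛ G) j) (u j))))
      Dw : Dual₂ w
      Dw = Dual₂-+ (λ i → subst (+ 2 ∣_) (∙-comm (a′ ⊛ G) (G i)) (∣-⊛∙ a′ G (G i) λ l → ∣-trans (divides (+ 2) refl) (4∣G∙G l i))) Du

  -- If some coefficient of `G` is odd, `v` reduces to a nonzero word of C₁ and has at least 16 odd
  -- entries. Otherwise v = 2w with w in C₁⊥ modulo 2 and norm below 4; such a w is even, w = 2y,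
  -- and y has norm below 1.
  minimumNorm : ∀ {v} → InLattice v → v ∙ v < + 16 → ∀ j → v j ≡ + 0
  minimumNorm {v} (a , u , v≡ , Du) v²<16 = Sum.[ heavy , light ]
    (nonemptySums-sound (λ w → 16 ℕ.≤ᵇ weight w) (rows G) rank wordWeights (bits a) (ℕₚ.m≤n⇒m≤1+n (weight≤length (bits a))))
    where
    heavy : (16 ℕ.≤ᵇ weight (combine (bits a) (rows G))) ≡ true → ∀ j → v j ≡ + 0
    heavy eq = contradiction v²<16 (ℤₚ.≤⇒≯ (ℤₚ.≤-trans
      (+≤+ (subst (λ w → 16 ℕ.≤ weight w) (word v a u v≡) (ℕₚ.≤ᵇ⇒≤ 16 _ (subst Bool.T (sym eq) _)))) (weight≤norm v)))
    light : (∀ i → lookup (bits a) i ≡ false) → ∀ j → v j ≡ + 0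
    light even = even-minimumNorm v a u v≡ Du
      (λ i → odd≡false⇒∣ (trans (sym (Vecₚ.lookup∘tabulate (odd ∘ a) i)) (even i))) v²<16

-- Sums of four squares

-- The odd case is written 3 + 2j to match the norm 6 + 4j = 2(3 + 2j) of a frame that involves U.
even-or-odd : ∀ k → 2 ℕ.≤ k → (∃[ j ] k ≡ 2 ℕ.* j) ⊎ (∃[ j ] k ≡ 3 ℕ.+ 2 ℕ.* j)
even-or-odd 1 (s≤s ())
even-or-odd 2 _ = inj₁ (1 , refl)
even-or-odd 3 _ = inj₂ (0 , refl)
even-or-odd (ℕ.suc (ℕ.suc k@(ℕ.suc (ℕ.suc _)))) _ with even-or-odd k (s≤s (s≤s z≤n))
... | inj₁ (j , eq) = inj₁ (ℕ.suc j , trans (cong (2 ℕ.+_) eq) (sym (ℕₚ.*-suc 2 j)))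
... | inj₂ (j , eq) = inj₂ (ℕ.suc j , trans (cong (2 ℕ.+_) eq) (cong (3 ℕ.+_) (sym (ℕₚ.*-suc 2 j))))

FourSquares : ℤ → Set
FourSquares z = ∃ λ (q : ℤ^ 4) → q ∙ q ≡ z

private
  vec4 : ℤ → ℤ → ℤ → ℤ → ℤ^ 4
  vec4 a b c d zero                   = a
  vec4 a b c d (suc zero)             = b
  vec4 a b c d (suc (suc zero))       = c
  vec4 a b c d (suc (suc (suc zero))) = d

  -- The product of the quaternion x with the conjugate of y.
  infixl 7 _⋆_
  _⋆_ : ℤ^ 4 → ℤ^ 4 → ℤ^ 4
  x ⋆ y = product (x zero) (x (suc zero)) (x (suc (suc zero))) (x (suc (suc (suc zero))))
                  (y zero) (y (suc zero)) (y (suc (suc zero))) (y (suc (suc (suc zero))))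
    where
    product : (a b c d e f g h : ℤ) → ℤ^ 4
    product a b c d e f g h = vec4 (a * e + b * f + c * g + d * h) (a * f - b * e + c * h - d * g)
                                   (a * g - b * h - c * e + d * f) (a * h + b * g - c * f - d * e)

  ⋆-norm : ∀ x y → (x ⋆ y) ∙ (x ⋆ y) ≡ (x ∙ x) * (y ∙ y)
  ⋆-norm x y = euler (x zero) (x (suc zero)) (x (suc (suc zero))) (x (suc (suc (suc zero))))
                     (y zero) (y (suc zero)) (y (suc (suc zero))) (y (suc (suc (suc zero))))
    where
    euler : ∀ a b c d e f g h →
      (a * e + b * f + c * g + d * h) * (a * e + b * f + c * g + d * h) +
      ((a * f - b * e + c * h - d * g) * (a * f - b * e + c * h - d * g) +
      ((a * g - b * h - c * e + d * f) * (a * g - b * h - c * e + d * f) +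
      ((a * h + b * g - c * f - d * e) * (a * h + b * g - c * f - d * e) + + 0))) ≡
      (a * a + (b * b + (c * c + (d * d + + 0)))) * (e * e + (f * f + (g * g + (h * h + + 0))))
    euler = solve-∀

  -- Modulo m the quaternion x times the conjugate of y is y times its own conjugate, which has real
  -- part m r and no imaginary part.
  ⋆-congruent : ∀ m r t y → y ∙ y ≡ m * r → ∀ x → (∀ i → x i ≡ y i + m * t i) →
    ∃ λ (w : ℤ^ 4) → ∀ i → (x ⋆ y) i ≡ m * w i
  ⋆-congruent m r t y y²≡mr x x≡ = vec4 (r + t ∙ y) ((t ⋆ y) (suc zero)) ((t ⋆ y) (suc (suc zero))) ((t ⋆ y) (suc (suc (suc zero)))) , λ
    { zero → trans (cong₂ (λ p q → p * e + q * f + x₂ * g + x₃ * h) (x≡ zero) (x≡ (suc zero)))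
        (trans (cong₂ (λ p q → (e + m * a) * e + (f + m * b) * f + p * g + q * h) (x≡ (suc (suc zero))) (x≡ (suc (suc (suc zero)))))
        (trans (eq₀ m a b c d e f g h) (trans (cong (_+ m * (t ∙ y)) y²≡mr) (sym (ℤₚ.*-distribˡ-+ m r (t ∙ y))))))
    ; (suc zero) → trans (cong₂ (λ p q → p * f - q * e + x₂ * h - x₃ * g) (x≡ zero) (x≡ (suc zero)))
        (trans (cong₂ (λ p q → (e + m * a) * f - (f + m * b) * e + p * h - q * g) (x≡ (suc (suc zero))) (x≡ (suc (suc (suc zero)))))
        (eq₁ m a b c d e f g h))
    ; (suc (suc zero)) → trans (cong₂ (λ p q → p * g - q * h - x₂ * e + x₃ * f) (x≡ zero) (x≡ (suc zero)))
        (trans (cong₂ (λ p q → (e + m * a) * g - (f + m * b) * h - p * e + q * f) (x≡ (suc (suc zero))) (x≡ (suc (suc (suc zero)))))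
        (eq₂ m a b c d e f g h))
    ; (suc (suc (suc zero))) → trans (cong₂ (λ p q → p * h + q * g - x₂ * f - x₃ * e) (x≡ zero) (x≡ (suc zero)))
        (trans (cong₂ (λ p q → (e + m * a) * h + (f + m * b) * g - p * f - q * e) (x≡ (suc (suc zero))) (x≡ (suc (suc (suc zero)))))
        (eq₃ m a b c d e f g h))
    }
    where
    x₂ = x (suc (suc zero))
    x₃ = x (suc (suc (suc zero)))
    a = t zero
    b = t (suc zero)
    c = t (suc (suc zero))
    d = t (suc (suc (suc zero)))
    e = y zero
    f = y (suc zero)
    g = y (suc (suc zero))
    h = y (suc (suc (suc zero)))
    eq₀ : ∀ m a b c d e f g h → (e + m * a) * e + (f + m * b) * f + (g + m * c) * g + (h + m * d) * h
      ≡ e * e + (f * f + (g * g + (h * h + + 0))) + m * (a * e + (b * f + (c * g + (d * h + + 0))))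
    eq₀ = solve-∀
    eq₁ : ∀ m a b c d e f g h → (e + m * a) * f - (f + m * b) * e + (g + m * c) * h - (h + m * d) * g
      ≡ m * (a * f - b * e + c * h - d * g)
    eq₁ = solve-∀
    eq₂ : ∀ m a b c d e f g h → (e + m * a) * g - (f + m * b) * h - (g + m * c) * e + (h + m * d) * f
      ≡ m * (a * g - b * h - c * e + d * f)
    eq₂ = solve-∀
    eq₃ : ∀ m a b c d e f g h → (e + m * a) * h + (f + m * b) * g - (g + m * c) * f - (h + m * d) * e
      ≡ m * (a * h + b * g - c * f - d * e)
    eq₃ = solve-∀

FourSquares-* : ∀ {x y} → FourSquares x → FourSquares y → FourSquares (x * y)
FourSquares-* (q , refl) (q′ , refl) = q ⋆ q′ , ⋆-norm q q′

centered : ∀ x m .{{_ : NonZero m}} → ∃[ y ] ∃[ t ] x ≡ y + + m * t × 2 ℕ.* ∣ y ∣ ℕ.≤ m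
centered x m = go (2 ℕ.* r ℕ.≤? m)
  where
  r = x %ℕ m
  q = x /ℕ m
  go : Dec (2 ℕ.* r ℕ.≤ m) → ∃[ y ] ∃[ t ] x ≡ y + + m * t × 2 ℕ.* ∣ y ∣ ℕ.≤ m
  go (yes p) = + r , q , trans (a≡a%ℕn+[a/ℕn]*n x m) (cong (_+_ (+ r)) (ℤₚ.*-comm q (+ m))) , p
  go (no ¬p) = + r - + m , + 1 + q , trans (a≡a%ℕn+[a/ℕn]*n x m) (shift (+ r) q (+ m)) ,
    subst (λ z → 2 ℕ.* z ℕ.≤ m) (sym ∣y∣) (subst (ℕ._≤ m) (sym (ℕₚ.*-distribˡ-∸ 2 m r))
      (ℕₚ.m≤n+o⇒m∸n≤o (2 ℕ.* m) (2 ℕ.* r) (subst (ℕ._≤ 2 ℕ.* r ℕ.+ m) (cong (m ℕ.+_) (sym (ℕₚ.+-identityʳ m))) (ℕₚ.+-monoˡ-≤ m (ℕₚ.≰⇒≥ ¬p)))))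
    where
    shift : ∀ r q m → r + q * m ≡ r - m + m * (+ 1 + q)
    shift = solve-∀
    ∣y∣ : ∣ + r - + m ∣ ≡ m ∸ r
    ∣y∣ = trans (cong ∣_∣ (ℤₚ.m-n≡m⊖n r m)) (ℤₚ.∣⊖∣-≤ (ℕₚ.<⇒≤ (n%ℕd<d x m)))

private
  module _ (m p : ℕ) .{{_ : NonZero m}} (x y t : ℤ^ 4) (x²≡mp : x ∙ x ≡ + m * + p)
           (x≡ : ∀ i → x i ≡ y i + + m * t i) (2y≤m : ∀ i → 2 ℕ.* ∣ y i ∣ ℕ.≤ m) where

    instance
      +m≢0 : ℤ.NonZero (+ m)
      +m≢0 = ℤ.≢-nonZero λ eq → ℕ.≢-nonZero⁻¹ m (ℤₚ.+-injective eq)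

      +m>0 : ℤ.Positive (+ m)
      +m>0 = ℤ.positive (+<+ (ℕ.>-nonZero⁻¹ m))

    -- The multiplier that replaces m in Lagrange's descent: `y ∙ y` is m times it.
    remainder : ℤ
    remainder = + p - (+ 2 * (y ∙ t) + + m * (t ∙ t))

    x²≡ : x ∙ x ≡ y ∙ y + + 2 * (+ m * (y ∙ t)) + + m * + m * (t ∙ t)
    x²≡ = trans (∙-cong x≡ x≡) (trans (norm-+ y (λ i → + m * t i))
      (cong₂ (λ a b → y ∙ y + + 2 * a + b) (∙-*ʳ (+ m) y t) (norm-* (+ m) t)))

    y²≡ : y ∙ y ≡ + m * remainder
    y²≡ = trans (isolate (y ∙ y) (x ∙ x) (+ m) (y ∙ t) (t ∙ t) x²≡)
      (trans (cong (λ z → z - (+ 2 * (+ m * (y ∙ t)) + + m * + m * (t ∙ t))) x²≡mp) (factor (+ m) (+ p) (y ∙ t) (t ∙ t)))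
      where
      cancel : ∀ a m b c → a + + 2 * (m * b) + m * m * c - (+ 2 * (m * b) + m * m * c) ≡ a
      cancel = solve-∀
      isolate : ∀ a z m b c → z ≡ a + + 2 * (m * b) + m * m * c → a ≡ z - (+ 2 * (m * b) + m * m * c)
      isolate a z m b c refl = sym (cancel a m b c)
      factor : ∀ m p b c → m * p - (+ 2 * (m * b) + m * m * c) ≡ m * (p - (+ 2 * b + m * c))
      factor = solve-∀

    remainder≥0 : + 0 ≤ remainder
    remainder≥0 = ℤₚ.*-cancelˡ-≤-pos (+ 0) remainder (+ m)
      (subst₂ _≤_ (sym (ℤₚ.*-zeroʳ (+ m))) y²≡ (0≤norm y))

    -- Each entry is nonnegative as 2|yᵢ| ≤ m, and the entries sum to 4m(m - `remainder`). Hence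
    -- `remainder` ≤ m, and equality makes every 2yᵢ equal to ±m.
    gap : ℤ^ 4
    gap i = + m * + m - (+ 2 * y i) * (+ 2 * y i)

    gap≥0 : ∀ i → + 0 ≤ gap i
    gap≥0 i = ℤₚ.i≤j⇒0≤j-i (square-mono {+ 2 * y i} {+ m} (subst (ℕ._≤ m) (sym (ℤₚ.abs-* (+ 2) (y i))) (2y≤m i)))

    sum-gap : sum gap ≡ + 4 * (+ m * (+ m - remainder))
    sum-gap = trans (total (+ m) (y zero) (y (suc zero)) (y (suc (suc zero))) (y (suc (suc (suc zero)))))
      (trans (cong (λ z → + 4 * (+ m * + m) - + 4 * z) y²≡) (factor (+ m) remainder))
      where
      total : ∀ m a b c d → (m * m - (+ 2 * a) * (+ 2 * a)) + ((m * m - (+ 2 * b) * (+ 2 * b)) +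
        ((m * m - (+ 2 * c) * (+ 2 * c)) + ((m * m - (+ 2 * d) * (+ 2 * d)) + + 0)))
        ≡ + 4 * (m * m) - + 4 * (a * a + (b * b + (c * c + (d * d + + 0))))
      total = solve-∀
      factor : ∀ m r → + 4 * (m * m) - + 4 * (m * r) ≡ + 4 * (m * (m - r))
      factor = solve-∀

    remainder≤m : remainder ≤ + m
    remainder≤m = ℤₚ.0≤i-j⇒j≤i (ℤₚ.*-cancelˡ-≤-pos (+ 0) (+ m - remainder) (+ m)
      (subst (_≤ + m * (+ m - remainder)) (sym (ℤₚ.*-zeroʳ (+ m)))
        (ℤₚ.*-cancelˡ-≤-pos (+ 0) (+ m * (+ m - remainder)) (+ 4) (subst (+ 0 ≤_) sum-gap (sum-nonneg gap gap≥0)))))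

    -- In the extreme cases, where each yᵢ is 0 or each 2yᵢ is ±m, all of x ∙ x is a multiple of m².
    m∣p : + m * + m ∣ y ∙ y → (∀ i → + m ∣ + 2 * y i) → m ℕ∣.∣ p
    m∣p m²∣y² m∣2y = ∣⇒∣ᵤ (*-cancelˡ-∣ (+ m) (subst (+ m * + m ∣_) (trans (sym x²≡) x²≡mp)
      (∣m∣n⇒∣m+n (∣m∣n⇒∣m+n m²∣y² (subst (+ m * + m ∣_) cross (*-monoʳ-∣ (+ m) (∣-∙ˡ (λ i → + 2 * y i) t m∣2y))))
        (divides (t ∙ t) (ℤₚ.*-comm (+ m * + m) (t ∙ t))))))
      where
      cross : + m * ((λ i → + 2 * y i) ∙ t) ≡ + 2 * (+ m * (y ∙ t))
      cross = trans (cong (_*_ (+ m)) (∙-*ˡ (+ 2) y t)) (swap (+ m) (y ∙ t))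
        where
        swap : ∀ m a → m * (+ 2 * a) ≡ + 2 * (m * a)
        swap = solve-∀

    remainder≡0⇒m∣p : remainder ≡ + 0 → m ℕ∣.∣ p
    remainder≡0⇒m∣p r≡0 = m∣p (divides (+ 0) y²≡0) (λ i → divides (+ 0) (cong (_*_ (+ 2)) (norm≡0⇒≡0 y y²≡0 i)))
      where
      y²≡0 : y ∙ y ≡ + 0
      y²≡0 = trans y²≡ (trans (cong (_*_ (+ m)) r≡0) (ℤₚ.*-zeroʳ (+ m)))

    remainder≡m⇒m∣p : remainder ≡ + m → m ℕ∣.∣ p
    remainder≡m⇒m∣p r≡m = m∣p (divides (+ 1) (trans y²≡ (trans (cong (_*_ (+ m)) r≡m) (sym (ℤₚ.*-identityˡ (+ m * + m)))))) λ i →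
      ∣ᵤ⇒∣ (ℕ∣.∣-reflexive (sym (trans (ℤₚ.abs-* (+ 2) (y i)) (ℕₚ.≤-antisym (2y≤m i) (m≤2y i)))))
      where
      sum-gap≡0 : sum gap ≡ + 0
      sum-gap≡0 = trans sum-gap (trans (cong (λ r → + 4 * (+ m * (+ m - r))) r≡m) (vanish (+ m)))
        where
        vanish : ∀ m → + 4 * (m * (m - m)) ≡ + 0
        vanish = solve-∀
      m²≡4y² : ∀ i → m ℕ.* m ≡ (2 ℕ.* ∣ y i ∣) ℕ.* (2 ℕ.* ∣ y i ∣)
      m²≡4y² i = trans (cong ∣_∣ (trans (ℤₚ.pos-* m m) (ℤₚ.i-j≡0⇒i≡j (+ m * + m) _ (sum-nonneg≡0 gap gap≥0 sum-gap≡0 i))))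
        (trans (ℤₚ.abs-* (+ 2 * y i) (+ 2 * y i)) (cong₂ ℕ._*_ (ℤₚ.abs-* (+ 2) (y i)) (ℤₚ.abs-* (+ 2) (y i))))
      m≤2y : ∀ i → m ℕ.≤ 2 ℕ.* ∣ y i ∣
      m≤2y i = ℕₚ.≮⇒≥ λ lt → ℕₚ.<-irrefl (sym (m²≡4y² i)) (ℕₚ.*-mono-< lt lt)

    -- The product of x with the conjugate of y has norm mp times m `remainder`, and all its entries
    -- are divisible by m; dividing by m removes the factor m².
    descend : FourSquares (remainder * + p)
    descend = w , ℤₚ.*-cancelˡ-≡ (+ m) _ _ (ℤₚ.*-cancelˡ-≡ (+ m) _ _ (begin
      + m * (+ m * (w ∙ w))                    ≡⟨ ℤₚ.*-assoc (+ m) (+ m) (w ∙ w) ⟨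
      + m * + m * (w ∙ w)                      ≡⟨ norm-* (+ m) w ⟨
      (λ i → + m * w i) ∙ (λ i → + m * w i)    ≡⟨ ∙-cong w≡ w≡ ⟨
      (x ⋆ y) ∙ (x ⋆ y)                        ≡⟨ ⋆-norm x y ⟩
      (x ∙ x) * (y ∙ y)                        ≡⟨ cong₂ _*_ x²≡mp y²≡ ⟩
      + m * + p * (+ m * remainder)            ≡⟨ rearrange (+ m) (+ p) remainder ⟩
      + m * (+ m * (remainder * + p))          ∎))
      where
      open ≡-Reasoning
      rearrange : ∀ m p r → m * p * (m * r) ≡ m * (m * (r * p))
      rearrange = solve-∀
      congruent = ⋆-congruent (+ m) remainder t y y²≡ x x≡
      w = proj₁ congruent
      w≡ = proj₂ congruent

-- For 1 < m < p the extreme remainders 0 and m are impossible, as they would make m a divisor of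
-- the prime p. So the remainder lies strictly between and serves as a smaller multiplier.
FourSquares-descent : ∀ {p} → Prime p → ∀ m → Acc ℕ._<_ m → 0 ℕ.< m → m ℕ.< p → FourSquares (+ m * + p) → FourSquares (+ p)
FourSquares-descent {p} pr 1 _ _ _ (q , eq) = q , trans eq (ℤₚ.*-identityˡ (+ p))
FourSquares-descent {p} pr m@(ℕ.suc (ℕ.suc _)) (acc rec) _ m<p (x , x²≡mp) =
  go ∣ r ∣ (ℤₚ.0≤i⇒+∣i∣≡i (remainder≥0 m p x y t x²≡mp x≡ 2y≤m)) (remainder≤m m p x y t x²≡mp x≡ 2y≤m)
  where
  y t : ℤ^ 4
  y i = proj₁ (centered (x i) m)
  t i = proj₁ (proj₂ (centered (x i) m))
  x≡ : ∀ i → x i ≡ y i + + m * t i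
  x≡ i = proj₁ (proj₂ (proj₂ (centered (x i) m)))
  2y≤m : ∀ i → 2 ℕ.* ∣ y i ∣ ℕ.≤ m
  2y≤m i = proj₂ (proj₂ (proj₂ (centered (x i) m)))
  r = remainder m p x y t x²≡mp x≡ 2y≤m
  m∤p : ¬ (m ℕ∣.∣ p)
  m∤p m∣p = Sum.[ (λ ()) , ℕₚ.<⇒≢ m<p ]′ (prime⇒irreducible pr m∣p)
  go : ∀ s → + s ≡ r → r ≤ + m → FourSquares (+ p)
  go ℕ.zero s≡r _ = contradiction (remainder≡0⇒m∣p m p x y t x²≡mp x≡ 2y≤m (sym s≡r)) m∤p
  go s@(ℕ.suc _) s≡r r≤m = Sum.[ smaller , (λ s≡m → contradiction (remainder≡m⇒m∣p m p x y t x²≡mp x≡ 2y≤m (trans (sym s≡r) (cong +_ s≡m))) m∤p) ]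
    (ℕₚ.m≤n⇒m<n∨m≡n (ℤₚ.drop‿+≤+ (subst (_≤ + m) (sym s≡r) r≤m)))
    where
    smaller : s ℕ.< m → FourSquares (+ p)
    smaller s<m = FourSquares-descent pr s (rec s<m) (s≤s z≤n) (ℕₚ.<-trans s<m m<p)
      (subst (λ z → FourSquares (z * + p)) (sym s≡r) (descend m p x y t x²≡mp x≡ 2y≤m))

private
  module _ (h : ℕ) (pr : Prime (1 ℕ.+ 2 ℕ.* h)) where

    p : ℕ
    p = 1 ℕ.+ 2 ℕ.* h

    residue : ℤ → Fin p
    residue z = Fin.fromℕ< (n%ℕd<d z p)

    residue≡⇒∣ : ∀ x y → residue x ≡ residue y → + p ∣ x - y
    residue≡⇒∣ x y eq = divides (x /ℕ p - y /ℕ p) (trans (cong₂ _-_ (a≡a%ℕn+[a/ℕn]*n x p) (a≡a%ℕn+[a/ℕn]*n y p))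
      (trans (cong (λ r → + (x %ℕ p) + (x /ℕ p) * + p - (+ r + (y /ℕ p) * + p)) (sym r≡)) (cancel (+ (x %ℕ p)) (x /ℕ p) (y /ℕ p) (+ p))))
      where
      cancel : ∀ r a b p → r + a * p - (r + b * p) ≡ (a - b) * p
      cancel = solve-∀
      r≡ : x %ℕ p ≡ y %ℕ p
      r≡ = trans (sym (Finₚ.toℕ-fromℕ< (n%ℕd<d x p))) (trans (cong toℕ eq) (Finₚ.toℕ-fromℕ< (n%ℕd<d y p)))

    -- These are 2h + 2 integers, one more than there are residues modulo p.
    candidate : Fin (ℕ.suc h) ⊎ Fin (ℕ.suc h) → ℤ
    candidate (inj₁ a) = + (toℕ a ℕ.* toℕ a)
    candidate (inj₂ b) = - (+ 1 + + (toℕ b ℕ.* toℕ b))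

    -- The factors b - a and b + a of the difference are both positive and less than p = 2h + 1, so
    -- Euclid's lemma applies.
    small≢0 : ∀ a b → a ℕ.≤ h → b ℕ.≤ h → a ℕ.< b → ¬ (p ℕ∣.∣ b ℕ.* b ∸ a ℕ.* a)
    small≢0 a b a≤h b≤h a<b p∣ = Sum.[ tooSmall (ℕₚ.m<n⇒0<n∸m a<b) (ℕₚ.≤-<-trans (ℕₚ.m∸n≤m b a) (ℕₚ.≤-<-trans b≤h h<p))
                                     , tooSmall (ℕₚ.≤-trans (ℕₚ.≤-<-trans z≤n a<b) (ℕₚ.m≤m+n b a)) (s≤s (ℕₚ.+-mono-≤ b≤h (subst (a ℕ.≤_) (sym (ℕₚ.+-identityʳ h)) a≤h))) ]′
        (euclidsLemma (b ∸ a) (b ℕ.+ a) pr (subst (p ℕ∣.∣_) (trans difference (ℕₚ.*-comm (b ℕ.+ a) (b ∸ a))) p∣))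
      where
      h<p : h ℕ.< p
      h<p = s≤s (ℕₚ.m≤m+n h (h ℕ.+ 0))
      tooSmall : ∀ {n} → 0 ℕ.< n → n ℕ.< p → ¬ (p ℕ∣.∣ n)
      tooSmall {ℕ.suc n} _ n<p p∣n = ℕₚ.<⇒≱ n<p (ℕ∣.∣⇒≤ p∣n)
      difference : b ℕ.* b ∸ a ℕ.* a ≡ (b ℕ.+ a) ℕ.* (b ∸ a)
      difference = trans (cong₂ _∸_ (refl {x = b ℕ.* b}) (refl {x = a ℕ.* a})) (sym (trans (ℕₚ.*-distribˡ-∸ (b ℕ.+ a) b a)
        (trans (cong₂ _∸_ (ℕₚ.*-distribʳ-+ b b a) (trans (ℕₚ.*-distribʳ-+ a b a) (cong (ℕ._+ a ℕ.* a) (ℕₚ.*-comm b a))))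
          (trans (cong (b ℕ.* b ℕ.+ a ℕ.* b ∸_) (ℕₚ.+-comm (a ℕ.* b) (a ℕ.* a))) (trans (sym (ℕₚ.∸-+-assoc (b ℕ.* b ℕ.+ a ℕ.* b) (a ℕ.* a) (a ℕ.* b)))
            (trans (cong (_∸ a ℕ.* b) (ℕₚ.+-∸-comm (a ℕ.* b) (ℕₚ.*-mono-≤ (ℕₚ.<⇒≤ a<b) (ℕₚ.<⇒≤ a<b)))) (ℕₚ.m+n∸n≡m _ (a ℕ.* b))))))))

    squares-distinct : ∀ a b → a ℕ.≤ h → b ℕ.≤ h → a ≢ b → ¬ (p ℕ∣.∣ ∣ + (b ℕ.* b) - + (a ℕ.* a) ∣)
    squares-distinct a b a≤h b≤h a≢b p∣ = Sum.[ (λ a≤b → ordered a b a≤h b≤h (ℕₚ.≤∧≢⇒< a≤b a≢b) p∣)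
      , (λ b≤a → ordered b a b≤h a≤h (ℕₚ.≤∧≢⇒< b≤a (≢-sym a≢b)) (subst (p ℕ∣.∣_) (ℤₚ.∣i-j∣≡∣j-i∣ (+ (b ℕ.* b)) (+ (a ℕ.* a))) p∣)) ]′
      (ℕₚ.≤-total a b)
      where
      ∣b²-a²∣ : ∀ a b → a ℕ.< b → ∣ + (b ℕ.* b) - + (a ℕ.* a) ∣ ≡ b ℕ.* b ∸ a ℕ.* a
      ∣b²-a²∣ a b a<b = cong ∣_∣ (trans (ℤₚ.m-n≡m⊖n (b ℕ.* b) (a ℕ.* a)) (ℤₚ.⊖-≥ (ℕₚ.*-mono-≤ (ℕₚ.<⇒≤ a<b) (ℕₚ.<⇒≤ a<b))))

      ordered : ∀ a b → a ℕ.≤ h → b ℕ.≤ h → a ℕ.< b → ¬ (p ℕ∣.∣ ∣ + (b ℕ.* b) - + (a ℕ.* a) ∣)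
      ordered a b a≤h b≤h a<b p∣ = small≢0 a b a≤h b≤h a<b (subst (p ℕ∣.∣_) (∣b²-a²∣ a b a<b) p∣)

    -- That is, p divides a² + 1 + b², written as a difference of two candidates.
    SumOfSquares : Set
    SumOfSquares = ∃[ a ] ∃[ b ] a ℕ.≤ h × b ℕ.≤ h × + p ∣ + (a ℕ.* a) - (- (+ 1 + + (b ℕ.* b)))

    -- The squares of 0, ..., h are distinct modulo p, so congruent candidates at different places
    -- are of different kinds.
    collision : ∀ (s t : Fin (ℕ.suc h) ⊎ Fin (ℕ.suc h)) → s ≢ t → + p ∣ candidate s - candidate t → SumOfSquares
    collision (inj₁ a) (inj₂ b) _ d = toℕ a , toℕ b , Finₚ.toℕ≤pred[n] a , Finₚ.toℕ≤pred[n] b , d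
    collision (inj₂ b) (inj₁ a) _ d = toℕ a , toℕ b , Finₚ.toℕ≤pred[n] a , Finₚ.toℕ≤pred[n] b ,
      subst (+ p ∣_) (-swap (candidate (inj₂ b)) (candidate (inj₁ a))) (∣m⇒∣-m d)
      where
      -swap : ∀ a b → - (a - b) ≡ b - a
      -swap = solve-∀
    collision (inj₁ a) (inj₁ b) a≢b d = contradiction (∣⇒∣ᵤ d)
      (squares-distinct (toℕ b) (toℕ a) (Finₚ.toℕ≤pred[n] b) (Finₚ.toℕ≤pred[n] a) λ eq → a≢b (cong inj₁ (Finₚ.toℕ-injective (sym eq))))
    collision (inj₂ a) (inj₂ b) a≢b d = contradiction (∣⇒∣ᵤ (subst (+ p ∣_) (cancel (+ (toℕ a ℕ.* toℕ a)) (+ (toℕ b ℕ.* toℕ b))) d))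
      (squares-distinct (toℕ a) (toℕ b) (Finₚ.toℕ≤pred[n] a) (Finₚ.toℕ≤pred[n] b) λ eq → a≢b (cong inj₂ (Finₚ.toℕ-injective eq)))
      where
      cancel : ∀ a b → - (+ 1 + a) - - (+ 1 + b) ≡ b - a
      cancel = solve-∀

    sumOfSquares : SumOfSquares
    sumOfSquares = go (Finₚ.pigeonhole p<2h+2 (residue ∘ candidate ∘ Fin.splitAt (ℕ.suc h)))
      where
      p<2h+2 : p ℕ.< ℕ.suc h ℕ.+ ℕ.suc h
      p<2h+2 = s≤s (ℕₚ.≤-reflexive (trans (cong (λ z → ℕ.suc (h ℕ.+ z)) (ℕₚ.+-identityʳ h)) (sym (ℕₚ.+-suc h h))))
      go : ∃ (λ i → ∃ λ j → i Fin.< j × residue (candidate (Fin.splitAt (ℕ.suc h) i)) ≡ residue (candidate (Fin.splitAt (ℕ.suc h) j))) → SumOfSquares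
      go (i , j , i<j , eq) = collision s t (λ s≡t → Finₚ.<⇒≢ i<j (splitAt-injective s≡t)) (residue≡⇒∣ (candidate s) (candidate t) eq)
        where
        s = Fin.splitAt (ℕ.suc h) i
        t = Fin.splitAt (ℕ.suc h) j
        splitAt-injective : Fin.splitAt (ℕ.suc h) i ≡ Fin.splitAt (ℕ.suc h) j → i ≡ j
        splitAt-injective eq = trans (sym (Finₚ.join-splitAt (ℕ.suc h) (ℕ.suc h) i))
          (trans (cong (Fin.join (ℕ.suc h) (ℕ.suc h)) eq) (Finₚ.join-splitAt (ℕ.suc h) (ℕ.suc h) j))

    oddPrime : FourSquares (+ p)
    oddPrime = go sumOfSquares
      where
      go : SumOfSquares → FourSquares (+ p)
      go (a , b , a≤h , b≤h , p∣) = descend′ (∣⇒∣ᵤ (subst (+ p ∣_) (N≡ (+ (a ℕ.* a)) (+ (b ℕ.* b))) p∣))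
        where
        N = a ℕ.* a ℕ.+ (1 ℕ.+ b ℕ.* b)
        N≡ : ∀ x y → x - (- (+ 1 + y)) ≡ x + (+ 1 + y)
        N≡ = solve-∀
        -- Makes the cofactor m in N = mp smaller than p, as the descent requires.
        N≤ : N ℕ.< p ℕ.* p
        N≤ = s≤s (begin
          a ℕ.* a ℕ.+ (1 ℕ.+ b ℕ.* b)          ≤⟨ ℕₚ.+-mono-≤ (ℕₚ.*-mono-≤ a≤h a≤h) (s≤s (ℕₚ.*-mono-≤ b≤h b≤h)) ⟩
          h ℕ.* h ℕ.+ (1 ℕ.+ h ℕ.* h)          ≡⟨ ℕₚ.+-suc (h ℕ.* h) (h ℕ.* h) ⟩
          1 ℕ.+ (h ℕ.* h ℕ.+ h ℕ.* h)          ≡⟨ cong (λ z → 1 ℕ.+ (h ℕ.* h ℕ.+ z)) (ℕₚ.+-identityʳ (h ℕ.* h)) ⟨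
          1 ℕ.+ 2 ℕ.* (h ℕ.* h)                ≡⟨ cong (1 ℕ.+_) (ℕₚ.*-assoc 2 h h) ⟨
          1 ℕ.+ 2 ℕ.* h ℕ.* h                  ≤⟨ ℕₚ.+-mono-≤ 1≤2h (ℕₚ.*-monoʳ-≤ (2 ℕ.* h) h≤p) ⟩
          2 ℕ.* h ℕ.+ 2 ℕ.* h ℕ.* p            ∎)
          where
          open ℕₚ.≤-Reasoning
          1≤2h : 1 ℕ.≤ 2 ℕ.* h
          1≤2h = ℕ.s≤s⁻¹ (ℕ.nonTrivial⇒n>1 p {{prime⇒nonTrivial pr}})
          h≤p : h ℕ.≤ p
          h≤p = ℕₚ.m≤n⇒m≤1+n (ℕₚ.m≤m+n h (h ℕ.+ 0))
        q : ℤ^ 4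
        q = vec4 (+ a) (+ 1) (+ b) (+ 0)
        q² : q ∙ q ≡ + N
        q² = trans (cong₂ (λ x y → x + (+ 1 + (y + + 0))) (sym (ℤₚ.pos-* a a)) (sym (ℤₚ.pos-* b b)))
          (cong (λ z → + (a ℕ.* a ℕ.+ (1 ℕ.+ z))) (ℕₚ.+-identityʳ (b ℕ.* b)))
        descend′ : p ℕ∣.∣ N → FourSquares (+ p)
        descend′ (ℕ∣.divides m N≡mp) = FourSquares-descent pr m (<-wellFounded m) (m>0 m N≡mp)
          (ℕₚ.*-cancelʳ-< p m p (subst (ℕ._< p ℕ.* p) N≡mp N≤)) (q , trans q² (trans (cong +_ N≡mp) (ℤₚ.pos-* m p)))
          where
          m>0 : ∀ m → N ≡ m ℕ.* p → 0 ℕ.< m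
          m>0 ℕ.zero    eq = contradiction (trans (sym (ℕₚ.+-suc (a ℕ.* a) (b ℕ.* b))) eq) λ ()
          m>0 (ℕ.suc m) eq = s≤s z≤n

FourSquares-prime : ∀ {p} → Prime p → FourSquares (+ p)
FourSquares-prime {p} pr = Sum.[ even , odd′ ]′ (even-or-odd p (ℕ.nonTrivial⇒n>1 p {{prime⇒nonTrivial pr}}))
  where
  even : ∃[ j ] p ≡ 2 ℕ.* j → FourSquares (+ p)
  even (j , p≡2j) = vec4 (+ 1) (+ 1) (+ 0) (+ 0) , cong +_
    (Sum.[ (λ ()) , id ]′ (prime⇒irreducible pr (ℕ∣.divides j (trans p≡2j (ℕₚ.*-comm 2 j)))))
  odd′ : ∃[ j ] p ≡ 3 ℕ.+ 2 ℕ.* j → FourSquares (+ p)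
  odd′ (j , p≡) = subst (λ n → FourSquares (+ n)) (sym p≡1+2h) (oddPrime (ℕ.suc j) (subst Prime p≡1+2h pr))
    where
    p≡1+2h : p ≡ 1 ℕ.+ 2 ℕ.* ℕ.suc j
    p≡1+2h = trans p≡ (cong ℕ.suc (sym (ℕₚ.*-suc 2 j)))

fourSquares : ∀ n → FourSquares (+ n)
fourSquares ℕ.zero        = (λ _ → + 0) , refl
fourSquares n@(ℕ.suc _) = subst (λ n → FourSquares (+ n)) (sym isFactorisation) (product-primes factors factorsPrime)
  where
  open PrimeFactorisation (factorise n)
  product-primes : ∀ ps → All Prime ps → FourSquares (+ ℕ-product ps)
  product-primes []       []          = vec4 (+ 1) (+ 0) (+ 0) (+ 0) , refl
  product-primes (p ∷ ps) (pr ∷ prs) = subst FourSquares (sym (ℤₚ.pos-* p (ℕ-product ps)))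
    (FourSquares-* (FourSquares-prime pr) (product-primes ps prs))

-- Frames

⊛-similarity : ∀ {r n d} (F : Fin r → ℤ^ n) → (∀ i j → F i ∙ F j ≡ d * δ i j) →
  ∀ x y → (x ⊛ F) ∙ (y ⊛ F) ≡ d * (x ∙ y)
⊛-similarity {d = d} F FFᵗ x y = begin
  (x ⊛ F) ∙ (y ⊛ F)                        ≡⟨ ⊛-∙ x F (y ⊛ F) ⟩
  x ∙ (λ i → F i ∙ (y ⊛ F))                ≡⟨ ∙-congˡ x (λ i → ∙-⊛ y F (F i)) ⟩
  x ∙ (λ i → y ∙ (λ j → F i ∙ F j))        ≡⟨ ∙-congˡ x (λ i → ∙-congˡ y (λ j → FFᵗ i j)) ⟩
  x ∙ (λ i → y ∙ (λ j → d * δ i j))        ≡⟨ ∙-congˡ x (λ i → trans (∙-*ʳ d y (δ i)) (cong (_*_ d) (∙-δ y i))) ⟩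
  x ∙ (λ i → d * y i)                      ≡⟨ ∙-*ʳ d x y ⟩
  d * (x ∙ y)                              ∎
  where open ≡-Reasoning

-- `u₀` is a minimal vector of L. Its coordinates with respect to the frame give a word of norm 8k;
-- were they all divisible by 2k, `u₀` would be an integral combination of the rows of `F`.
module Frame {n} (L : Lattice n) (k : ℕ) .{{_ : NonZero k}} (F : Fin n → ℤ^ n)
  (FFᵗ : ∀ i j → F i ∙ F j ≡ + (2 ℕ.* k) * δ i j)
  (FᵗF : ∀ i j → (F ᵗ) i ∙ (F ᵗ) j ≡ + (2 ℕ.* k) * δ i j)
  (F∈ : ∀ i → Lattice.Dual₂ L (F i))
  (u₀ : ℤ^ n) (u₀∈ : Lattice.Dual₂ L u₀) (u₀²≡4 : u₀ ∙ u₀ ≡ + 4)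
  (u₀∉F : ∀ z → ¬ (∀ j → u₀ j ≡ (z ⊛ F) j))
  where

  open Lattice L

  private
    K = + k

    2k≡ : + (2 ℕ.* k) ≡ + 2 * K
    2k≡ = ℤₚ.pos-* 2 k

    4k≡ : + (4 ℕ.* k) ≡ + 4 * K
    4k≡ = ℤₚ.pos-* 4 k

    8k≡ : + (8 ℕ.* k) ≡ + 8 * K
    8k≡ = ℤₚ.pos-* 8 k

    instance
      K≢0 : ℤ.NonZero K
      K≢0 = ℤ.≢-nonZero λ eq → ℕ.≢-nonZero⁻¹ k (ℤₚ.+-injective eq)

    -- States without denominators that `v` is the double of cF/2k. Comparing the norm of cF on both
    -- sides shows that twice the norm of `c` is k times that of `v`.
    scaled : ℤ^ n → ℤ^ n → Set
    scaled c v = ∀ j → (c ⊛ F) j ≡ K * v j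

    ⊛F∙⊛F : ∀ c c′ → (c ⊛ F) ∙ (c′ ⊛ F) ≡ + 2 * K * (c ∙ c′)
    ⊛F∙⊛F c c′ = trans (⊛-similarity {d = + (2 ℕ.* k)} F FFᵗ c c′) (cong (_* (c ∙ c′)) 2k≡)

    coordinates : ℤ^ n → ℤ^ n
    coordinates w i = w ∙ F i

    coordinates⊛F : ∀ w j → (coordinates w ⊛ F) j ≡ K * (+ 2 * w j)
    coordinates⊛F w j = begin
      (coordinates w ⊛ F) j                       ≡⟨ ⊛-∙ w (F ᵗ) ((F ᵗ) j) ⟩
      w ∙ (λ l → (F ᵗ) l ∙ (F ᵗ) j)               ≡⟨ ∙-congˡ w (λ l → trans (FᵗF l j) (cong (_*_ (+ (2 ℕ.* k))) (δ-sym l j))) ⟩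
      w ∙ (λ l → + (2 ℕ.* k) * δ j l)             ≡⟨ ∙-*ʳ (+ (2 ℕ.* k)) w (δ j) ⟩
      + (2 ℕ.* k) * (w ∙ δ j)                     ≡⟨ cong₂ _*_ 2k≡ (∙-δ w j) ⟩
      + 2 * K * w j                               ≡⟨ rearrange K (w j) ⟩
      K * (+ 2 * w j)                             ∎
      where
      open ≡-Reasoning
      rearrange : ∀ K w → + 2 * K * w ≡ K * (+ 2 * w)
      rearrange = solve-∀

    2∙≡k∙ : ∀ c v c′ v′ → scaled c v → scaled c′ v′ → + 2 * (c ∙ c′) ≡ K * (v ∙ v′)
    2∙≡k∙ c v c′ v′ cF c′F = ℤₚ.*-cancelˡ-≡ K _ _ (begin
      K * (+ 2 * (c ∙ c′))                        ≡⟨ rearrange K (c ∙ c′) ⟨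
      + 2 * K * (c ∙ c′)                          ≡⟨ ⊛F∙⊛F c c′ ⟨
      (c ⊛ F) ∙ (c′ ⊛ F)                          ≡⟨ ∙-cong cF c′F ⟩
      (λ j → K * v j) ∙ (λ j → K * v′ j)          ≡⟨ ∙-*ˡ K v _ ⟩
      K * (v ∙ (λ j → K * v′ j))                  ≡⟨ cong (_*_ K) (∙-*ʳ K v v′) ⟩
      K * (K * (v ∙ v′))                          ∎)
      where
      open ≡-Reasoning
      rearrange : ∀ K w → + 2 * K * w ≡ K * (+ 2 * w)
      rearrange = solve-∀

    Mem : ℤ^ n → Set
    Mem c = ∃[ v ] InLattice v × scaled c v

    even-coordinates : ∀ {w} → InLattice w → ∀ i → + 2 ∣ coordinates w i
    even-coordinates {w} (a , u , w≡ , _) i = subst (+ 2 ∣_)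
      (sym (trans (∙-cong w≡ (λ _ → refl)) (trans (∙-+ˡ (a ⊛ G) _ (F i)) (cong (_+_ ((a ⊛ G) ∙ F i)) (∙-*ˡ (+ 2) u (F i))))))
      (∣m∣n⇒∣m+n (∣-⊛∙ a G (F i) (F∈ i)) (divides (u ∙ F i) (ℤₚ.*-comm (+ 2) (u ∙ F i))))

    -- Every lattice vector comes from an integral `c`: the rows of `F` lie in C₁⊥ modulo 2 and so
    -- have even inner products with it. A condition on all members of the preimage thereby becomes
    -- one on the whole lattice.
    half-coordinates : ∀ {w} → InLattice w → ∃[ c ] (∀ i → coordinates w i ≡ + 2 * c i) × scaled c w
    half-coordinates {w} w∈ = c , c≡ , λ j → ℤₚ.*-cancelˡ-≡ (+ 2) _ _
        (trans (sym (⊛-* (+ 2) c F j)) (trans (⊛-cong F (sym ∘ c≡) j) (trans (coordinates⊛F w j) (rearrange K (w j)))))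
      where
      rearrange : ∀ K w → K * (+ 2 * w) ≡ + 2 * (K * w)
      rearrange = solve-∀
      c : ℤ^ n
      c i = _∣_.quotient (even-coordinates w∈ i)
      c≡ : ∀ i → coordinates w i ≡ + 2 * c i
      c≡ i = trans (_∣_.equality (even-coordinates w∈ i)) (ℤₚ.*-comm (c i) (+ 2))

    Mem-2k : ∀ (z : ℤ^ n) → Mem (λ i → z i * + (2 ℕ.* k))
    Mem-2k z = (λ j → + 2 * (z ⊛ F) j) , InLattice-2* (λ i → subst (+ 2 ∣_) (sym (∙-⊛ z F (G i))) (∣-∙ʳ z _ (λ l → F∈ l i))) ,
      λ j → trans (⊛-cong F (λ i → trans (ℤₚ.*-comm (z i) _) (cong (_* z i) 2k≡)) j)
        (trans (⊛-* (+ 2 * K) z F j) (rearrange K ((z ⊛ F) j)))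
      where
      rearrange : ∀ K w → + 2 * K * w ≡ K * (+ 2 * w)
      rearrange = solve-∀

    selfOrthogonal : ∀ {x y} → Mem x → Mem y → + (2 ℕ.* k) ∣ x ∙ y
    selfOrthogonal {x} {y} (v , v∈ , xF) (w , w∈ , yF) = divides q (ℤₚ.*-cancelˡ-≡ (+ 2) (x ∙ y) (q * + (2 ℕ.* k)) (begin
      + 2 * (x ∙ y)              ≡⟨ 2∙≡k∙ x v y w xF yF ⟩
      K * (v ∙ w)                ≡⟨ cong (λ z → K * z) eq ⟩
      K * (q * + 4)              ≡⟨ rearrange K q ⟩
      + 2 * (q * (+ 2 * K))      ≡⟨ cong (λ z → + 2 * (q * z)) 2k≡ ⟨
      + 2 * (q * + (2 ℕ.* k))    ∎))
      where
      open ≡-Reasoning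
      q = _∣_.quotient (4∣∙ v∈ w∈)
      eq = _∣_.equality (4∣∙ v∈ w∈)
      rearrange : ∀ K q → K * (q * + 4) ≡ + 2 * (q * (+ 2 * K))
      rearrange = solve-∀

    doublyEven : ∀ {x} → Mem x → + (4 ℕ.* k) ∣ x ∙ x
    doublyEven {x} (v , v∈ , xF) = divides q (ℤₚ.*-cancelˡ-≡ (+ 2) (x ∙ x) (q * + (4 ℕ.* k)) (begin
      + 2 * (x ∙ x)              ≡⟨ 2∙≡k∙ x v x v xF xF ⟩
      K * (v ∙ v)                ≡⟨ cong (λ w → K * w) eq ⟩
      K * (q * + 8)              ≡⟨ rearrange K q ⟩
      + 2 * (q * (+ 4 * K))      ≡⟨ cong (λ w → + 2 * (q * w)) 4k≡ ⟨
      + 2 * (q * + (4 ℕ.* k))    ∎))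
      where
      open ≡-Reasoning
      q = _∣_.quotient (8∣norm v∈)
      eq = _∣_.equality (8∣norm v∈)
      rearrange : ∀ K q → K * (q * + 8) ≡ + 2 * (q * (+ 4 * K))
      rearrange = solve-∀

    -- The hypothesis says that cF has inner products divisible by 4k with the whole lattice. The
    -- lattice vectors 4eⱼ then make cF/k integral, and unimodularity puts cF/k into the lattice.
    dual⇒Mem : ∀ c → (∀ y → Mem y → + (2 ℕ.* k) ∣ c ∙ y) → Mem c
    dual⇒Mem c c⊥ = v , dual v 4∣v∙ , v≡
      where
      4k∣ : ∀ w → InLattice w → K * + 4 ∣ (c ⊛ F) ∙ w
      4k∣ w w∈ = subst₂ _∣_ (trans (cong (_*_ (+ 2)) 2k≡) (rearrange K)) (sym eq) (*-monoʳ-∣ (+ 2) (c⊥ c′ (w , w∈ , c′F)))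
        where
        c′ = proj₁ (half-coordinates w∈)
        c′≡ = proj₁ (proj₂ (half-coordinates w∈))
        c′F = proj₂ (proj₂ (half-coordinates w∈))
        rearrange : ∀ K → + 2 * (+ 2 * K) ≡ K * + 4
        rearrange = solve-∀
        eq : (c ⊛ F) ∙ w ≡ + 2 * (c ∙ c′)
        eq = trans (⊛-∙ c F w) (trans (∙-congˡ c (λ i → trans (∙-comm (F i) w) (c′≡ i))) (∙-*ʳ (+ 2) c c′))
      k∣ : ∀ j → K ∣ (c ⊛ F) j
      k∣ j = *-cancelˡ-∣ (+ 4) (subst₂ _∣_ (ℤₚ.*-comm K (+ 4)) eq (4k∣ _ (InLattice-4δ j)))
        where
        eq : (c ⊛ F) ∙ (λ i → + 2 * (+ 2 * δ j i)) ≡ + 4 * (c ⊛ F) j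
        eq = trans (∙-*ʳ (+ 2) (c ⊛ F) _) (trans (cong (_*_ (+ 2)) (trans (∙-*ʳ (+ 2) (c ⊛ F) (δ j)) (cong (_*_ (+ 2)) (∙-δ (c ⊛ F) j)))) (sym (ℤₚ.*-assoc (+ 2) (+ 2) ((c ⊛ F) j))))
      v : ℤ^ n
      v j = _∣_.quotient (k∣ j)
      v≡ : scaled c v
      v≡ j = trans (_∣_.equality (k∣ j)) (ℤₚ.*-comm (v j) K)
      4∣v∙ : ∀ w → InLattice w → + 4 ∣ v ∙ w
      4∣v∙ w w∈ = *-cancelˡ-∣ K (subst (K * + 4 ∣_) (trans (∙-cong v≡ (λ _ → refl)) (∙-*ˡ K v w)) (4k∣ w w∈))

    minimum : ∀ {x} → Mem x → ¬ (∀ i → + (2 ℕ.* k) ∣ x i) → + (8 ℕ.* k) ≤ x ∙ x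
    minimum {x} (v , v∈ , xF) x≢0 = ℤₚ.≮⇒≥ λ x²<8k →
      x≢0 λ i → subst (+ (2 ℕ.* k) ∣_) (sym (norm≡0⇒≡0 x (x²≡0 x²<8k) i)) (divides (+ 0) refl)
      where
      v²<16 : x ∙ x < + (8 ℕ.* k) → v ∙ v < + 16
      v²<16 x²<8k = ℤₚ.*-cancelˡ-<-nonNeg {v ∙ v} {+ 16} K (subst₂ _<_ (2∙≡k∙ x v x v xF xF) (trans (cong (_*_ (+ 2)) (8k≡)) (rearrange K))
        (ℤₚ.*-monoˡ-<-pos (+ 2) x²<8k))
        where
        rearrange : ∀ K → + 2 * (+ 8 * K) ≡ K * + 16
        rearrange = solve-∀
      x²≡0 : x ∙ x < + (8 ℕ.* k) → x ∙ x ≡ + 0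
      x²≡0 x²<8k = ℤₚ.*-cancelˡ-≡ (+ 2) (x ∙ x) (+ 0) (trans (2∙≡k∙ x v x v xF xF) (trans (cong (_*_ K) (sum-0 _ λ j → cong (λ z → z * z) (minimumNorm v∈ (v²<16 x²<8k) j))) (ℤₚ.*-zeroʳ K)))

    attained : ∃[ x ] Mem x × ¬ (∀ i → + (2 ℕ.* k) ∣ x i) × x ∙ x ≡ + (8 ℕ.* k)
    attained = c , ((λ j → + 2 * u₀ j) , InLattice-2* u₀∈ , coordinates⊛F u₀) , c≢0 , c²
      where
      c = coordinates u₀
      c² : c ∙ c ≡ + (8 ℕ.* k)
      c² = ℤₚ.*-cancelˡ-≡ (+ 2) _ _ (trans (2∙≡k∙ c (λ j → + 2 * u₀ j) c (λ j → + 2 * u₀ j) (coordinates⊛F u₀) (coordinates⊛F u₀))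
        (trans (cong (_*_ K) (trans (norm-* (+ 2) u₀) (cong (_*_ (+ 4)) u₀²≡4)))
        (trans (rearrange K) (cong (_*_ (+ 2)) (sym (8k≡))))))
        where
        rearrange : ∀ K → K * + 16 ≡ + 2 * (+ 8 * K)
        rearrange = solve-∀
      c≢0 : ¬ (∀ i → + (2 ℕ.* k) ∣ c i)
      c≢0 d = u₀∉F z λ j → ℤₚ.*-cancelˡ-≡ (+ 2) _ _ (ℤₚ.*-cancelˡ-≡ K _ _ (begin
        K * (+ 2 * u₀ j)                  ≡⟨ coordinates⊛F u₀ j ⟨
        (c ⊛ F) j                         ≡⟨ ⊛-cong F (λ i → trans (_∣_.equality (d i)) (trans (ℤₚ.*-comm (z i) _) (cong (_* z i) 2k≡))) j ⟩
        ((λ i → + 2 * K * z i) ⊛ F) j     ≡⟨ ⊛-* (+ 2 * K) z F j ⟩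
        + 2 * K * (z ⊛ F) j               ≡⟨ rearrange K ((z ⊛ F) j) ⟩
        K * (+ 2 * (z ⊛ F) j)             ∎))
        where
        open ≡-Reasoning
        rearrange : ∀ K w → + 2 * K * w ≡ K * (+ 2 * w)
        rearrange = solve-∀
        z : ℤ^ n
        z i = _∣_.quotient (d i)

  framePreimage : ExtremalPreimage k n
  framePreimage = record
    { Mem            = Mem
    ; Mem-cong       = λ { x≡y (v , v∈ , xF) → v , v∈ , λ j → trans (⊛-cong F (sym ∘ x≡y) j) (xF j) }
    ; Mem-+          = λ { {x} {y} (v , v∈ , xF) (w , w∈ , yF) → _ , InLattice-+ v∈ w∈ ,
                       λ j → trans (⊛-+ x y F j) (trans (cong₂ _+_ (xF j) (yF j)) (sym (ℤₚ.*-distribˡ-+ K (v j) (w j)))) }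
    ; Mem-*          = λ { a {x} (v , v∈ , xF) → _ , InLattice-* a v∈ ,
                       λ j → trans (⊛-* a x F j) (trans (cong (_*_ a) (xF j)) (swap a K (v j))) }
    ; Mem-2k         = Mem-2k
    ; selfOrthogonal = λ {x} {y} → selfOrthogonal {x} {y}
    ; dual⇒Mem       = dual⇒Mem
    ; doublyEven     = λ {x} → doublyEven {x}
    ; minimum        = λ {x} → minimum {x}
    ; attained       = attained
    }
    where
    swap : ∀ a b c → a * (b * c) ≡ b * (a * c)
    swap = solve-∀

-- Frames from anticommuting similarities

-- Adding the double sum over s and t to the same sum with s and t exchanged cancels all terms off
-- the diagonal; the factor 2 is then removed.
⊛∙⊛-anticommuting : ∀ {r n} (x c : ℤ^ r) (A B : Fin r → ℤ^ n) d →
  (∀ s t → A s ∙ B t + A t ∙ B s ≡ + 2 * (c s * δ s t) * d) → (x ⊛ A) ∙ (x ⊛ B) ≡ (x ∙ (λ s → c s * x s)) * d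
⊛∙⊛-anticommuting x c A B d AB = ℤₚ.*-cancelˡ-≡ (+ 2) _ _ (begin
  + 2 * ((x ⊛ A) ∙ (x ⊛ B))                                      ≡⟨ double ((x ⊛ A) ∙ (x ⊛ B)) ⟩
  (x ⊛ A) ∙ (x ⊛ B) + (x ⊛ A) ∙ (x ⊛ B)                          ≡⟨ cong₂ _+_ left right ⟩
  x ∙ (λ s → x ∙ (λ t → A s ∙ B t)) + x ∙ (λ s → x ∙ (λ t → A t ∙ B s))
    ≡⟨ ∙-+ʳ x (λ s → x ∙ (λ t → A s ∙ B t)) (λ s → x ∙ (λ t → A t ∙ B s)) ⟨
  x ∙ (λ s → x ∙ (λ t → A s ∙ B t) + x ∙ (λ t → A t ∙ B s))
    ≡⟨ ∙-congˡ x (λ s → trans (sym (∙-+ʳ x (λ t → A s ∙ B t) (λ t → A t ∙ B s))) (inner s)) ⟩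
  x ∙ (λ s → + 2 * d * (c s * x s))                              ≡⟨ ∙-*ʳ (+ 2 * d) x (λ s → c s * x s) ⟩
  + 2 * d * (x ∙ (λ s → c s * x s))                              ≡⟨ rearrange d (x ∙ (λ s → c s * x s)) ⟩
  + 2 * ((x ∙ (λ s → c s * x s)) * d)                              ∎)
  where
  open ≡-Reasoning
  double : ∀ a → + 2 * a ≡ a + a
  double = solve-∀
  rearrange : ∀ d f → + 2 * d * f ≡ + 2 * (f * d)
  rearrange = solve-∀
  left : (x ⊛ A) ∙ (x ⊛ B) ≡ x ∙ (λ s → x ∙ (λ t → A s ∙ B t))
  left = trans (⊛-∙ x A (x ⊛ B)) (∙-congˡ x λ s → ∙-⊛ x B (A s))
  right : (x ⊛ A) ∙ (x ⊛ B) ≡ x ∙ (λ s → x ∙ (λ t → A t ∙ B s))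
  right = trans (∙-⊛ x B (x ⊛ A)) (∙-congˡ x λ s → ⊛-∙ x A (B s))
  regroup : ∀ a b d → + 2 * (a * b) * d ≡ + 2 * d * a * b
  regroup = solve-∀
  inner : ∀ s → x ∙ (λ t → A s ∙ B t + A t ∙ B s) ≡ + 2 * d * (c s * x s)
  inner s = begin
    x ∙ (λ t → A s ∙ B t + A t ∙ B s)    ≡⟨ ∙-congˡ x (λ t → trans (AB s t) (regroup (c s) (δ s t) d)) ⟩
    x ∙ (λ t → + 2 * d * c s * δ s t)    ≡⟨ ∙-*ʳ (+ 2 * d * c s) x (δ s) ⟩
    + 2 * d * c s * (x ∙ δ s)            ≡⟨ cong (_*_ (+ 2 * d * c s)) (∙-δ x s) ⟩
    + 2 * d * c s * x s                  ≡⟨ ℤₚ.*-assoc (+ 2 * d) (c s) (x s) ⟩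
    + 2 * d * (c s * x s)                ∎

-- Index 0 belongs to U, with UUᵗ = 6, the others to the identity and the three skew signed
-- permutations.
scale : Fin 5 → ℤ
scale zero    = + 6
scale (suc _) = + 1

-- The product rule makes every linear combination of the five matrices a similarity.
record Similarities {n} (L : Lattice n) : Set where
  open Lattice L
  field
    T         : Fin 5 → Fin n → ℤ^ n
    sign      : Fin 5 → ℤ
    sign²     : ∀ s → sign s * sign s ≡ + 1
    T-sym     : ∀ s i j → T s i j ≡ sign s * T s j i
    T-product : ∀ s t i j → T s i ∙ T t j + T t i ∙ T s j ≡ + 2 * (scale s * δ s t) * δ i j
    T₀∈       : ∀ i → Dual₂ (T zero i)
    u₀        : ℤ^ n
    u₀∈       : Dual₂ u₀
    u₀²≡4     : u₀ ∙ u₀ ≡ + 4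
    u₀-odd    : ∃[ j ] odd (u₀ j) ≡ true

  similarity : ℤ^ 5 → Fin n → ℤ^ n
  similarity x i = x ⊛ (λ s → T s i)

  factor : ℤ^ 5 → ℤ
  factor x = x ∙ (λ s → scale s * x s)

  similarity∙similarity : ∀ x i j → similarity x i ∙ similarity x j ≡ factor x * δ i j
  similarity∙similarity x i j = ⊛∙⊛-anticommuting x scale (λ s → T s i) (λ s → T s j) (δ i j) (λ s t → T-product s t i j)

  -- Transposition changes the signs of the skew matrices only, so the transpose of a combination is
  -- again one, with the same factor. This gives FᵗF from the same product rule as FFᵗ.
  conjugate : ℤ^ 5 → ℤ^ 5
  conjugate x s = sign s * x s

  similarityᵗ : ∀ x i j → (similarity x ᵗ) i j ≡ similarity (conjugate x) i j
  similarityᵗ x i j = sum-cong-≗ λ s → trans (cong (_*_ (x s)) (T-sym s j i)) (regroup (x s) (sign s) (T s i j))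
    where
    regroup : ∀ a b c → a * (b * c) ≡ b * a * c
    regroup = solve-∀

  factor-conjugate : ∀ x → factor (conjugate x) ≡ factor x
  factor-conjugate x = sum-cong-≗ λ s → trans (regroup (sign s) (x s) (scale s)) (trans (cong (_* (x s * (scale s * x s))) (sign² s)) (ℤₚ.*-identityˡ _))
    where
    regroup : ∀ e a c → e * a * (c * (e * a)) ≡ e * e * (a * (c * a))
    regroup = solve-∀

  similarityᵗ∙similarityᵗ : ∀ x i j → (similarity x ᵗ) i ∙ (similarity x ᵗ) j ≡ factor x * δ i j
  similarityᵗ∙similarityᵗ x i j = trans (∙-cong (similarityᵗ x i) (similarityᵗ x j))
    (trans (similarity∙similarity (conjugate x) i j) (cong (_* δ i j) (factor-conjugate x)))

  -- The doubled entries contribute even vectors, which lie in C₁⊥ modulo 2 for every `q`; the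
  -- coefficient `y` of U needs no doubling, since the rows of U lie there already.
  coefficients : ℤ → ℤ^ 4 → ℤ^ 5
  coefficients y q zero    = y
  coefficients y q (suc s) = + 2 * q s

  factor-coefficients : ∀ y q → factor (coefficients y q) ≡ y * (+ 6 * y) + + 4 * (q ∙ q)
  factor-coefficients y q = cong (_+_ (y * (+ 6 * y)))
    (trans (sum-cong-≗ λ s → regroup (q s)) (sym (*-distribˡ-sum (+ 4) (λ s → q s * q s))))
    where
    regroup : ∀ a → + 2 * a * (+ 1 * (+ 2 * a)) ≡ + 4 * (a * a)
    regroup = solve-∀

  similarity∈ : ∀ y q i → Dual₂ (similarity (coefficients y q) i)
  similarity∈ y q i l = subst (+ 2 ∣_) (sym (∙-⊛ (coefficients y q) (λ s → T s i) (G l)))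
    (∣m∣n⇒∣m+n (∣n⇒∣m*n y (T₀∈ i l)) (∣-∙ˡ (λ s → + 2 * q s) (λ s → G l ∙ T (suc s) i) λ s → divides (q s) (ℤₚ.*-comm (+ 2) (q s))))

  module _ (k : ℕ) .{{_ : NonZero k}} (y : ℤ) (q : ℤ^ 4)
           (norm≡2k : y * (+ 6 * y) + + 4 * (q ∙ q) ≡ + (2 ℕ.* k)) where

    private
      F = similarity (coefficients y q)

      factor≡2k : factor (coefficients y q) ≡ + (2 ℕ.* k)
      factor≡2k = trans (factor-coefficients y q) norm≡2k

      FFᵗ : ∀ i j → F i ∙ F j ≡ + (2 ℕ.* k) * δ i j
      FFᵗ i j = trans (similarity∙similarity (coefficients y q) i j) (cong (_* δ i j) factor≡2k)

      FᵗF : ∀ i j → (F ᵗ) i ∙ (F ᵗ) j ≡ + (2 ℕ.* k) * δ i j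
      FᵗF i j = trans (similarityᵗ∙similarityᵗ (coefficients y q) i j) (cong (_* δ i j) factor≡2k)

    preimage : (∀ z → ¬ (∀ j → u₀ j ≡ (z ⊛ F) j)) → ExtremalPreimage k n
    preimage = Frame.framePreimage L k F FFᵗ FᵗF (similarity∈ y q) u₀ u₀∈ u₀²≡4

    u₀∉F-even : y ≡ + 0 → ∀ z → ¬ (∀ j → u₀ j ≡ (z ⊛ F) j)
    u₀∉F-even y≡0 z eq = contradiction (trans (sym (proj₂ u₀-odd)) (∣⇒odd≡false
      (subst (+ 2 ∣_) (sym (eq j)) (∣-∙ʳ z (λ i → F i j) λ i → ∣-∙ˡ (coefficients y q) (λ s → T s i j) even)))) λ ()
      where
      j = proj₁ u₀-odd
      even : ∀ s → + 2 ∣ coefficients y q s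
      even zero    = divides (+ 0) y≡0
      even (suc s) = divides (q s) (ℤₚ.*-comm (+ 2) (q s))

    -- Integral combinations of the frame have norms divisible by 2k, so norm 4 forces k to divide
    -- 2. The value k = 2 left out here is even and falls under `u₀∉F-even`.
    u₀∉F-large : 3 ℕ.≤ k → ∀ z → ¬ (∀ j → u₀ j ≡ (z ⊛ F) j)
    u₀∉F-large 3≤k z eq = contradiction (ℕ∣.∣⇒≤ (∣⇒∣ᵤ k∣2)) (ℕₚ.<⇒≱ 3≤k)
      where
      k∣2 : + k ∣ + 2
      k∣2 = divides (z ∙ z) (ℤₚ.*-cancelˡ-≡ (+ 2) _ _ (begin
        + 4                        ≡⟨ u₀²≡4 ⟨
        u₀ ∙ u₀                    ≡⟨ ∙-cong eq eq ⟩
        (z ⊛ F) ∙ (z ⊛ F)          ≡⟨ ⊛-similarity {d = + (2 ℕ.* k)} F FFᵗ z z ⟩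
        + (2 ℕ.* k) * (z ∙ z)      ≡⟨ cong (_* (z ∙ z)) (ℤₚ.pos-* 2 k) ⟩
        + 2 * + k * (z ∙ z)        ≡⟨ trans (ℤₚ.*-assoc (+ 2) (+ k) (z ∙ z)) (cong (_*_ (+ 2)) (ℤₚ.*-comm (+ k) (z ∙ z))) ⟩
        + 2 * ((z ∙ z) * + k)        ∎))
        where open ≡-Reasoning

  private
    evenPreimage : ∀ j .{{_ : NonZero (2 ℕ.* j)}} q → q ∙ q ≡ + j → ExtremalPreimage (2 ℕ.* j) n
    evenPreimage j q q²≡j = preimage (2 ℕ.* j) (+ 0) q norm (u₀∉F-even (2 ℕ.* j) (+ 0) q norm refl)
      where
      norm : + 0 + + 4 * (q ∙ q) ≡ + (2 ℕ.* (2 ℕ.* j))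
      norm = trans (ℤₚ.+-identityˡ (+ 4 * (q ∙ q))) (trans (cong (_*_ (+ 4)) q²≡j)
        (trans (sym (ℤₚ.pos-* 4 j)) (cong +_ (ℕₚ.*-assoc 2 2 j))))

    oddPreimage : ∀ j q → q ∙ q ≡ + j → ExtremalPreimage (3 ℕ.+ 2 ℕ.* j) n
    oddPreimage j q q²≡j = preimage (3 ℕ.+ 2 ℕ.* j) (+ 1) q norm (u₀∉F-large (3 ℕ.+ 2 ℕ.* j) (+ 1) q norm (ℕₚ.m≤m+n 3 (2 ℕ.* j)))
      where
      norm : + 6 + + 4 * (q ∙ q) ≡ + (2 ℕ.* (3 ℕ.+ 2 ℕ.* j))
      norm = trans (cong (λ w → + 6 + + 4 * w) q²≡j)
        (trans (cong (_+_ (+ 6)) (sym (ℤₚ.pos-* 4 j))) (trans (sym (ℤₚ.pos-+ 6 (4 ℕ.* j)))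
          (cong +_ (sym (trans (ℕₚ.*-distribˡ-+ 2 3 (2 ℕ.* j)) (cong (6 ℕ.+_) (sym (ℕₚ.*-assoc 2 2 j))))))))

  preimages : (∀ m → ∃[ q ] (_∙_ {4} q q ≡ + m)) → ∀ k .{{_ : NonZero k}} → 2 ℕ.≤ k → ExtremalPreimage k n
  preimages fourSquares k 2≤k = Sum.[ even k , odd′ k ] (even-or-odd k 2≤k)
    where
    even : ∀ k .{{_ : NonZero k}} → ∃[ j ] k ≡ 2 ℕ.* j → ExtremalPreimage k n
    even _ (j , refl) = evenPreimage j (proj₁ (fourSquares j)) (proj₂ (fourSquares j))
    odd′ : ∀ k → ∃[ j ] k ≡ 3 ℕ.+ 2 ℕ.* j → ExtremalPreimage k n
    odd′ _ (j , refl) = oddPreimage j (proj₁ (fourSquares j)) (proj₂ (fourSquares j))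

-- The case k = 1

-- The identity HᵗD + EH = 1 modulo 2 says that the words orthogonal to the rows of H are combinations of these rows.
record BinaryCode (n : ℕ) : Set where
  field
    {rank}     : ℕ
    H D        : Fin rank → ℤ^ n
    E          : Fin n → ℤ^ rank
    2∣H∙H      : ∀ i j → + 2 ∣ H i ∙ H j
    4∣H∙H      : ∀ i → + 4 ∣ H i ∙ H i
    complete   : ∀ i j → + 2 ∣ δ i j - (((H ᵗ) i ⊛ D) j + (E i ⊛ H) j)
    weights    : nonemptySums nonzero (rows (H ᵗ)) 3 ≡ true
    octad      : ∃[ i ] H i ∙ H i ≡ + 8 × ∃[ j ] odd (H i j) ≡ true

  private
    Mem : ℤ^ n → Set
    Mem c = ∀ i → + 2 ∣ H i ∙ c

    decompose : ∀ {c} → Mem c → ∃ λ (a : ℤ^ rank) → ∃ λ (e : ℤ^ n) → ∀ i → c i ≡ (a ⊛ H) i + + 2 * e i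
    decompose {c} Mc = a , (λ i → _∣_.quotient (even i)) , λ i →
      trans (restore (c i) ((a ⊛ H) i)) (cong (_+_ ((a ⊛ H) i)) (trans (_∣_.equality (even i)) (ℤₚ.*-comm _ (+ 2))))
      where
      restore : ∀ x y → x ≡ y + (x - y)
      restore = solve-∀
      a = λ l → c ∙ D l
      b = λ l → H l ∙ c
      residual : ∀ i → c ∙ (λ j → δ i j - (((H ᵗ) i ⊛ D) j + (E i ⊛ H) j)) ≡ c i - ((a ⊛ H) i + E i ∙ b)
      residual i = trans (∙--ʳ c (δ i) _) (cong₂ _-_ (∙-δ c i) (trans (∙-+ʳ c ((H ᵗ) i ⊛ D) (E i ⊛ H))
        (cong₂ _+_ (trans (∙-⊛ ((H ᵗ) i) D c) (∙-comm ((H ᵗ) i) a)) (trans (∙-⊛ (E i) H c) (∙-congˡ (E i) λ l → ∙-comm c (H l))))))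
      even : ∀ i → + 2 ∣ c i - (a ⊛ H) i
      even i = subst (+ 2 ∣_) (cancel (c i) ((a ⊛ H) i) (E i ∙ b))
        (∣m∣n⇒∣m+n (subst (+ 2 ∣_) (residual i) (∣-∙ʳ c _ (complete i))) (∣-∙ʳ (E i) b Mc))
        where
        cancel : ∀ x y z → x - (y + z) + z ≡ x - y
        cancel = solve-∀

    selfOrthogonal : ∀ {x y} → Mem x → Mem y → + 2 ∣ x ∙ y
    selfOrthogonal {x} {y} Mx My = go (decompose Mx)
      where
      go : (∃ λ (a : ℤ^ rank) → ∃ λ (e : ℤ^ n) → ∀ i → x i ≡ (a ⊛ H) i + + 2 * e i) → + 2 ∣ x ∙ y
      go (a , e , x≡) = subst (+ 2 ∣_) (sym expand)
        (∣m∣n⇒∣m+n (∣-⊛∙ a H y My) (divides (e ∙ y) (ℤₚ.*-comm (+ 2) (e ∙ y))))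
        where
        expand : x ∙ y ≡ (a ⊛ H) ∙ y + + 2 * (e ∙ y)
        expand = trans (∙-cong x≡ (λ _ → refl))
          (trans (∙-+ˡ (a ⊛ H) (λ i → + 2 * e i) y) (cong (_+_ ((a ⊛ H) ∙ y)) (∙-*ˡ (+ 2) e y)))

    doublyEven : ∀ {x} → Mem x → + 4 ∣ x ∙ x
    doublyEven {x} Mx = go (decompose Mx)
      where
      go : (∃ λ (a : ℤ^ rank) → ∃ λ (e : ℤ^ n) → ∀ i → x i ≡ (a ⊛ H) i + + 2 * e i) → + 4 ∣ x ∙ x
      go (a , e , x≡) = subst (+ 4 ∣_) (sym expand)
        (∣m∣n⇒∣m+n (∣m∣n⇒∣m+n (2d∣norm {+ 2} a H 2∣H∙H 4∣H∙H)
          (divides ((a ⊛ H) ∙ e) (ℤₚ.*-comm (+ 4) ((a ⊛ H) ∙ e))))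
          (divides (e ∙ e) (ℤₚ.*-comm (+ 4) (e ∙ e))))
        where
        expand : x ∙ x ≡ (a ⊛ H) ∙ (a ⊛ H) + + 4 * ((a ⊛ H) ∙ e) + + 4 * (e ∙ e)
        expand = trans (∙-cong x≡ x≡)
          (trans (norm-+ (a ⊛ H) (λ i → + 2 * e i)) (cong₂ (λ p r → (a ⊛ H) ∙ (a ⊛ H) + p + r)
            (trans (cong (_*_ (+ 2)) (∙-*ʳ (+ 2) (a ⊛ H) e)) (sym (ℤₚ.*-assoc (+ 2) (+ 2) ((a ⊛ H) ∙ e))))
            (norm-* (+ 2) e)))

    -- Since norms are multiples of 4, a norm below 8 is at most 4. Hence the budget 3 in `weights`,
    -- which covers up to four odd coordinates.
    minimum : ∀ {x} → Mem x → ¬ (∀ i → + 2 ∣ x i) → + 8 ≤ x ∙ x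
    minimum {x} Mx x≢0 = ℤₚ.≮⇒≥ λ x²<8 → x≢0 (light⇒even H 3 weights x Mx (x²≤4 (doublyEven Mx) x²<8))
      where
      x²≤4 : + 4 ∣ x ∙ x → x ∙ x < + 8 → x ∙ x ≤ + 4
      x²≤4 (divides q eq) x²<8 = subst (_≤ + 4) (sym eq) (ℤₚ.*-monoʳ-≤-nonNeg (+ 4) {q} {+ 1}
        (ℤₚ.i<j⇒i≤pred[j] {q} {+ 2} (ℤₚ.*-cancelʳ-<-nonNeg {q} {+ 2} (+ 4) (subst (_< + 8) eq x²<8))))

  binaryPreimage : ExtremalPreimage 1 n
  binaryPreimage = record
    { Mem            = Mem
    ; Mem-cong       = λ x≡y Mx i → subst (+ 2 ∣_) (∙-congˡ (H i) x≡y) (Mx i)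
    ; Mem-+          = λ {x} {y} Mx My i → subst (+ 2 ∣_) (sym (∙-+ʳ (H i) x y)) (∣m∣n⇒∣m+n (Mx i) (My i))
    ; Mem-*          = λ a {x} Mx i → subst (+ 2 ∣_) (sym (∙-*ʳ a (H i) x)) (∣n⇒∣m*n a (Mx i))
    ; Mem-2k         = λ z i → ∣-∙ʳ (H i) _ λ j → divides (z j) refl
    ; selfOrthogonal = λ {x} {y} → selfOrthogonal {x} {y}
    ; dual⇒Mem       = λ x x⊥ i → subst (+ 2 ∣_) (∙-comm x (H i)) (x⊥ (H i) λ j → 2∣H∙H j i)
    ; doublyEven     = λ {x} → doublyEven {x}
    ; minimum        = λ {x} → minimum {x}
    ; attained       = H (proj₁ octad) , (λ j → 2∣H∙H j (proj₁ octad)) ,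
                       (λ ev → contradiction (trans (sym (proj₂ (proj₂ (proj₂ octad)))) (∣⇒odd≡false (ev (proj₁ (proj₂ (proj₂ octad)))))) λ ()) ,
                       proj₁ (proj₂ octad)
    }

-- Quaternionic and circulant matrices

rightMul leftMul : Vec ℤ 4 → Vec (Vec ℤ 4) 4
rightMul (a ∷ b ∷ c ∷ d ∷ []) =
  (a ∷ - b ∷ - c ∷ - d ∷ []) ∷
  (b ∷   a ∷   d ∷ - c ∷ []) ∷
  (c ∷ - d ∷   a ∷   b ∷ []) ∷
  (d ∷   c ∷ - b ∷   a ∷ []) ∷ []
leftMul (a ∷ b ∷ c ∷ d ∷ []) =
  (a ∷ - b ∷ - c ∷ - d ∷ []) ∷
  (b ∷   a ∷ - d ∷   c ∷ []) ∷
  (c ∷   d ∷   a ∷ - b ∷ []) ∷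
  (d ∷ - c ∷   b ∷   a ∷ []) ∷ []

Matrix : ℕ → ℕ → Set
Matrix r n = Vec (Vec ℤ n) r

fromBlocks : ∀ {p q} → Vec (Vec (Matrix 4 4) q) p → Matrix (p ℕ.* 4) (q ℕ.* 4)
fromBlocks = Vec.concat ∘ map (map Vec.concat ∘ Vec.transpose)

zeroBlocks : ∀ p q → Vec (Vec (Matrix 4 4) q) p
zeroBlocks p q = replicate p (replicate q (replicate 4 (replicate 4 (+ 0))))

diagonal : ∀ p → Matrix 4 4 → Vec (Vec (Matrix 4 4) p) p
diagonal p B = tabulate λ i → tabulate λ j → if does (i Finₚ.≟ j) then B else replicate 4 (replicate 4 (+ 0))

quadrants : ∀ {p} → (A B C D : Vec (Vec (Matrix 4 4) p) p) → Matrix ((p ℕ.+ p) ℕ.* 4) ((p ℕ.+ p) ℕ.* 4)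
quadrants A B C D = fromBlocks (zipWith Vec._++_ A B Vec.++ zipWith Vec._++_ C D)

-- On pairs of vectors of quaternions the matrices for suc s act by left multiplication, by the unit on the first
-- vector and by its conjugate on the second.  The matrix for zero exchanges the two vectors, and it anticommutes with
-- the imaginary units because Y acts by right multiplication.
quaternionic : ∀ {p} → Vec (Vec (Vec ℤ 4) p) p → Fin 5 → Matrix ((p ℕ.+ p) ℕ.* 4) ((p ℕ.+ p) ℕ.* 4)
quaternionic {p} Y zero = quadrants (zeroBlocks p p) (map (map (map (map (λ a → - a)) ∘ rightMul)) Y)
                                    (Vec.transpose (map (map (Vec.transpose ∘ rightMul)) Y)) (zeroBlocks p p)
quaternionic {p} Y (suc s) = quadrants (diagonal p (leftMul (unit s))) (zeroBlocks p p)
                                       (zeroBlocks p p) (diagonal p (leftMul (conj (unit s))))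
  where
  unit : Fin 4 → Vec ℤ 4
  unit s = tabulate (δ s)
  conj : Vec ℤ 4 → Vec ℤ 4
  conj (a ∷ b ∷ c ∷ d ∷ []) = a ∷ - b ∷ - c ∷ - d ∷ []

-- Decidable checks of the explicit data

-- Skips the zero entries of the first vector: the rows of the five matrices have norm 1 or 6, hence
-- at most six nonzero entries, and the product rule is checked for all pairs of rows.
dot : ∀ {n} → Vec ℤ n → Vec ℤ n → ℤ
dot []        []      = + 0
dot (+ 0 ∷ x) (_ ∷ y) = dot x y
dot (a ∷ x)   (b ∷ y) = a * b + dot x y

dot≡∙ : ∀ {n} (x y : Vec ℤ n) → dot x y ≡ lookup x ∙ lookup y
dot≡∙ []                  []      = refl
dot≡∙ (+ 0         ∷ x) (b ∷ y) = trans (dot≡∙ x y) (sym (ℤₚ.+-identityˡ _))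
dot≡∙ (+ (ℕ.suc a) ∷ x) (b ∷ y) = cong (_+_ (+ (ℕ.suc a) * b)) (dot≡∙ x y)
dot≡∙ (-[1+ a ]    ∷ x) (b ∷ y) = cong (_+_ (-[1+ a ] * b)) (dot≡∙ x y)

product? : ∀ {n} c (M N : Matrix n n) →
  Dec (∀ i j → dot (lookup M i) (lookup N j) + dot (lookup N i) (lookup M j) ≡ c * δ i j)
product? c M N = Finₚ.all? λ i → row? i (lookup M i) (lookup N i)
  where
  row? : ∀ i x y → Dec (∀ j → dot x (lookup N j) + dot y (lookup M j) ≡ c * δ i j)
  row? i x y = Finₚ.all? λ j → (dot x (lookup N j) + dot y (lookup M j)) ℤ.≟ c * δ i j

similarities? : ∀ {n} (M : Fin 5 → Matrix n n) → Dec (∀ s t i j →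
  dot (lookup (M s) i) (lookup (M t) j) + dot (lookup (M t) i) (lookup (M s) j) ≡ + 2 * (scale s * δ s t) * δ i j)
similarities? M = Finₚ.all? λ s → Finₚ.all? λ t → product? (+ 2 * (scale s * δ s t)) (M s) (M t)

entries : ∀ {r n} → Matrix r n → Fin r → ℤ^ n
entries M i j = lookup (lookup M i) j

symmetric? : ∀ {n} c (M : Matrix n n) → Dec (∀ i j → entries M i j ≡ c * entries M j i)
symmetric? c M = Finₚ.all? λ i → Finₚ.all? λ j → entries M i j ℤ.≟ c * entries M j i

gram? : ∀ {q r n} d (A : Matrix q n) (B : Matrix r n) → Dec (∀ i j → d ∣ entries A i ∙ entries B j)
gram? d A B = Finₚ.all? λ i → Finₚ.all? λ j → d ∣? entries A i ∙ entries B j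

norms? : ∀ {r n} d (A : Matrix r n) → Dec (∀ i → d ∣ entries A i ∙ entries A i)
norms? d A = Finₚ.all? λ i → d ∣? entries A i ∙ entries A i

dualBasis? : ∀ {r n} (A B : Matrix r n) → Dec (∀ i j → + 2 ∣ entries A i ∙ entries B j - δ i j)
dualBasis? A B = Finₚ.all? λ i → Finₚ.all? λ j → + 2 ∣? (entries A i ∙ entries B j - δ i j)

complete? : ∀ {r n} (H D : Matrix r n) (E : Matrix n r) →
  Dec (∀ i j → + 2 ∣ δ i j - (((entries H ᵗ) i ⊛ entries D) j + (entries E i ⊛ entries H) j))
complete? H D E = Finₚ.all? λ i → Finₚ.all? λ j → + 2 ∣? (δ i j - (((entries H ᵗ) i ⊛ entries D) j + (entries E i ⊛ entries H) j))

-- Only index 1, the identity, is symmetric; U and the three imaginary units are skew.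
quaternionicSign : Fin 5 → ℤ
quaternionicSign zero          = -[1+ 0 ]
quaternionicSign (suc zero)    = + 1
quaternionicSign (suc (suc _)) = -[1+ 0 ]

quaternionicSign² : ∀ s → quaternionicSign s * quaternionicSign s ≡ + 1
quaternionicSign² zero          = refl
quaternionicSign² (suc zero)    = refl
quaternionicSign² (suc (suc _)) = refl

-- Explicit data for lengths 32 and 40

rotate : ∀ {p} → Vec ℤ (ℕ.suc p) → Vec ℤ (ℕ.suc p)
rotate x = Vec.last x ∷ Vec.init x

circulant : ∀ {p} → Vec ℤ (ℕ.suc p) → Matrix (ℕ.suc p) (ℕ.suc p)
circulant x = Vec.iterate rotate x _

identity zeros : ∀ p → Matrix p p
identity p = tabulate λ i → tabulate (δ i)
zeros p    = replicate p (replicate p (+ 0))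

indicator : ∀ {n} → List ℕ → Vec ℤ n
indicator ps = tabulate λ j → if any (ℕ._≡ᵇ toℕ j) ps then + 1 else + 0

digits : ∀ {n} → Vec ℕ n → Vec ℤ n
digits = map (λ a → + a)

𝟎 𝟏 𝐢 𝐣 𝐤 : Vec ℤ 4
𝟎 = digits (0 ∷ 0 ∷ 0 ∷ 0 ∷ [])
𝟏 = digits (1 ∷ 0 ∷ 0 ∷ 0 ∷ [])
𝐢 = digits (0 ∷ 1 ∷ 0 ∷ 0 ∷ [])
𝐣 = digits (0 ∷ 0 ∷ 1 ∷ 0 ∷ [])
𝐤 = digits (0 ∷ 0 ∷ 0 ∷ 1 ∷ [])

infixl 6 _⊞_ _⊟_
_⊞_ _⊟_ : Vec ℤ 4 → Vec ℤ 4 → Vec ℤ 4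
_⊞_ = zipWith _+_
_⊟_ = zipWith _-_

-- The generators reduce modulo 2 to the Reed–Muller code RM(1,5); the quaternionic matrix Y with YY* = 6 was found
-- by a search among those whose rows and columns are words of its dual.
quaternions₃₂ : Vec (Vec (Vec ℤ 4) 4) 4
quaternions₃₂ =
  (𝟏 ⊟ 𝐣 ⊟ 𝐤 ∷ 𝐤 ∷ 𝟏 ∷ 𝟎 ⊟ 𝐣 ∷ []) ∷
  (𝐢 ∷ 𝟎 ⊟ 𝟏 ∷ 𝐤 ∷ 𝟎 ⊟ 𝟏 ⊞ 𝐢 ⊟ 𝐤 ∷ []) ∷
  (𝐤 ∷ 𝐣 ∷ 𝟏 ⊟ 𝐢 ⊟ 𝐤 ∷ 𝟎 ⊟ 𝐤 ∷ []) ∷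
  (𝐤 ∷ 𝟏 ⊟ 𝐣 ⊞ 𝐤 ∷ 𝐢 ∷ 𝟎 ⊟ 𝐤 ∷ []) ∷ []

-- The rows are the constant 1 and the five binary digits of the position. Evaluation at 0 singles
-- out the constant, and comparison of position 0 with a power of 2 singles out one digit.
generators₃₂ dualVectors₃₂ : Matrix 6 32
generators₃₂ =
  digits (1 ∷ 1 ∷ 1 ∷ 1 ∷ 1 ∷ 1 ∷ 1 ∷ 1 ∷ 1 ∷ 1 ∷ 1 ∷ 1 ∷ 1 ∷ 1 ∷ 1 ∷ 1 ∷ 1 ∷ 1 ∷ 1 ∷ 1 ∷ 1 ∷ 1 ∷ 1 ∷ 1 ∷ 1 ∷ 1 ∷ 1 ∷ 1 ∷ 1 ∷ 1 ∷ 1 ∷ 1 ∷ []) ∷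
  digits (0 ∷ 1 ∷ 0 ∷ 1 ∷ 0 ∷ 1 ∷ 0 ∷ 1 ∷ 0 ∷ 1 ∷ 0 ∷ 1 ∷ 0 ∷ 1 ∷ 0 ∷ 1 ∷ 0 ∷ 1 ∷ 0 ∷ 1 ∷ 0 ∷ 1 ∷ 0 ∷ 1 ∷ 0 ∷ 1 ∷ 0 ∷ 1 ∷ 0 ∷ 1 ∷ 0 ∷ 1 ∷ []) ∷
  digits (0 ∷ 0 ∷ 1 ∷ 1 ∷ 0 ∷ 0 ∷ 1 ∷ 1 ∷ 0 ∷ 0 ∷ 1 ∷ 1 ∷ 0 ∷ 0 ∷ 1 ∷ 1 ∷ 0 ∷ 0 ∷ 1 ∷ 1 ∷ 0 ∷ 0 ∷ 1 ∷ 1 ∷ 0 ∷ 0 ∷ 1 ∷ 1 ∷ 0 ∷ 0 ∷ 1 ∷ 1 ∷ []) ∷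
  digits (0 ∷ 0 ∷ 0 ∷ 0 ∷ 1 ∷ 1 ∷ 1 ∷ 1 ∷ 0 ∷ 0 ∷ 0 ∷ 0 ∷ 1 ∷ 1 ∷ 1 ∷ 1 ∷ 0 ∷ 0 ∷ 0 ∷ 0 ∷ 1 ∷ 1 ∷ 1 ∷ 1 ∷ 0 ∷ 0 ∷ 0 ∷ 0 ∷ 1 ∷ 1 ∷ 1 ∷ 1 ∷ []) ∷
  digits (0 ∷ 0 ∷ 0 ∷ 0 ∷ 0 ∷ 0 ∷ 0 ∷ 0 ∷ 1 ∷ 1 ∷ 1 ∷ 1 ∷ 1 ∷ 1 ∷ 1 ∷ 1 ∷ 0 ∷ 0 ∷ 0 ∷ 0 ∷ 0 ∷ 0 ∷ 0 ∷ 0 ∷ 1 ∷ 1 ∷ 1 ∷ 1 ∷ 1 ∷ 1 ∷ 1 ∷ 1 ∷ []) ∷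
  digits (0 ∷ 0 ∷ 0 ∷ 0 ∷ 0 ∷ 0 ∷ 0 ∷ 0 ∷ 0 ∷ 0 ∷ 0 ∷ 0 ∷ 0 ∷ 0 ∷ 0 ∷ 0 ∷ 1 ∷ 1 ∷ 1 ∷ 1 ∷ 1 ∷ 1 ∷ 1 ∷ 1 ∷ 1 ∷ 1 ∷ 1 ∷ 1 ∷ 1 ∷ 1 ∷ 1 ∷ 1 ∷ []) ∷ []
dualVectors₃₂ = indicator (0 ∷ []) ∷ indicator (0 ∷ 1 ∷ []) ∷ indicator (0 ∷ 2 ∷ []) ∷ indicator (0 ∷ 4 ∷ []) ∷ indicator (0 ∷ 8 ∷ []) ∷ indicator (0 ∷ 16 ∷ []) ∷ []

lattice₃₂ : Lattice 32
lattice₃₂ = record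
  { G           = entries generators₃₂
  ; D           = entries dualVectors₃₂
  ; 4∣G∙G       = toWitness {a? = gram? (+ 4) generators₃₂ generators₃₂} _
  ; 8∣G∙G       = toWitness {a? = norms? (+ 8) generators₃₂} _
  ; G∙D         = toWitness {a? = dualBasis? generators₃₂ dualVectors₃₂} _
  ; allOnes     = zero , toWitness {a? = Finₚ.all? λ j → odd (entries generators₃₂ zero j) Boolₚ.≟ true} _
  ; wordWeights = refl
  ; dualWeights = refl
  }

similarities₃₂ : Similarities lattice₃₂
similarities₃₂ = record
  { T         = T
  ; sign      = quaternionicSign
  ; sign²     = quaternionicSign²
  ; T-sym     = toWitness {a? = Finₚ.all? λ s → symmetric? (quaternionicSign s) (quaternionic quaternions₃₂ s)} _
  ; T-product = λ s t i j → trans (sym (cong₂ _+_ (dot≡∙ (row s i) (row t j)) (dot≡∙ (row t i) (row s j))))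
      (toWitness {a? = similarities? (quaternionic quaternions₃₂)} _ s t i j)
  ; T₀∈       = λ i l → toWitness {a? = gram? (+ 2) generators₃₂ (quaternionic quaternions₃₂ zero)} _ l i
  ; u₀        = lookup u
  ; u₀∈       = λ i → toWitness {a? = gram? (+ 2) generators₃₂ (u ∷ [])} _ i zero
  ; u₀²≡4     = refl
  ; u₀-odd    = zero , refl
  }
  where
  -- An affine plane, hence a word of minimum weight in the dual RM(3,5).
  u : Vec ℤ 32
  u = indicator (0 ∷ 1 ∷ 2 ∷ 3 ∷ [])
  T : Fin 5 → Fin 32 → ℤ^ 32
  T s = entries (quaternionic quaternions₃₂ s)
  row : Fin 5 → Fin 32 → Vec ℤ 32
  row s = lookup (quaternionic quaternions₃₂ s)

-- The first row has weight 7, so that the rows of (I | C) have weight 8 and attain the minimum.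
circulant₃₂ : Matrix 16 16
circulant₃₂ = circulant (digits (1 ∷ 1 ∷ 1 ∷ 1 ∷ 1 ∷ 0 ∷ 1 ∷ 0 ∷ 0 ∷ 1 ∷ 0 ∷ 0 ∷ 0 ∷ 0 ∷ 0 ∷ 0 ∷ []))

parityChecks₃₂ : Matrix 16 32
parityChecks₃₂ = zipWith Vec._++_ (identity 16) circulant₃₂

binaryCode₃₂ : BinaryCode 32
binaryCode₃₂ = record
  { H        = entries parityChecks₃₂
  ; D        = entries D
  ; E        = entries E
  ; 2∣H∙H    = toWitness {a? = gram? (+ 2) parityChecks₃₂ parityChecks₃₂} _
  ; 4∣H∙H    = toWitness {a? = norms? (+ 4) parityChecks₃₂} _
  ; complete = toWitness {a? = complete? parityChecks₃₂ D E} _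
  ; weights  = refl
  ; octad    = zero , refl , zero , refl
  }
  where
  -- With H = (I | C), the block rows of HᵗD + EH are (I | 0) and (2Cᵗ | CᵗC); this is the identity
  -- modulo 2 because CᵗC is.
  D : Matrix 16 32
  D = zipWith Vec._++_ (identity 16) (zeros 16)
  E : Matrix 32 16
  E = zeros 16 Vec.++ Vec.transpose circulant₃₂

-- Found by computer: first Y with YY* = 6, then a doubly even [40,8,16] code orthogonal to the rows and columns of
-- Y, then generators of a lift to ℤ/4, in which 3 stands for − 1.
quaternions₄₀ : Vec (Vec (Vec ℤ 4) 5) 5
quaternions₄₀ =
  (𝟏 ∷ 𝐢 ⊟ 𝐣 ∷ 𝐣 ∷ 𝟏 ∷ 𝐤 ∷ []) ∷
  (𝟏 ⊞ 𝐤 ∷ 𝟎 ∷ 𝟎 ⊟ 𝟏 ∷ 𝟎 ⊟ 𝐣 ⊟ 𝐤 ∷ 𝟎 ⊟ 𝐤 ∷ []) ∷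
  (𝟎 ∷ 𝟏 ⊞ 𝐢 ∷ 𝟏 ⊟ 𝐤 ∷ 𝟎 ∷ 𝟎 ⊟ 𝟏 ⊟ 𝐤 ∷ []) ∷
  (𝐣 ∷ 𝟎 ⊟ 𝟏 ⊟ 𝐤 ∷ 𝐣 ∷ 𝐣 ∷ 𝟎 ⊟ 𝐤 ∷ []) ∷
  (𝐣 ⊞ 𝐤 ∷ 𝟎 ∷ 𝟏 ∷ 𝟎 ⊟ 𝟏 ⊟ 𝐤 ∷ 𝐤 ∷ []) ∷ []

generators₄₀ dualVectors₄₀ : Matrix 8 40
generators₄₀ =
  digits (1 ∷ 1 ∷ 1 ∷ 1 ∷ 1 ∷ 1 ∷ 1 ∷ 1 ∷ 1 ∷ 1 ∷ 1 ∷ 1 ∷ 1 ∷ 1 ∷ 1 ∷ 1 ∷ 1 ∷ 1 ∷ 1 ∷ 1 ∷ 1 ∷ 1 ∷ 1 ∷ 1 ∷ 1 ∷ 1 ∷ 1 ∷ 1 ∷ 1 ∷ 1 ∷ 1 ∷ 1 ∷ 1 ∷ 1 ∷ 1 ∷ 1 ∷ 1 ∷ 1 ∷ 1 ∷ 1 ∷ []) ∷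
  digits (2 ∷ 0 ∷ 1 ∷ 0 ∷ 1 ∷ 0 ∷ 0 ∷ 1 ∷ 0 ∷ 0 ∷ 0 ∷ 0 ∷ 3 ∷ 0 ∷ 0 ∷ 0 ∷ 0 ∷ 0 ∷ 1 ∷ 1 ∷ 1 ∷ 0 ∷ 1 ∷ 1 ∷ 0 ∷ 1 ∷ 1 ∷ 0 ∷ 1 ∷ 1 ∷ 1 ∷ 0 ∷ 1 ∷ 0 ∷ 1 ∷ 1 ∷ 1 ∷ 1 ∷ 0 ∷ 1 ∷ []) ∷
  digits (2 ∷ 1 ∷ 1 ∷ 0 ∷ 1 ∷ 1 ∷ 3 ∷ 0 ∷ 1 ∷ 0 ∷ 1 ∷ 0 ∷ 0 ∷ 0 ∷ 1 ∷ 1 ∷ 0 ∷ 1 ∷ 0 ∷ 0 ∷ 1 ∷ 1 ∷ 1 ∷ 0 ∷ 0 ∷ 1 ∷ 0 ∷ 1 ∷ 1 ∷ 0 ∷ 0 ∷ 1 ∷ 0 ∷ 1 ∷ 0 ∷ 0 ∷ 1 ∷ 1 ∷ 0 ∷ 0 ∷ []) ∷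
  digits (0 ∷ 0 ∷ 0 ∷ 3 ∷ 0 ∷ 0 ∷ 0 ∷ 1 ∷ 1 ∷ 0 ∷ 1 ∷ 2 ∷ 0 ∷ 0 ∷ 0 ∷ 1 ∷ 1 ∷ 1 ∷ 1 ∷ 0 ∷ 1 ∷ 0 ∷ 1 ∷ 1 ∷ 1 ∷ 0 ∷ 1 ∷ 0 ∷ 0 ∷ 0 ∷ 1 ∷ 0 ∷ 1 ∷ 0 ∷ 1 ∷ 1 ∷ 1 ∷ 1 ∷ 1 ∷ 0 ∷ []) ∷
  digits (2 ∷ 0 ∷ 1 ∷ 3 ∷ 1 ∷ 0 ∷ 0 ∷ 1 ∷ 0 ∷ 0 ∷ 1 ∷ 1 ∷ 2 ∷ 0 ∷ 1 ∷ 1 ∷ 2 ∷ 1 ∷ 1 ∷ 0 ∷ 1 ∷ 0 ∷ 0 ∷ 0 ∷ 1 ∷ 0 ∷ 0 ∷ 1 ∷ 1 ∷ 1 ∷ 0 ∷ 1 ∷ 1 ∷ 0 ∷ 0 ∷ 0 ∷ 1 ∷ 1 ∷ 1 ∷ 0 ∷ []) ∷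
  digits (2 ∷ 3 ∷ 0 ∷ 3 ∷ 0 ∷ 0 ∷ 0 ∷ 0 ∷ 0 ∷ 0 ∷ 1 ∷ 1 ∷ 2 ∷ 1 ∷ 0 ∷ 1 ∷ 3 ∷ 1 ∷ 1 ∷ 1 ∷ 0 ∷ 1 ∷ 1 ∷ 1 ∷ 1 ∷ 0 ∷ 1 ∷ 0 ∷ 1 ∷ 1 ∷ 0 ∷ 0 ∷ 0 ∷ 2 ∷ 1 ∷ 0 ∷ 1 ∷ 0 ∷ 0 ∷ 1 ∷ []) ∷
  digits (2 ∷ 2 ∷ 2 ∷ 1 ∷ 3 ∷ 1 ∷ 0 ∷ 0 ∷ 1 ∷ 1 ∷ 1 ∷ 3 ∷ 2 ∷ 1 ∷ 0 ∷ 0 ∷ 3 ∷ 0 ∷ 0 ∷ 1 ∷ 0 ∷ 0 ∷ 0 ∷ 1 ∷ 0 ∷ 1 ∷ 0 ∷ 1 ∷ 1 ∷ 1 ∷ 0 ∷ 0 ∷ 1 ∷ 2 ∷ 1 ∷ 1 ∷ 0 ∷ 1 ∷ 1 ∷ 0 ∷ []) ∷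
  digits (0 ∷ 1 ∷ 0 ∷ 0 ∷ 0 ∷ 1 ∷ 2 ∷ 0 ∷ 0 ∷ 1 ∷ 1 ∷ 0 ∷ 2 ∷ 1 ∷ 0 ∷ 0 ∷ 0 ∷ 1 ∷ 0 ∷ 0 ∷ 1 ∷ 0 ∷ 1 ∷ 1 ∷ 1 ∷ 0 ∷ 0 ∷ 1 ∷ 0 ∷ 1 ∷ 1 ∷ 1 ∷ 0 ∷ 1 ∷ 0 ∷ 0 ∷ 0 ∷ 1 ∷ 0 ∷ 0 ∷ []) ∷ []
-- Each pair marks two columns of the generators that differ modulo 2 in exactly one row; column 0
-- is nonzero modulo 2 in the all-ones row only.
dualVectors₄₀ = indicator (0 ∷ []) ∷ indicator (0 ∷ 12 ∷ []) ∷ indicator (0 ∷ 6 ∷ []) ∷ indicator (3 ∷ 11 ∷ []) ∷ indicator (3 ∷ 16 ∷ []) ∷ indicator (1 ∷ 33 ∷ []) ∷ indicator (2 ∷ 4 ∷ []) ∷ indicator (1 ∷ 21 ∷ []) ∷ []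

lattice₄₀ : Lattice 40
lattice₄₀ = record
  { G           = entries generators₄₀
  ; D           = entries dualVectors₄₀
  ; 4∣G∙G       = toWitness {a? = gram? (+ 4) generators₄₀ generators₄₀} _
  ; 8∣G∙G       = toWitness {a? = norms? (+ 8) generators₄₀} _
  ; G∙D         = toWitness {a? = dualBasis? generators₄₀ dualVectors₄₀} _
  ; allOnes     = zero , toWitness {a? = Finₚ.all? λ j → odd (entries generators₄₀ zero j) Boolₚ.≟ true} _
  ; wordWeights = refl
  ; dualWeights = refl
  }

similarities₄₀ : Similarities lattice₄₀
similarities₄₀ = record
  { T         = T
  ; sign      = quaternionicSign
  ; sign²     = quaternionicSign²
  ; T-sym     = toWitness {a? = Finₚ.all? λ s → symmetric? (quaternionicSign s) (quaternionic quaternions₄₀ s)} _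
  ; T-product = λ s t i j → trans (sym (cong₂ _+_ (dot≡∙ (row s i) (row t j)) (dot≡∙ (row t i) (row s j))))
      (toWitness {a? = similarities? (quaternionic quaternions₄₀)} _ s t i j)
  ; T₀∈       = λ i l → toWitness {a? = gram? (+ 2) generators₄₀ (quaternionic quaternions₄₀ zero)} _ l i
  ; u₀        = lookup u
  ; u₀∈       = λ i → toWitness {a? = gram? (+ 2) generators₄₀ (u ∷ [])} _ i zero
  ; u₀²≡4     = refl
  ; u₀-odd    = zero , refl
  }
  where
  u : Vec ℤ 40
  u = indicator (0 ∷ 1 ∷ 4 ∷ 29 ∷ [])
  T : Fin 5 → Fin 40 → ℤ^ 40
  T s = entries (quaternionic quaternions₄₀ s)
  row : Fin 5 → Fin 40 → Vec ℤ 40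
  row s = lookup (quaternionic quaternions₄₀ s)

circulant₄₀ : Matrix 20 20
circulant₄₀ = circulant (digits (1 ∷ 1 ∷ 1 ∷ 0 ∷ 0 ∷ 0 ∷ 1 ∷ 1 ∷ 0 ∷ 1 ∷ 1 ∷ 0 ∷ 0 ∷ 0 ∷ 0 ∷ 0 ∷ 0 ∷ 0 ∷ 0 ∷ 0 ∷ []))

parityChecks₄₀ : Matrix 20 40
parityChecks₄₀ = zipWith Vec._++_ (identity 20) circulant₄₀

binaryCode₄₀ : BinaryCode 40
binaryCode₄₀ = record
  { H        = entries parityChecks₄₀
  ; D        = entries D
  ; E        = entries E
  ; 2∣H∙H    = toWitness {a? = gram? (+ 2) parityChecks₄₀ parityChecks₄₀} _
  ; 4∣H∙H    = toWitness {a? = norms? (+ 4) parityChecks₄₀} _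
  ; complete = toWitness {a? = complete? parityChecks₄₀ D E} _
  ; weights  = refl
  ; octad    = zero , refl , zero , refl
  }
  where
  D : Matrix 20 40
  D = zipWith Vec._++_ (identity 20) (zeros 20)
  E : Matrix 40 20
  E = zeros 20 Vec.++ Vec.transpose circulant₄₀

extremalPreimage : ∀ {n} {L : Lattice n} → BinaryCode n → Similarities L → ∀ k .{{_ : NonZero k}} → ExtremalPreimage k n
extremalPreimage B S 1                     = BinaryCode.binaryPreimage B
extremalPreimage B S k@(ℕ.suc (ℕ.suc _)) = Similarities.preimages S fourSquares k (s≤s (s≤s z≤n))

theorem4p3 : (k : ℕ) .{{_ : NonZero k}} →
    (∃[ C ] Extremal k {32} C) × (∃[ C ] Extremal k {40} C)
theorem4p3 k = extremalCode k (ℕₚ.m≤m+n 32 104) refl (extremalPreimage binaryCode₃₂ similarities₃₂ k)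
             , extremalCode k (ℕₚ.m≤m+n 40 96) refl (extremalPreimage binaryCode₄₀ similarities₄₀ k)
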